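{- There exists a constant $c_2 > 0$ such that $$s(n) = O\left(\frac{n^2}{(\log n)^{c_2}}\right),$$ i.e. there is a constant $K>0$ with $s(n) \le K n^2 (\log n)^{ -c_2}$ for all sufficiently large $n$.
   Context: A skew corner is a configuration of points of the form $(x,y),(x,y+d),(x+d,y')$ with $x,y,y',d \in \mathbb{Z}$; it is non-trivial if $d \neq 0$. A subset of $\mathbb{Z}^2$ is skew corner-free if it contains no non-trivial skew corner. For a positive integer $n$, $[n]=\{1,\dots,n\}$ and $s(n)$ denotes the largest size of a skew corner-free subset of $[n]^2$. -}

module Defs where

open import Data.Nat as ℕ using (ℕ)
open import Data.Integer as ℤ using (ℤ; +_; _+_; _≤_)
open import Data.Product using (_×_; _,_)
open import Data.List using (List)
open import Data.List.Membership.Propositional using (_∈_)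
open import Relation.Binary.PropositionalEquality using (_≢_)
open import Data.Empty using (⊥)

InGrid : ℕ → ℤ × ℤ → Set
InGrid n (x , y) = (+ 1 ≤ x × x ≤ + n) × (+ 1 ≤ y × y ≤ + n)

SkewCornerFree : List (ℤ × ℤ) → Set
SkewCornerFree A =
  ∀ (x y y′ d : ℤ) → d ≢ + 0 →
  (x , y) ∈ A → (x , y + d) ∈ A → (x + d , y′) ∈ A → ⊥

{-# OPTIONS --safe #-}
module Submission where

-- A density increment argument in the style of Heath-Brown and Szemerédi.  At scale n = 2 ^ h let
-- A_x be the columns of the set, f (x) = |A_x|, δ the density and F = f - δ n 1_I the balanced
-- function.  If x and x + d are distinct nonempty columns then d is not a difference of two elements
-- of A_x, so Σ F (x + y′ - y) over y, y′ ∈ A_x is very negative and therefore Σ |F^| |A_x^|² is large.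
-- Split the frequencies by the size of F^.  By Dirichlet's theorem, k frequencies are all
-- trivialised by a progression of step q and length n ^ (1 / O(k)).  If a level set of F^ has many
-- elements, or a single element at the top level, then f itself has larger density on a translate of
-- this progression; otherwise every level set is small, and on the average over x the columns A_x
-- have larger density on translates (depending on x) of a common progression.  Restricting x and all
-- columns to progressions with the same step preserves skew corner-freeness, so in either case one
-- passes to scale n ^ (1 / O(k)) with the density multiplied by a power of k (by a fixed constant > 1
-- if k = 1).  Hence δ ^ q log n does not decrease for a suitable q, and no further step is possible
-- only if log n is at most a power of 1 / δ.
--
-- The Fourier analysis takes place over ℚ: characters of ℤ / 2 ^ m are powers of a Gaussian rational
-- z of modulus exactly 1 with z ^ (2 ^ (m - 1)) very close to -1, so that orthogonality holds up to
-- an arbitrarily small error.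

open import Defs
open import Data.Bool using (Bool; true; false; T; _∧_)
open import Data.Bool.Properties using (T-∧; T-≡)
open import Data.Empty using (⊥; ⊥-elim)
open import Data.Fin.Base using (Fin; toℕ; fromℕ; inject₁; combine) renaming (zero to fzero)
open import Data.Fin.Properties using (toℕ-inject₁; toℕ-fromℕ; toℕ<n; pigeonhole; combine-injective)
open import Data.Integer using (ℤ)
import Data.Integer as ℤ
import Data.Integer.Properties as ℤₚ
import Data.Integer.Tactic.RingSolver as ℤS
open import Data.List using (List; []; _∷_; length; take)
open import Data.List.Membership.Propositional using (_∈_)
import Data.List.Membership.DecPropositional as DecMembership
open import Data.List.Properties using (take-all; length-take)
open import Data.List.Relation.Unary.All as All using (All; []; _∷_)
open import Data.List.Relation.Unary.All.Properties using (All¬⇒¬Any) renaming (take⁺ to All-take)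
open import Data.List.Relation.Unary.AllPairs using ([]; _∷_)
open import Data.List.Relation.Unary.Any using (here; there)
open import Data.List.Relation.Unary.Unique.Propositional using (Unique)
open import Data.Maybe.Base using (Maybe; just; nothing)
open import Data.Nat as ℕ using (ℕ; zero; suc)
open import Data.Nat.Coprimality using (1-coprimeTo) renaming (sym to coprime-sym)
open import Data.Nat.DivMod using (m/n*n≤m; m≡m%n+[m/n]*n; m%n<n; m≥n⇒m/n>0)
open import Data.Nat.Induction using (<-rec)
open import Data.Nat.Logarithm using (⌊log₂_⌋; ⌊log₂⌋-mono-≤; ⌊log₂[2^n]⌋≡n)
import Data.Nat.Properties as ℕₚ
import Data.Nat.Tactic.RingSolver as ℕS
open import Data.Product using (_×_; _,_; proj₁; proj₂; ∃-syntax)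
open import Data.Product.Properties using (≡-dec)
open import Data.Rational
open import Data.Rational.Properties
open import Data.Sum using (_⊎_; inj₁; inj₂)
open import Data.Unit using (tt)
open import Function.Bundles using (Equivalence)
open import Level using (0ℓ)
open import Relation.Binary.Definitions using (tri<; tri≈; tri>)
open import Relation.Binary.PropositionalEquality
open import Relation.Nullary using (¬_; Dec; yes; no; does)
open import Relation.Nullary.Decidable using (True; toWitness)
open import Tactic.RingSolver using (solve-∀)
open import Tactic.RingSolver.Core.AlmostCommutativeRing using (AlmostCommutativeRing; fromCommutativeRing)

-- Rational arithmetic

-- A skew corner compares two heights only inside one column, so nothing changes when every column
-- is translated vertically by its own amount. This is why each column may choose its own best
-- translate of the common progression. One subset built from these choices serves both alternatives
-- of the increment: no translate gives `f` a larger density than this subset has, up to the loss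
-- from the margin, and its density also bounds the columns on average. The proof therefore never
-- decides which increment occurs: at a least bad scale all such subsets have density at most ρ δ,
-- and this bound is fed into the Fourier argument. Translates must not leave the domain, so the set
-- is first moved into a window with a margin of proportion 2 ^ (- s), at the price of factors 1 +
-- O(2 ^ (- s)). Since ℚ has no square roots, moduli occur squared or are replaced by the norm |re|
-- + |im|.

isZero? : ∀ x → Maybe (0ℚ ≡ x)
isZero? x with 0ℚ ≟ x
... | yes p = just p
... | no _  = nothing

ℚ-ring : AlmostCommutativeRing 0ℓ 0ℓ
ℚ-ring = fromCommutativeRing +-*-commutativeRing isZero?

¼ 2ℚ 4ℚ 8ℚ : ℚ
¼  = ½ * ½
2ℚ = 1ℚ + 1ℚ
4ℚ = 2ℚ + 2ℚ
8ℚ = 4ℚ + 4ℚ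

≤! : ∀ {p q} {_ : True (p ≤? q)} → p ≤ q
≤! {_} {_} {t} = toWitness t

<! : ∀ {p q} {_ : True (p <? q)} → p < q
<! {_} {_} {t} = toWitness t

-- The workhorse for inequalities: the slack `t` is written as a visibly nonnegative expression, and
-- the equation is left to the ring solver.
≤-add : ∀ {a b} t → 0ℚ ≤ t → a + t ≡ b → a ≤ b
≤-add {a} t 0≤t refl = subst (_≤ a + t) (+-identityʳ a) (+-monoʳ-≤ a 0≤t)

0≤- : ∀ {a b} → a ≤ b → 0ℚ ≤ b - a
0≤- {a} {b} a≤b = subst (_≤ b - a) (+-inverseʳ a) (+-monoˡ-≤ (- a) a≤b)

0≤+ : ∀ {a b} → 0ℚ ≤ a → 0ℚ ≤ b → 0ℚ ≤ a + b
0≤+ = +-mono-≤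

0≤* : ∀ {a b} → 0ℚ ≤ a → 0ℚ ≤ b → 0ℚ ≤ a * b
0≤* {a} {b} p q = subst (_≤ a * b) (*-zeroʳ a) (*-monoˡ-≤-nonNeg a {{nonNegative p}} q)

0<* : ∀ {a b} → 0ℚ < a → 0ℚ < b → 0ℚ < a * b
0<* {a} {b} p q = subst (_< a * b) (*-zeroʳ a) (*-monoʳ-<-pos a {{positive p}} q)

*-monoˡ : ∀ {a b} c → 0ℚ ≤ c → a ≤ b → c * a ≤ c * b
*-monoˡ c p = *-monoˡ-≤-nonNeg c {{nonNegative p}}

*-mono : ∀ {a b c d} → 0ℚ ≤ a → a ≤ b → 0ℚ ≤ c → c ≤ d → a * c ≤ b * d
*-mono {a} {b} {c} {d} 0≤a a≤b 0≤c c≤d =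
  ≤-trans (*-monoʳ-≤-nonNeg c {{nonNegative 0≤c}} a≤b) (*-monoˡ b (≤-trans 0≤a a≤b) c≤d)

*-cancelˡ : ∀ {a b} c → 0ℚ < c → c * a ≤ c * b → a ≤ b
*-cancelˡ c p = *-cancelˡ-≤-pos c {{positive p}}

neg-involutive : ∀ a → - (- a) ≡ a
neg-involutive = solve-∀ ℚ-ring

neg-sq : ∀ a → - a * - a ≡ a * a
neg-sq = solve-∀ ℚ-ring

0≤sq : ∀ a → 0ℚ ≤ a * a
0≤sq a with ≤-total 0ℚ a
... | inj₁ p = 0≤* p p
... | inj₂ p = subst (0ℚ ≤_) (neg-sq a) (0≤* (neg-antimono-≤ p) (neg-antimono-≤ p))

-- Replaces square roots: bounds on moduli are carried as squares and undone here.
sq-cancel-≤ : ∀ {a b} → 0ℚ ≤ b → a * a ≤ b * b → a ≤ b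
sq-cancel-≤ {a} {b} 0≤b p with a ≤? b
... | yes q = q
... | no ¬q = ⊥-elim (<-irrefl refl (<-≤-trans lt p))
  where
  b<a : b < a
  b<a = ≰⇒> ¬q
  lt : b * b < a * a
  lt = ≤-<-trans (*-monoˡ b 0≤b (<⇒≤ b<a)) (*-monoˡ-<-pos a {{positive (≤-<-trans 0≤b b<a)}} b<a)

abstract
  inverse : ∀ c → 0ℚ < c → ∃[ r ] (0ℚ < r × c * r ≡ 1ℚ)
  inverse c 0<c = 1/_ c {{nz}} , positive⁻¹ _ {{1/pos⇒pos c {{positive 0<c}}}} , *-inverseʳ c {{nz}}
    where
    nz : NonZero c
    nz = pos⇒nonZero c {{positive 0<c}}

ι : ℕ → ℚ
ι zero    = 0ℚ
ι (suc n) = 1ℚ + ι n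

0≤ι : ∀ n → 0ℚ ≤ ι n
0≤ι zero    = ≤-refl
0≤ι (suc n) = 0≤+ (≤! {0ℚ} {1ℚ}) (0≤ι n)

ι-+ : ∀ m n → ι (m ℕ.+ n) ≡ ι m + ι n
ι-+ zero    n = sym (+-identityˡ (ι n))
ι-+ (suc m) n = trans (cong (1ℚ +_) (ι-+ m n)) (sym (+-assoc 1ℚ (ι m) (ι n)))

ι-* : ∀ m n → ι (m ℕ.* n) ≡ ι m * ι n
ι-* zero    n = sym (*-zeroˡ (ι n))
ι-* (suc m) n = trans (ι-+ n (m ℕ.* n)) (trans (cong (λ t → ι n + t) (ι-* m n)) (eq (ι m) (ι n)))
  where
  eq : ∀ x y → y + x * y ≡ (1ℚ + x) * y
  eq = solve-∀ ℚ-ring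

ι-mono : ∀ {m n} → m ℕ.≤ n → ι m ≤ ι n
ι-mono {n = n} ℕ.z≤n = 0≤ι n
ι-mono (ℕ.s≤s p)     = +-monoʳ-≤ 1ℚ (ι-mono p)

ι-mono-< : ∀ {m n} → m ℕ.< n → ι m < ι n
ι-mono-< {m} {n} m<n = <-≤-trans (subst (_< 1ℚ + ι m) (+-identityˡ (ι m)) (+-monoˡ-< (ι m) (<! {0ℚ} {1ℚ}))) (ι-mono m<n)

ι-cancel-≤ : ∀ {m n} → ι m ≤ ι n → m ℕ.≤ n
ι-cancel-≤ {m} {n} p with m ℕₚ.≤? n
... | yes q = q
... | no ¬q = ⊥-elim (<-irrefl refl (<-≤-trans (ι-mono-< (ℕₚ.≰⇒> ¬q)) p))

-- Needed only for `archimedean`, which reads off the numerator of a fraction.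
ι-mkℚ : ∀ n → ι n ≡ mkℚ (ℤ.+ n) 0 (coprime-sym (1-coprimeTo n))
ι-mkℚ zero    = refl
ι-mkℚ (suc n) = trans (cong (1ℚ +_) (ι-mkℚ n))
  (trans (cong (_/ 1) (cong (ℤ._+_ (ℤ.+ 1)) (ℤₚ.*-identityʳ (ℤ.+ n)))) (↥p/↧p≡p (mkℚ (ℤ.+ suc n) 0 _)))

-- Powers and finite sums

archimedean : ∀ x → ∃[ M ] x ≤ ι M
-- The numerator itself is a bound, the denominator being at least 1.
archimedean x@(mkℚ (ℤ.+ k) d _) = k , subst (x ≤_) (sym (ι-mkℚ k))
  (*≤* (ℤₚ.*-monoˡ-≤-nonNeg (ℤ.+ k) (ℤ.+≤+ (ℕ.s≤s ℕ.z≤n))))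
archimedean x@(mkℚ ℤ.-[1+ k ] d _) = 0 , <⇒≤ (negative⁻¹ x)

infixr 8 _^ℚ_
_^ℚ_ : ℚ → ℕ → ℚ
x ^ℚ zero  = 1ℚ
x ^ℚ suc k = x * x ^ℚ k

^ℚ-+ : ∀ x m n → x ^ℚ (m ℕ.+ n) ≡ x ^ℚ m * x ^ℚ n
^ℚ-+ x zero    n = sym (*-identityˡ _)
^ℚ-+ x (suc m) n = trans (cong (x *_) (^ℚ-+ x m n)) (sym (*-assoc x (x ^ℚ m) (x ^ℚ n)))

^ℚ-* : ∀ x m n → x ^ℚ (n ℕ.* m) ≡ (x ^ℚ m) ^ℚ n
^ℚ-* x m zero    = refl
^ℚ-* x m (suc n) = trans (^ℚ-+ x m (n ℕ.* m)) (cong (x ^ℚ m *_) (^ℚ-* x m n))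

^ℚ-distrib : ∀ x y n → (x * y) ^ℚ n ≡ x ^ℚ n * y ^ℚ n
^ℚ-distrib x y zero    = refl
^ℚ-distrib x y (suc n) = trans (cong (x * y *_) (^ℚ-distrib x y n)) (eq x y (x ^ℚ n) (y ^ℚ n))
  where
  eq : ∀ a b c d → a * b * (c * d) ≡ a * c * (b * d)
  eq = solve-∀ ℚ-ring

1^ℚ : ∀ n → 1ℚ ^ℚ n ≡ 1ℚ
1^ℚ zero    = refl
1^ℚ (suc n) = trans (*-identityˡ _) (1^ℚ n)

0≤^ : ∀ {x} n → 0ℚ ≤ x → 0ℚ ≤ x ^ℚ n
0≤^ zero    _ = ≤! {0ℚ} {1ℚ}
0≤^ (suc n) p = 0≤* p (0≤^ n p)

0<^ : ∀ {x} n → 0ℚ < x → 0ℚ < x ^ℚ n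
0<^ zero    _ = <! {0ℚ} {1ℚ}
0<^ (suc n) p = 0<* p (0<^ n p)

^ℚ-mono : ∀ {x y} n → 0ℚ ≤ x → x ≤ y → x ^ℚ n ≤ y ^ℚ n
^ℚ-mono zero    _ _ = ≤-refl
^ℚ-mono (suc n) p q = *-mono p q (0≤^ n p) (^ℚ-mono n p q)

1≤^ : ∀ {x} n → 1ℚ ≤ x → 1ℚ ≤ x ^ℚ n
1≤^ {x} n p = subst (_≤ x ^ℚ n) (1^ℚ n) (^ℚ-mono n (≤! {0ℚ} {1ℚ}) p)

^ℚ-monoʳ : ∀ {x m n} → 1ℚ ≤ x → m ℕ.≤ n → x ^ℚ m ≤ x ^ℚ n
^ℚ-monoʳ {x} {n = n} p ℕ.z≤n = 1≤^ n p
^ℚ-monoʳ {x} p (ℕ.s≤s q)     = *-monoˡ x (≤-trans (≤! {0ℚ} {1ℚ}) p) (^ℚ-monoʳ p q)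

ι-^ : ∀ m k → ι (m ℕ.^ k) ≡ ι m ^ℚ k
ι-^ m zero    = refl
ι-^ m (suc k) = trans (ι-* m (m ℕ.^ k)) (cong (ι m *_) (ι-^ m k))

∑ : ℕ → (ℕ → ℚ) → ℚ
∑ zero    f = 0ℚ
∑ (suc n) f = ∑ n f + f n

∑-cong : ∀ n {f g : ℕ → ℚ} → (∀ i → i ℕ.< n → f i ≡ g i) → ∑ n f ≡ ∑ n g
∑-cong zero    p = refl
∑-cong (suc n) p = cong₂ _+_ (∑-cong n (λ i i<n → p i (ℕₚ.m<n⇒m<1+n i<n))) (p n (ℕₚ.n<1+n n))

∑-mono : ∀ n {f g : ℕ → ℚ} → (∀ i → i ℕ.< n → f i ≤ g i) → ∑ n f ≤ ∑ n g
∑-mono zero    p = ≤-refl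
∑-mono (suc n) p = +-mono-≤ (∑-mono n (λ i i<n → p i (ℕₚ.m<n⇒m<1+n i<n))) (p n (ℕₚ.n<1+n n))

∑-const : ∀ n c → ∑ n (λ _ → c) ≡ ι n * c
∑-const zero    c = sym (*-zeroˡ c)
∑-const (suc n) c = trans (cong (_+ c) (∑-const n c)) (eq (ι n) c)
  where
  eq : ∀ x c → x * c + c ≡ (1ℚ + x) * c
  eq = solve-∀ ℚ-ring

∑-0 : ∀ n → ∑ n (λ _ → 0ℚ) ≡ 0ℚ
∑-0 n = trans (∑-const n 0ℚ) (*-zeroʳ (ι n))

∑-zero : ∀ n {f : ℕ → ℚ} → (∀ i → i ℕ.< n → f i ≡ 0ℚ) → ∑ n f ≡ 0ℚ
∑-zero n p = trans (∑-cong n p) (∑-0 n)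

0≤∑ : ∀ n {f : ℕ → ℚ} → (∀ i → 0ℚ ≤ f i) → 0ℚ ≤ ∑ n f
0≤∑ n {f} p = subst (_≤ ∑ n f) (∑-0 n) (∑-mono n (λ i _ → p i))

∑-≤const : ∀ n {f : ℕ → ℚ} {c} → (∀ i → i ℕ.< n → f i ≤ c) → ∑ n f ≤ ι n * c
∑-≤const n {f} {c} p = subst (∑ n f ≤_) (∑-const n c) (∑-mono n p)

∑-distrib-+ : ∀ n (f g : ℕ → ℚ) → ∑ n (λ i → f i + g i) ≡ ∑ n f + ∑ n g
∑-distrib-+ zero    f g = refl
∑-distrib-+ (suc n) f g = trans (cong (_+ (f n + g n)) (∑-distrib-+ n f g)) (eq (∑ n f) (∑ n g) (f n) (g n))
  where
  eq : ∀ a b c d → a + b + (c + d) ≡ a + c + (b + d)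
  eq = solve-∀ ℚ-ring

*-∑ : ∀ n c (f : ℕ → ℚ) → c * ∑ n f ≡ ∑ n (λ i → c * f i)
*-∑ zero    c f = *-zeroʳ c
*-∑ (suc n) c f = trans (*-distribˡ-+ c (∑ n f) (f n)) (cong (_+ c * f n) (*-∑ n c f))

∑-* : ∀ n (f : ℕ → ℚ) c → ∑ n f * c ≡ ∑ n (λ i → f i * c)
∑-* n f c = trans (*-comm (∑ n f) c) (trans (*-∑ n c f) (∑-cong n (λ i _ → *-comm c (f i))))

∑-distrib-- : ∀ n (f g : ℕ → ℚ) → ∑ n (λ i → f i - g i) ≡ ∑ n f - ∑ n g
∑-distrib-- n f g = trans (∑-distrib-+ n f (λ i → - g i)) (cong (λ t → ∑ n f + t) (∑-neg n))
  where
  ∑-neg : ∀ n → ∑ n (λ i → - g i) ≡ - ∑ n g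
  ∑-neg zero    = refl
  ∑-neg (suc n) = trans (cong (_+ - g n) (∑-neg n)) (sym (neg-distrib-+ (∑ n g) (g n)))

∑-swap : ∀ m n (f : ℕ → ℕ → ℚ) → ∑ m (λ i → ∑ n (f i)) ≡ ∑ n (λ j → ∑ m (λ i → f i j))
∑-swap zero    n f = sym (∑-0 n)
∑-swap (suc m) n f = trans (cong (_+ ∑ n (f m)) (∑-swap m n f))
  (sym (∑-distrib-+ n (λ j → ∑ m (λ i → f i j)) (f m)))

∑-split : ∀ m n (f : ℕ → ℚ) → ∑ (m ℕ.+ n) f ≡ ∑ m f + ∑ n (λ i → f (m ℕ.+ i))
∑-split m zero    f = trans (cong (λ t → ∑ t f) (ℕₚ.+-identityʳ m)) (sym (+-identityʳ _))
∑-split m (suc n) f = trans (cong (λ t → ∑ t f) (ℕₚ.+-suc m n))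
  (trans (cong (_+ f (m ℕ.+ n)) (∑-split m n f)) (+-assoc (∑ m f) _ _))

term≤∑ : ∀ n {f : ℕ → ℚ} → (∀ i → 0ℚ ≤ f i) → ∀ {i} → i ℕ.< n → f i ≤ ∑ n f
term≤∑ (suc n) {f} p {i} i<1+n with ℕₚ.m≤n⇒m<n∨m≡n (ℕₚ.≤-pred i<1+n)
... | inj₁ i<n  = ≤-trans (term≤∑ n p i<n) (≤-add (f n) (p n) refl)
... | inj₂ refl = ≤-add (∑ n f) (0≤∑ n p) (+-comm (f n) _)

-- Lengthening the range to c + N adds only zeros at either end. The two vanishing conditions are
-- what the margin around the set provides.
∑-shift : ∀ N c (g : ℕ → ℚ) → (∀ x → x ℕ.< c → g x ≡ 0ℚ) → (∀ x → N ℕ.≤ x → g x ≡ 0ℚ) →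
          ∑ N (λ s → g (c ℕ.+ s)) ≡ ∑ N g
∑-shift N c g lo hi = begin
  ∑ N (λ s → g (c ℕ.+ s))             ≡⟨ sym (+-identityˡ _) ⟩
  0ℚ + ∑ N (λ s → g (c ℕ.+ s))        ≡⟨ cong (_+ ∑ N (λ s → g (c ℕ.+ s))) (sym (∑-zero c lo)) ⟩
  ∑ c g + ∑ N (λ s → g (c ℕ.+ s))     ≡⟨ sym (∑-split c N g) ⟩
  ∑ (c ℕ.+ N) g                       ≡⟨ cong (λ t → ∑ t g) (ℕₚ.+-comm c N) ⟩
  ∑ (N ℕ.+ c) g                       ≡⟨ ∑-split N c g ⟩
  ∑ N g + ∑ c (λ s → g (N ℕ.+ s))     ≡⟨ cong (λ t → ∑ N g + t) (∑-zero c (λ s _ → hi (N ℕ.+ s) (ℕₚ.m≤m+n N s))) ⟩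
  ∑ N g + 0ℚ                          ≡⟨ +-identityʳ _ ⟩
  ∑ N g ∎
  where open ≡-Reasoning

argmax : ∀ n (f : ℕ → ℚ) → ∃[ s ] (∀ i → i ℕ.≤ n → f i ≤ f s)
argmax zero    f = 0 , λ { .zero ℕ.z≤n → ≤-refl }
argmax (suc n) f with argmax n f
... | s , p with ≤-total (f s) (f (suc n))
... | inj₁ q = suc n , λ i i≤ → case-≤ i i≤
  where
  case-≤ : ∀ i → i ℕ.≤ suc n → f i ≤ f (suc n)
  case-≤ i i≤ with ℕₚ.m≤n⇒m<n∨m≡n i≤
  ... | inj₁ i<  = ≤-trans (p i (ℕₚ.≤-pred i<)) q
  ... | inj₂ refl = ≤-refl
... | inj₂ q = s , λ i i≤ → case-≤ i i≤
  where
  case-≤ : ∀ i → i ℕ.≤ suc n → f i ≤ f s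
  case-≤ i i≤ with ℕₚ.m≤n⇒m<n∨m≡n i≤
  ... | inj₁ i<  = p i (ℕₚ.≤-pred i<)
  ... | inj₂ refl = q

-- Gaussian rationals and approximate roots of unity

infix 5 _⊹_
infixl 6 _⊕_ _⊖_
infixl 7 _⊗_
infixr 8 _^ᶜ_

record ℂ : Set where
  constructor _⊹_
  field
    re im : ℚ

open ℂ public

1ᶜ : ℂ
1ᶜ = 1ℚ ⊹ 0ℚ

_⊕_ _⊖_ _⊗_ : ℂ → ℂ → ℂ
x ⊕ y = (re x + re y) ⊹ (im x + im y)
x ⊖ y = (re x - re y) ⊹ (im x - im y)
x ⊗ y = (re x * re y - im x * im y) ⊹ (re x * im y + im x * re y)

-- The real part of x times the conjugate of y. Orthogonality of characters is only ever used
-- through real parts, so this takes the place of the hermitian form.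
⟨_,_⟩ : ℂ → ℂ → ℚ
⟨ x , y ⟩ = re x * re y + im x * im y

∣_∣² : ℂ → ℚ
∣ x ∣² = ⟨ x , x ⟩

_^ᶜ_ : ℂ → ℕ → ℂ
z ^ᶜ zero  = 1ᶜ
z ^ᶜ suc k = z ⊗ z ^ᶜ k

⊗-assoc : ∀ x y z → (x ⊗ y) ⊗ z ≡ x ⊗ (y ⊗ z)
⊗-assoc x y z = cong₂ _⊹_ (p (re x) (im x) (re y) (im y) (re z) (im z)) (q (re x) (im x) (re y) (im y) (re z) (im z))
  where
  p : ∀ a b c d e f → (a * c - b * d) * e - (a * d + b * c) * f ≡ a * (c * e - d * f) - b * (c * f + d * e)
  p = solve-∀ ℚ-ring
  q : ∀ a b c d e f → (a * c - b * d) * f + (a * d + b * c) * e ≡ a * (c * f + d * e) + b * (c * e - d * f)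
  q = solve-∀ ℚ-ring

⊗-comm : ∀ x y → x ⊗ y ≡ y ⊗ x
⊗-comm x y = cong₂ _⊹_ (p (re x) (im x) (re y) (im y)) (q (re x) (im x) (re y) (im y))
  where
  p : ∀ a b c d → a * c - b * d ≡ c * a - d * b
  p = solve-∀ ℚ-ring
  q : ∀ a b c d → a * d + b * c ≡ c * b + d * a
  q = solve-∀ ℚ-ring

⊗-identityˡ : ∀ x → 1ᶜ ⊗ x ≡ x
⊗-identityˡ x = cong₂ _⊹_ (p (re x) (im x)) (q (re x) (im x))
  where
  p : ∀ a b → 1ℚ * a - 0ℚ * b ≡ a
  p = solve-∀ ℚ-ring
  q : ∀ a b → 1ℚ * b + 0ℚ * a ≡ b
  q = solve-∀ ℚ-ring

⊗-identityʳ : ∀ x → x ⊗ 1ᶜ ≡ x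
⊗-identityʳ x = trans (⊗-comm x 1ᶜ) (⊗-identityˡ x)

∣⊗∣² : ∀ x y → ∣ x ⊗ y ∣² ≡ ∣ x ∣² * ∣ y ∣²
∣⊗∣² x y = p (re x) (im x) (re y) (im y)
  where
  p : ∀ a b c d → (a * c - b * d) * (a * c - b * d) + (a * d + b * c) * (a * d + b * c) ≡ (a * a + b * b) * (c * c + d * d)
  p = solve-∀ ℚ-ring

0≤∣∣² : ∀ x → 0ℚ ≤ ∣ x ∣²
0≤∣∣² x = 0≤+ (0≤sq (re x)) (0≤sq (im x))

∣⊕∣²-≤ : ∀ x y → ∣ x ⊕ y ∣² ≤ 2ℚ * ∣ x ∣² + 2ℚ * ∣ y ∣²
∣⊕∣²-≤ x y = ≤-add ∣ x ⊖ y ∣² (0≤∣∣² (x ⊖ y)) (p (re x) (im x) (re y) (im y))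
  where
  p : ∀ a b c d → (a + c) * (a + c) + (b + d) * (b + d) + ((a - c) * (a - c) + (b - d) * (b - d))
                ≡ 2ℚ * (a * a + b * b) + 2ℚ * (c * c + d * d)
  p = solve-∀ ℚ-ring

^ᶜ-+ : ∀ z m n → z ^ᶜ (m ℕ.+ n) ≡ z ^ᶜ m ⊗ z ^ᶜ n
^ᶜ-+ z zero    n = sym (⊗-identityˡ _)
^ᶜ-+ z (suc m) n = trans (cong (z ⊗_) (^ᶜ-+ z m n)) (sym (⊗-assoc z (z ^ᶜ m) (z ^ᶜ n)))

^ᶜ-* : ∀ z m n → z ^ᶜ (n ℕ.* m) ≡ (z ^ᶜ m) ^ᶜ n
^ᶜ-* z m zero    = refl
^ᶜ-* z m (suc n) = trans (^ᶜ-+ z m (n ℕ.* m)) (cong (z ^ᶜ m ⊗_) (^ᶜ-* z m n))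

Unit : ℂ → Set
Unit z = ∣ z ∣² ≡ 1ℚ

Unit-⊗ : ∀ {x y} → Unit x → Unit y → Unit (x ⊗ y)
Unit-⊗ {x} {y} p q = trans (∣⊗∣² x y) (cong₂ _*_ p q)

Unit-^ : ∀ {z} k → Unit z → Unit (z ^ᶜ k)
Unit-^ zero    p = refl
Unit-^ {z} (suc k) p = Unit-⊗ {z} {z ^ᶜ k} p (Unit-^ {z} k p)

sq≤1⇒≤1 : ∀ {a} → a * a ≤ 1ℚ → a ≤ 1ℚ
sq≤1⇒≤1 = sq-cancel-≤ (≤! {0ℚ} {1ℚ})

Unit⇒re-sq≤1 : ∀ {z} → Unit z → re z * re z ≤ 1ℚ
Unit⇒re-sq≤1 {z} p = ≤-add (im z * im z) (0≤sq (im z)) p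

Unit⇒im-sq≤1 : ∀ {z} → Unit z → im z * im z ≤ 1ℚ
Unit⇒im-sq≤1 {z} p = ≤-add (re z * re z) (0≤sq (re z)) (trans (+-comm (im z * im z) _) p)

sq≤1⇒-1≤ : ∀ {a} → a * a ≤ 1ℚ → - 1ℚ ≤ a
sq≤1⇒-1≤ {a} p = subst (- 1ℚ ≤_) (neg-involutive a)
  (neg-antimono-≤ (sq≤1⇒≤1 (subst (_≤ 1ℚ) (sym (neg-sq a)) p)))

abstract
  inv1+sq : ∀ t → ∃[ r ] (0ℚ ≤ r × r ≤ 1ℚ × (1ℚ + t * t) * r ≡ 1ℚ)
  inv1+sq t with inverse (1ℚ + t * t) (<-≤-trans (<! {0ℚ} {1ℚ}) (≤-add (t * t) (0≤sq t) refl))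
  ... | r , 0<r , eq = r , <⇒≤ 0<r , subst (r ≤_) eq (≤-add (t * t * r) (0≤* (0≤sq t) (<⇒≤ 0<r)) (p t r)) , eq
    where
    p : ∀ t r → r + t * t * r ≡ (1ℚ + t * t) * r
    p = solve-∀ ℚ-ring

recip : ℚ → ℚ
recip t = proj₁ (inv1+sq t)

0≤recip : ∀ t → 0ℚ ≤ recip t
0≤recip t = proj₁ (proj₂ (inv1+sq t))

recip≤1 : ∀ t → recip t ≤ 1ℚ
recip≤1 t = proj₁ (proj₂ (proj₂ (inv1+sq t)))

recip-inverse : ∀ t → (1ℚ + t * t) * recip t ≡ 1ℚ
recip-inverse t = proj₂ (proj₂ (proj₂ (inv1+sq t)))

-- Stereographic parametrisation of the unit circle; the parameters from 0 to 1 run through the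
-- first quadrant.
circlePoint : ℚ → ℂ
circlePoint t = ((1ℚ - t * t) * recip t) ⊹ (2ℚ * t * recip t)

Unit-circlePoint : ∀ t → Unit (circlePoint t)
Unit-circlePoint t = trans (p t (recip t)) (cong₂ _*_ (recip-inverse t) (recip-inverse t))
  where
  p : ∀ t r → (1ℚ - t * t) * r * ((1ℚ - t * t) * r) + 2ℚ * t * r * (2ℚ * t * r) ≡ (1ℚ + t * t) * r * ((1ℚ + t * t) * r)
  p = solve-∀ ℚ-ring

0≤im-circlePoint : ∀ {t} → 0ℚ ≤ t → 0ℚ ≤ im (circlePoint t)
0≤im-circlePoint {t} 0≤t = 0≤* (0≤* (≤! {0ℚ} {2ℚ}) 0≤t) (0≤recip t)

0≤re-circlePoint : ∀ {t} → 0ℚ ≤ t → t ≤ 1ℚ → 0ℚ ≤ re (circlePoint t)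
0≤re-circlePoint {t} 0≤t t≤1 = 0≤* (0≤- (*-mono 0≤t t≤1 0≤t t≤1)) (0≤recip t)

-- The constant is the maximum of the derivative of 2 t / (1 + t²), attained at t = 0.
im-circlePoint-lipschitz : ∀ t μ → 0ℚ ≤ t → 0ℚ ≤ μ →
  im (circlePoint (t + μ)) ≤ im (circlePoint t) + 2ℚ * μ
im-circlePoint-lipschitz t μ 0≤t 0≤μ =
  ≤-add (2ℚ * (μ * (1ℚ - r * r′)) + 2ℚ * (μ * (r * r′ * (t * (t + μ)))))
    (0≤+ (0≤* (≤! {0ℚ} {2ℚ}) (0≤* 0≤μ (0≤- (*-mono (0≤recip t) (recip≤1 t) (0≤recip (t + μ)) (recip≤1 (t + μ))))))
         (0≤* (≤! {0ℚ} {2ℚ}) (0≤* 0≤μ (0≤* (0≤* (0≤recip t) (0≤recip (t + μ))) (0≤* 0≤t (0≤+ 0≤t 0≤μ))))))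
    eq
  where
  r r′ : ℚ
  r  = recip t
  r′ = recip (t + μ)
  -- Both sides are polynomials in t, μ, r, r′ once 1 is replaced by (1 + t²) r and (1 + (t + μ)²) r′.
  eq : 2ℚ * (t + μ) * r′ + (2ℚ * (μ * (1ℚ - r * r′)) + 2ℚ * (μ * (r * r′ * (t * (t + μ))))) ≡ 2ℚ * t * r + 2ℚ * μ
  eq = begin
    2ℚ * (t + μ) * r′ + X                            ≡⟨ cong (_+ X) (sym (*-identityʳ (2ℚ * (t + μ) * r′))) ⟩
    2ℚ * (t + μ) * r′ * 1ℚ + X                       ≡⟨ cong (λ a → 2ℚ * (t + μ) * r′ * a + X) (sym (recip-inverse t)) ⟩
    2ℚ * (t + μ) * r′ * ((1ℚ + t * t) * r) + X       ≡⟨ p t μ r r′ ⟩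
    2ℚ * t * r * ((1ℚ + (t + μ) * (t + μ)) * r′) + 2ℚ * μ ≡⟨ cong (λ a → 2ℚ * t * r * a + 2ℚ * μ) (recip-inverse (t + μ)) ⟩
    2ℚ * t * r * 1ℚ + 2ℚ * μ                         ≡⟨ cong (_+ 2ℚ * μ) (*-identityʳ (2ℚ * t * r)) ⟩
    2ℚ * t * r + 2ℚ * μ ∎
    where
    open ≡-Reasoning
    X : ℚ
    X = 2ℚ * (μ * (1ℚ - r * r′)) + 2ℚ * (μ * (r * r′ * (t * (t + μ))))
    p : ∀ t μ r s → 2ℚ * (t + μ) * s * ((1ℚ + t * t) * r) + (2ℚ * (μ * (1ℚ - r * s)) + 2ℚ * (μ * (r * s * (t * (t + μ)))))
        ≡ 2ℚ * t * r * ((1ℚ + (t + μ) * (t + μ)) * s) + 2ℚ * μ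
    p = solve-∀ ℚ-ring

discrete-IVT : ∀ M (φ : ℕ → ℚ) c → c ≤ φ 0 → φ (suc M) ≤ c → ∃[ k ] (k ℕ.≤ M × c ≤ φ k × φ (suc k) ≤ c)
discrete-IVT zero    φ c p q = 0 , ℕ.z≤n , p , q
discrete-IVT (suc M) φ c p q with c ≤? φ (suc M)
... | yes r = suc M , ℕₚ.≤-refl , r , q
... | no ¬r with discrete-IVT M φ c p (<⇒≤ (≰⇒> ¬r))
... | k , k≤M , u , v = k , ℕₚ.m≤n⇒m≤1+n k≤M , u , v

re-sq-unit : ∀ v → Unit v → re (v ⊗ v) ≡ 1ℚ - 2ℚ * (im v * im v)
re-sq-unit v u = trans (p (re v) (im v)) (cong (_- 2ℚ * (im v * im v)) u)
  where
  p : ∀ a b → a * a - b * b ≡ a * a + b * b - 2ℚ * (b * b)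
  p = solve-∀ ℚ-ring

-- The real part of v² is 1 - 2 (im v)². Its drop is at most 2 · 2 μ · 2, since im v grows by at
-- most 2 μ and the two imaginary parts add up to at most 2.
re-circlePoint²-lipschitz : ∀ t μ → 0ℚ ≤ t → 0ℚ ≤ μ →
  re (circlePoint t ⊗ circlePoint t) ≤ re (circlePoint (t + μ) ⊗ circlePoint (t + μ)) + 8ℚ * μ
re-circlePoint²-lipschitz t μ 0≤t 0≤μ =
  subst₂ (λ x y → x ≤ y + 8ℚ * μ) (sym (re-sq-unit v uv)) (sym (re-sq-unit v′ uv′))
    (≤-add (2ℚ * ((b + 2ℚ * μ - b′) * (b′ + b)) + 4ℚ * (μ * ((1ℚ - b) + (1ℚ - b′))))
      (0≤+ (0≤* (≤! {0ℚ} {2ℚ}) (0≤* (0≤- (im-circlePoint-lipschitz t μ 0≤t 0≤μ)) (0≤+ 0≤b′ 0≤b)))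
           (0≤* (≤! {0ℚ} {4ℚ}) (0≤* 0≤μ (0≤+ (0≤- b≤1) (0≤- b′≤1)))))
      (p b b′ μ))
  where
  v v′ : ℂ
  v  = circlePoint t
  v′ = circlePoint (t + μ)
  uv : Unit v
  uv = Unit-circlePoint t
  uv′ : Unit v′
  uv′ = Unit-circlePoint (t + μ)
  b b′ : ℚ
  b  = im v
  b′ = im v′
  0≤b : 0ℚ ≤ b
  0≤b = 0≤im-circlePoint 0≤t
  0≤b′ : 0ℚ ≤ b′
  0≤b′ = 0≤im-circlePoint (0≤+ 0≤t 0≤μ)
  b≤1 : b ≤ 1ℚ
  b≤1 = sq≤1⇒≤1 (Unit⇒im-sq≤1 {v} uv)
  b′≤1 : b′ ≤ 1ℚ
  b′≤1 = sq≤1⇒≤1 (Unit⇒im-sq≤1 {v′} uv′)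
  p : ∀ b c μ → 1ℚ - 2ℚ * (b * b) + (2ℚ * ((b + 2ℚ * μ - c) * (c + b)) + 4ℚ * (μ * ((1ℚ - b) + (1ℚ - c))))
      ≡ 1ℚ - 2ℚ * (c * c) + 8ℚ * μ
  p = solve-∀ ℚ-ring

-- On the upper half circle the real part determines the point, with square root loss: (y - s)² ≤
-- |y² - s²| = |X² - c²|.
upper-unit-dist : ∀ x w e → Unit x → Unit w → 0ℚ ≤ im x → 0ℚ ≤ im w →
  re w ≤ re x → re x ≤ re w + e → ∣ x ⊖ w ∣² ≤ 4ℚ * e
upper-unit-dist x w e ux uw 0≤y 0≤s c≤X X≤c+e =
  ≤-trans (+-mono-≤ re-part im-part) (≤-add (4ℚ * (re w + e - re x)) (0≤* (≤! {0ℚ} {4ℚ}) (0≤- X≤c+e)) (r X c e))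
  where
  X c y s d : ℚ
  X = re x
  c = re w
  y = im x
  s = im w
  d = X - c
  0≤d : 0ℚ ≤ d
  0≤d = 0≤- c≤X
  X≤1 : X ≤ 1ℚ
  X≤1 = sq≤1⇒≤1 (Unit⇒re-sq≤1 {x} ux)
  c≤1 : c ≤ 1ℚ
  c≤1 = sq≤1⇒≤1 (Unit⇒re-sq≤1 {w} uw)
  -1≤X : - 1ℚ ≤ X
  -1≤X = sq≤1⇒-1≤ (Unit⇒re-sq≤1 {x} ux)
  -1≤c : - 1ℚ ≤ c
  -1≤c = sq≤1⇒-1≤ (Unit⇒re-sq≤1 {w} uw)
  r : ∀ X c e → 2ℚ * (X - c) + 2ℚ * (X - c) + 4ℚ * (c + e - X) ≡ 4ℚ * e
  r = solve-∀ ℚ-ring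
  re-part : d * d ≤ 2ℚ * d
  re-part = ≤-add (d * ((1ℚ - X) + (c - - 1ℚ))) (0≤* 0≤d (0≤+ (0≤- X≤1) (0≤- -1≤c))) (p X c)
    where
    p : ∀ X c → (X - c) * (X - c) + (X - c) * ((1ℚ - X) + (c - - 1ℚ)) ≡ 2ℚ * (X - c)
    p = solve-∀ ℚ-ring
  sq-diff : X * X + y * y ≡ c * c + s * s
  sq-diff = trans ux (sym uw)
  im-part : (y - s) * (y - s) ≤ 2ℚ * d
  im-part with ≤-total y s
  ... | inj₁ y≤s = ≤-add (2ℚ * (y * (s - y)) + d * ((1ℚ - X) + (1ℚ - c)))
        (0≤+ (0≤* (≤! {0ℚ} {2ℚ}) (0≤* 0≤y (0≤- y≤s))) (0≤* 0≤d (0≤+ (0≤- X≤1) (0≤- c≤1))))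
        (trans (p X c y s) (trans (cong (λ t → t - (X * X + y * y) + 2ℚ * (X - c)) (sym sq-diff)) (z (X * X + y * y) _)))
    where
    p : ∀ X c y s → (y - s) * (y - s) + (2ℚ * (y * (s - y)) + (X - c) * ((1ℚ - X) + (1ℚ - c)))
        ≡ c * c + s * s - (X * X + y * y) + 2ℚ * (X - c)
    p = solve-∀ ℚ-ring
    z : ∀ a b → a - a + b ≡ b
    z = solve-∀ ℚ-ring
  ... | inj₂ s≤y = ≤-add (2ℚ * (s * (y - s)) + d * ((X - - 1ℚ) + (c - - 1ℚ)))
        (0≤+ (0≤* (≤! {0ℚ} {2ℚ}) (0≤* 0≤s (0≤- s≤y))) (0≤* 0≤d (0≤+ (0≤- -1≤X) (0≤- -1≤c))))
        (trans (p X c y s) (trans (cong (λ t → t - (c * c + s * s) + 2ℚ * (X - c)) sq-diff) (z (c * c + s * s) _)))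
    where
    p : ∀ X c y s → (y - s) * (y - s) + (2ℚ * (s * (y - s)) + (X - c) * ((X - - 1ℚ) + (c - - 1ℚ)))
        ≡ X * X + y * y - (c * c + s * s) + 2ℚ * (X - c)
    p = solve-∀ ℚ-ring
    z : ∀ a b → a - a + b ≡ b
    z = solve-∀ ℚ-ring

-- The product of the constant 4 in `upper-unit-dist` and the constant 8 in
-- `re-circlePoint²-lipschitz`.
32ℚ : ℚ
32ℚ = 4ℚ * 8ℚ

mesh : ∀ ε → 0ℚ < ε → ∃[ M ] ∃[ μ ] (0ℚ < μ × ι (suc M) * μ ≡ 1ℚ × 32ℚ * μ ≤ ε)
mesh ε 0<ε =
  let ε⁻¹ , 0<ε⁻¹ , εε⁻¹ = inverse ε 0<ε
      M , M-big = archimedean (32ℚ * ε⁻¹)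
      μ , 0<μ , Mμ = inverse (ι (suc M)) (<-≤-trans (<! {0ℚ} {1ℚ}) (≤-add (ι M) (0≤ι M) refl))
      step : 32ℚ * μ ≤ ε
      step = begin
        32ℚ * μ                  ≡⟨ sym (*-identityˡ _) ⟩
        1ℚ * (32ℚ * μ)           ≡⟨ cong (_* (32ℚ * μ)) (sym εε⁻¹) ⟩
        ε * ε⁻¹ * (32ℚ * μ)      ≡⟨ p ε ε⁻¹ μ ⟩
        (ε * μ) * (32ℚ * ε⁻¹)    ≤⟨ *-monoˡ (ε * μ) (0≤* (<⇒≤ 0<ε) (<⇒≤ 0<μ)) (≤-trans M-big (≤-add 1ℚ (≤! {0ℚ} {1ℚ}) (+-comm (ι M) 1ℚ))) ⟩
        (ε * μ) * ι (suc M)      ≡⟨ q ε μ (ι (suc M)) ⟩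
        ε * (ι (suc M) * μ)      ≡⟨ cong (ε *_) Mμ ⟩
        ε * 1ℚ                   ≡⟨ *-identityʳ ε ⟩
        ε ∎
  in M , μ , 0<μ , Mμ , step
  where
  open ≤-Reasoning
  p : ∀ a b c → a * b * (32ℚ * c) ≡ (a * c) * (32ℚ * b)
  p = solve-∀ ℚ-ring
  q : ∀ a b c → (a * b) * c ≡ a * (c * b)
  q = solve-∀ ℚ-ring

abstract
  -- Along the mesh the real part of the squared circle point goes from 1 at t = 0 to -1 at t = 1,
  -- hence passes that of `w` between two neighbours. The squares stay in the upper half plane, so
  -- nearly equal real parts mean nearly equal points. The root lies in the upper half plane again,
  -- which allows iteration.
  approx-sqrt : ∀ w ε → Unit w → 0ℚ ≤ im w → 0ℚ < ε →
    ∃[ v ] (Unit v × 0ℚ ≤ im v × ∣ v ⊗ v ⊖ w ∣² ≤ ε)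
  approx-sqrt w ε uw 0≤s 0<ε =
    let M , μ , 0<μ , Mμ , small = mesh ε 0<ε
        t : ℕ → ℚ
        t k = ι k * μ
        0≤t : ∀ k → 0ℚ ≤ t k
        0≤t k = 0≤* (0≤ι k) (<⇒≤ 0<μ)
        φ : ℕ → ℚ
        φ k = re (circlePoint (t k) ⊗ circlePoint (t k))
        φ0 : φ 0 ≡ 1ℚ
        φ0 = trans (re-sq-unit (circlePoint (t 0)) (Unit-circlePoint (t 0)))
                   (trans (cong (λ x → 1ℚ - 2ℚ * ((2ℚ * x * recip (t 0)) * (2ℚ * x * recip (t 0)))) (*-zeroˡ μ)) (at0 (recip (t 0))))
        t-last : t (suc M) ≡ 1ℚ
        t-last = Mμ
        φM : φ (suc M) ≡ - 1ℚ
        φM = trans (re-at-1 (t (suc M)) (recip (t (suc M))) t-last (trans (cong (λ x → (1ℚ + x * x) * recip (t (suc M))) (sym t-last)) (recip-inverse (t (suc M))))) refl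
        k , k≤M , c≤φ , φ≤c = discrete-IVT M φ (re w)
          (subst (re w ≤_) (sym φ0) (sq≤1⇒≤1 (Unit⇒re-sq≤1 {w} uw)))
          (subst (_≤ re w) (sym φM) (sq≤1⇒-1≤ (Unit⇒re-sq≤1 {w} uw)))
        v = circlePoint (t k)
        uv : Unit v
        uv = Unit-circlePoint (t k)
        t≤1 : t k ≤ 1ℚ
        t≤1 = subst (t k ≤_) Mμ (*-monoʳ-≤-nonNeg μ {{nonNegative (<⇒≤ 0<μ)}} (ι-mono (ℕₚ.m≤n⇒m≤1+n k≤M)))
        φ-step : φ k ≤ re w + 8ℚ * μ
        φ-step = ≤-trans (re-circlePoint²-lipschitz (t k) μ (0≤t k) (<⇒≤ 0<μ))
          (+-monoˡ-≤ (8ℚ * μ) (subst (_≤ re w) (cong (λ x → re (circlePoint x ⊗ circlePoint x)) (next (ι k) μ)) φ≤c))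
        0≤re : 0ℚ ≤ re v
        0≤re = 0≤re-circlePoint (0≤t k) t≤1
        0≤im : 0ℚ ≤ im v
        0≤im = 0≤im-circlePoint (0≤t k)
    in v , uv , 0≤im ,
       ≤-trans (upper-unit-dist (v ⊗ v) w (8ℚ * μ) (Unit-⊗ {v} {v} uv uv) uw
                 (0≤+ (0≤* 0≤re 0≤im) (0≤* 0≤im 0≤re)) 0≤s c≤φ φ-step)
               (subst (_≤ ε) (*-assoc 4ℚ 8ℚ μ) small)
    where
    at0 : ∀ r → 1ℚ - 2ℚ * ((2ℚ * 0ℚ * r) * (2ℚ * 0ℚ * r)) ≡ 1ℚ
    at0 = solve-∀ ℚ-ring
    next : ∀ k μ → (1ℚ + k) * μ ≡ k * μ + μ
    next = solve-∀ ℚ-ring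
    re-at-1 : ∀ t r → t ≡ 1ℚ → (1ℚ + 1ℚ * 1ℚ) * r ≡ 1ℚ →
              (1ℚ - t * t) * r * ((1ℚ - t * t) * r) - 2ℚ * t * r * (2ℚ * t * r) ≡ - 1ℚ
    re-at-1 t r refl e = trans (p r) (cong (λ x → - (x * x)) e)
      where
      p : ∀ r → (1ℚ - 1ℚ * 1ℚ) * r * ((1ℚ - 1ℚ * 1ℚ) * r) - 2ℚ * 1ℚ * r * (2ℚ * 1ℚ * r) ≡ - ((1ℚ + 1ℚ * 1ℚ) * r * ((1ℚ + 1ℚ * 1ℚ) * r))
      p = solve-∀ ℚ-ring

-- From x X - y Y = x (X - Y) + (x - y) Y. The exponential constant is harmless, because the
-- accuracy of x is chosen after k.
∣^⊖^∣²-≤ : ∀ {x y} → Unit x → Unit y → ∀ k → ∣ x ^ᶜ k ⊖ y ^ᶜ k ∣² ≤ 4ℚ ^ℚ k * ∣ x ⊖ y ∣²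
∣^⊖^∣²-≤ {x} {y} ux uy zero = subst (0ℚ ≤_) (sym (*-identityˡ ∣ x ⊖ y ∣²)) (0≤∣∣² (x ⊖ y))
∣^⊖^∣²-≤ {x} {y} ux uy (suc k) = begin
  ∣ x ⊗ X ⊖ y ⊗ Y ∣²                                  ≡⟨ cong ∣_∣² (cong₂ _⊹_ (p (re x) (im x) (re y) (im y) (re X) (im X) (re Y) (im Y)) (q (re x) (im x) (re y) (im y) (re X) (im X) (re Y) (im Y))) ⟩
  ∣ x ⊗ (X ⊖ Y) ⊕ (x ⊖ y) ⊗ Y ∣²                      ≤⟨ ∣⊕∣²-≤ (x ⊗ (X ⊖ Y)) ((x ⊖ y) ⊗ Y) ⟩
  2ℚ * ∣ x ⊗ (X ⊖ Y) ∣² + 2ℚ * ∣ (x ⊖ y) ⊗ Y ∣²       ≡⟨ cong₂ (λ a b → 2ℚ * a + 2ℚ * b) (trans (∣⊗∣² x (X ⊖ Y)) (cong (_* ∣ X ⊖ Y ∣²) ux)) (trans (∣⊗∣² (x ⊖ y) Y) (cong (∣ x ⊖ y ∣² *_) (Unit-^ {y} k uy))) ⟩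
  2ℚ * (1ℚ * ∣ X ⊖ Y ∣²) + 2ℚ * (D * 1ℚ)              ≤⟨ +-monoˡ-≤ (2ℚ * (D * 1ℚ)) (*-monoˡ 2ℚ (≤! {0ℚ} {2ℚ}) (*-monoˡ 1ℚ (≤! {0ℚ} {1ℚ}) (∣^⊖^∣²-≤ {x} {y} ux uy k))) ⟩
  2ℚ * (1ℚ * (K * D)) + 2ℚ * (D * 1ℚ)                 ≤⟨ ≤-add (2ℚ * ((K - 1ℚ) * D)) (0≤* (≤! {0ℚ} {2ℚ}) (0≤* (0≤- (1≤^ k (≤! {1ℚ} {4ℚ}))) (0≤∣∣² (x ⊖ y)))) (r K D) ⟩
  4ℚ * K * D ∎
  where
  open ≤-Reasoning
  X Y : ℂ
  X = x ^ᶜ k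
  Y = y ^ᶜ k
  D K : ℚ
  D = ∣ x ⊖ y ∣²
  K = 4ℚ ^ℚ k
  p : ∀ a b c d e f g h → (a * e - b * f) - (c * g - d * h) ≡ (a * (e - g) - b * (f - h)) + ((a - c) * g - (b - d) * h)
  p = solve-∀ ℚ-ring
  q : ∀ a b c d e f g h → (a * f + b * e) - (c * h + d * g) ≡ (a * (f - h) + b * (e - g)) + ((a - c) * h + (b - d) * g)
  q = solve-∀ ℚ-ring
  r : ∀ K D → 2ℚ * (1ℚ * (K * D)) + 2ℚ * (D * 1ℚ) + 2ℚ * ((K - 1ℚ) * D) ≡ 4ℚ * K * D
  r = solve-∀ ℚ-ring

double-^ᶜ : ∀ z K → z ^ᶜ (2 ℕ.* K) ≡ (z ⊗ z) ^ᶜ K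
double-^ᶜ z K = trans (cong (z ^ᶜ_) (ℕₚ.*-comm 2 K))
  (trans (^ᶜ-* z 2 K) (cong (λ w → (z ⊗ w) ^ᶜ K) (⊗-identityʳ z)))

abstract
  -- Start from -1 and take approximate square roots m times. An error is unavoidable: for m ≥ 2 no
  -- exact root is a Gaussian rational.
  near-root-of-−1 : ∀ m ε → 0ℚ < ε → ∃[ z ] (Unit z × 0ℚ ≤ im z × ∣ z ^ᶜ (2 ℕ.^ m) ⊕ 1ᶜ ∣² ≤ ε)
  near-root-of-−1 zero ε 0<ε = (- 1ℚ ⊹ 0ℚ) , refl , ≤-refl , ≤-trans (≤! {∣ (- 1ℚ ⊹ 0ℚ) ^ᶜ 1 ⊕ 1ᶜ ∣²} {0ℚ}) (<⇒≤ 0<ε)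
  near-root-of-−1 (suc m) ε 0<ε =
    let K = 2 ℕ.^ m
        -- Half of ε pays for the inaccuracy of z, half for that of the new root, which is amplified
        -- by 4 ^ K.
        c = 4ℚ * 4ℚ ^ℚ K
        c⁻¹ , 0<c⁻¹ , cc⁻¹ = inverse c (0<* (<! {0ℚ} {4ℚ}) (0<^ K (<! {0ℚ} {4ℚ})))
        z , uz , 0≤iz , close-z = near-root-of-−1 m (¼ * ε) (0<* (<! {0ℚ} {¼}) 0<ε)
        v , uv , 0≤iv , close-v = approx-sqrt z (c⁻¹ * ε) uz 0≤iz (0<* 0<c⁻¹ 0<ε)
        V = (v ⊗ v) ^ᶜ K
        Z = z ^ᶜ K
    in v , uv , 0≤iv , (begin
      ∣ v ^ᶜ (2 ℕ.* K) ⊕ 1ᶜ ∣²                         ≡⟨ cong (λ w → ∣ w ⊕ 1ᶜ ∣²) (double-^ᶜ v K) ⟩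
      ∣ V ⊕ 1ᶜ ∣²                                      ≡⟨ cong₂ (λ a b → ∣ a ⊹ b ∣²) (p (re V) 1ℚ (re Z)) (p (im V) 0ℚ (im Z)) ⟩
      ∣ (V ⊖ Z) ⊕ (Z ⊕ 1ᶜ) ∣²                          ≤⟨ ∣⊕∣²-≤ (V ⊖ Z) (Z ⊕ 1ᶜ) ⟩
      2ℚ * ∣ V ⊖ Z ∣² + 2ℚ * ∣ Z ⊕ 1ᶜ ∣²               ≤⟨ +-mono-≤ (*-monoˡ 2ℚ (≤! {0ℚ} {2ℚ}) (≤-trans (∣^⊖^∣²-≤ {v ⊗ v} {z} (Unit-⊗ {v} {v} uv uv) uz K)
                                                            (*-monoˡ (4ℚ ^ℚ K) (0≤^ K (≤! {0ℚ} {4ℚ})) close-v)))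
                                                          (*-monoˡ 2ℚ (≤! {0ℚ} {2ℚ}) close-z) ⟩
      2ℚ * (4ℚ ^ℚ K * (c⁻¹ * ε)) + 2ℚ * (¼ * ε)        ≡⟨ q (4ℚ ^ℚ K) c⁻¹ ε ⟩
      ½ * (c * c⁻¹) * ε + ½ * ε                        ≡⟨ cong (λ t → ½ * t * ε + ½ * ε) cc⁻¹ ⟩
      ½ * 1ℚ * ε + ½ * ε                               ≡⟨ r ε ⟩
      ε ∎)
    where
    open ≤-Reasoning
    p : ∀ a b c → a + b ≡ (a - c) + (c + b)
    p = solve-∀ ℚ-ring
    q : ∀ a b e → 2ℚ * (a * (b * e)) + 2ℚ * (½ * ½ * e) ≡ ½ * (4ℚ * a * b) * e + ½ * e
    q = solve-∀ ℚ-ring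
    r : ∀ e → ½ * 1ℚ * e + ½ * e ≡ e
    r = solve-∀ ℚ-ring

-- Geometric sums and approximate orthogonality

∑ᶜ : ℕ → (ℕ → ℂ) → ℂ
∑ᶜ n f = ∑ n (λ i → re (f i)) ⊹ ∑ n (λ i → im (f i))

⊗-∑ᶜ : ∀ n x (f : ℕ → ℂ) → x ⊗ ∑ᶜ n f ≡ ∑ᶜ n (λ i → x ⊗ f i)
⊗-∑ᶜ n x f = cong₂ _⊹_
  (trans (cong₂ _-_ (*-∑ n (re x) _) (*-∑ n (im x) _)) (sym (∑-distrib-- n _ _)))
  (trans (cong₂ _+_ (*-∑ n (re x) _) (*-∑ n (im x) _)) (sym (∑-distrib-+ n _ _)))

∑ᶜ-cong : ∀ n {f g : ℕ → ℂ} → (∀ i → f i ≡ g i) → ∑ᶜ n f ≡ ∑ᶜ n g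
∑ᶜ-cong n p = cong₂ _⊹_ (∑-cong n (λ i _ → cong re (p i))) (∑-cong n (λ i _ → cong im (p i)))

geo : ℕ → ℂ → ℂ
geo n w = ∑ᶜ n (w ^ᶜ_)

-- Thus a geometric sum of length 2 ^ m is a product of m factors 1 + w ^ (2 ^ i), and one small
-- factor makes it small without any division by 1 - w.
geo-double : ∀ K w → geo (2 ℕ.* K) w ≡ geo K w ⊗ (1ᶜ ⊕ w ^ᶜ K)
geo-double K w = begin
  geo (2 ℕ.* K) w                              ≡⟨ cong (λ t → geo t w) (cong (K ℕ.+_) (ℕₚ.+-identityʳ K)) ⟩
  geo (K ℕ.+ K) w                              ≡⟨ cong₂ _⊹_ (∑-split K K _) (∑-split K K _) ⟩
  geo K w ⊕ ∑ᶜ K (λ i → w ^ᶜ (K ℕ.+ i))        ≡⟨ cong (geo K w ⊕_) (trans (∑ᶜ-cong K (^ᶜ-+ w K)) (sym (⊗-∑ᶜ K (w ^ᶜ K) (w ^ᶜ_)))) ⟩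
  geo K w ⊕ w ^ᶜ K ⊗ geo K w                   ≡⟨ cong₂ _⊹_ (p (re G) (im G) (re W) (im W)) (q (re G) (im G) (re W) (im W)) ⟩
  geo K w ⊗ (1ᶜ ⊕ w ^ᶜ K) ∎
  where
  open ≡-Reasoning
  G W : ℂ
  G = geo K w
  W = w ^ᶜ K
  p : ∀ a b c d → a + (c * a - d * b) ≡ a * (1ℚ + c) - b * (0ℚ + d)
  p = solve-∀ ℚ-ring
  q : ∀ a b c d → b + (c * b + d * a) ≡ a * (0ℚ + d) + b * (1ℚ + c)
  q = solve-∀ ℚ-ring

∣1⊕unit∣²≤4 : ∀ {u} → Unit u → ∣ 1ᶜ ⊕ u ∣² ≤ 4ℚ
∣1⊕unit∣²≤4 {u} p = ≤-trans (∣⊕∣²-≤ 1ᶜ u) (≤-reflexive (cong (λ t → 2ℚ * 1ℚ + 2ℚ * t) p))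

∣1⊖unit∣²≤4 : ∀ {u} → Unit u → ∣ 1ᶜ ⊖ u ∣² ≤ 4ℚ
∣1⊖unit∣²≤4 {u} p = ≤-add ∣ 1ᶜ ⊕ u ∣² (0≤∣∣² (1ᶜ ⊕ u)) (trans (q (re u) (im u)) (cong (λ t → 2ℚ + 2ℚ * t) p))
  where
  q : ∀ a b → (1ℚ - a) * (1ℚ - a) + (0ℚ - b) * (0ℚ - b) + ((1ℚ + a) * (1ℚ + a) + (0ℚ + b) * (0ℚ + b)) ≡ 2ℚ + 2ℚ * (a * a + b * b)
  q = solve-∀ ℚ-ring

∣geo∣²-≤ : ∀ m {w} → Unit w → ∣ geo (2 ℕ.^ m) w ∣² ≤ 4ℚ ^ℚ m
∣geo∣²-≤ zero    uw = ≤! {∣ geo 1 1ᶜ ∣²} {1ℚ}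
∣geo∣²-≤ (suc m) {w} uw = begin
  ∣ geo (2 ℕ.^ suc m) w ∣²        ≡⟨ trans (cong ∣_∣² (geo-double (2 ℕ.^ m) w)) (∣⊗∣² (geo (2 ℕ.^ m) w) (1ᶜ ⊕ w ^ᶜ (2 ℕ.^ m))) ⟩
  ∣ geo (2 ℕ.^ m) w ∣² * ∣ 1ᶜ ⊕ w ^ᶜ (2 ℕ.^ m) ∣²
    ≤⟨ *-mono (0≤∣∣² (geo (2 ℕ.^ m) w)) (∣geo∣²-≤ m {w} uw) (0≤∣∣² (1ᶜ ⊕ w ^ᶜ (2 ℕ.^ m))) (∣1⊕unit∣²≤4 {w ^ᶜ (2 ℕ.^ m)} (Unit-^ {w} (2 ℕ.^ m) uw)) ⟩
  4ℚ ^ℚ m * 4ℚ                    ≡⟨ *-comm (4ℚ ^ℚ m) 4ℚ ⟩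
  4ℚ ^ℚ suc m ∎
  where open ≤-Reasoning

10ℚ : ℚ
10ℚ = 8ℚ + 2ℚ

-- The identity 1 + u² P = u² (1 + P) + (1 - u) (1 + u) carries closeness to -1 from one odd power
-- to the next; each step costs the factor 2 + 8.
∣1⊕odd-power∣² : ∀ {u} → Unit u → ∀ k → ∣ 1ᶜ ⊕ u ^ᶜ suc (k ℕ.* 2) ∣² ≤ 10ℚ ^ℚ k * ∣ 1ᶜ ⊕ u ∣²
∣1⊕odd-power∣² {u} uu zero = ≤-reflexive (trans (cong (λ w → ∣ 1ᶜ ⊕ w ∣²) (⊗-identityʳ u)) (sym (*-identityˡ _)))
∣1⊕odd-power∣² {u} uu (suc k) = begin
  ∣ 1ᶜ ⊕ u ⊗ (u ⊗ P) ∣²                              ≡⟨ cong ∣_∣² (cong₂ _⊹_ (p (re u) (im u) (re P) (im P)) (q (re u) (im u) (re P) (im P))) ⟩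
  ∣ u ⊗ (u ⊗ (1ᶜ ⊕ P)) ⊕ (1ᶜ ⊖ u) ⊗ (1ᶜ ⊕ u) ∣²      ≤⟨ ∣⊕∣²-≤ (u ⊗ (u ⊗ (1ᶜ ⊕ P))) ((1ᶜ ⊖ u) ⊗ (1ᶜ ⊕ u)) ⟩
  2ℚ * ∣ u ⊗ (u ⊗ (1ᶜ ⊕ P)) ∣² + 2ℚ * ∣ (1ᶜ ⊖ u) ⊗ (1ᶜ ⊕ u) ∣²
    ≡⟨ cong₂ (λ a b → 2ℚ * a + 2ℚ * b)
         (trans (∣⊗∣² u (u ⊗ (1ᶜ ⊕ P))) (cong₂ _*_ uu (trans (∣⊗∣² u (1ᶜ ⊕ P)) (cong (_* ∣ 1ᶜ ⊕ P ∣²) uu))))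
         (∣⊗∣² (1ᶜ ⊖ u) (1ᶜ ⊕ u)) ⟩
  2ℚ * (1ℚ * (1ℚ * ∣ 1ᶜ ⊕ P ∣²)) + 2ℚ * (∣ 1ᶜ ⊖ u ∣² * D)
    ≤⟨ +-mono-≤ (*-monoˡ 2ℚ (≤! {0ℚ} {2ℚ}) (*-monoˡ 1ℚ (≤! {0ℚ} {1ℚ}) (*-monoˡ 1ℚ (≤! {0ℚ} {1ℚ}) (∣1⊕odd-power∣² {u} uu k))))
                (*-monoˡ 2ℚ (≤! {0ℚ} {2ℚ}) (*-mono (0≤∣∣² (1ᶜ ⊖ u)) (∣1⊖unit∣²≤4 {u} uu) 0≤D ≤-refl)) ⟩
  2ℚ * (1ℚ * (1ℚ * (K * D))) + 2ℚ * (4ℚ * D)         ≤⟨ ≤-add (8ℚ * ((K - 1ℚ) * D)) (0≤* (≤! {0ℚ} {8ℚ}) (0≤* (0≤- (1≤^ k (≤! {1ℚ} {10ℚ}))) 0≤D)) (r K D) ⟩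
  10ℚ * K * D ∎
  where
  open ≤-Reasoning
  P : ℂ
  P = u ^ᶜ suc (k ℕ.* 2)
  D K : ℚ
  D = ∣ 1ᶜ ⊕ u ∣²
  K = 10ℚ ^ℚ k
  0≤D : 0ℚ ≤ D
  0≤D = 0≤∣∣² (1ᶜ ⊕ u)
  p : ∀ a b c d → 1ℚ + (a * (a * c - b * d) - b * (a * d + b * c))
      ≡ (a * (a * (1ℚ + c) - b * (0ℚ + d)) - b * (a * (0ℚ + d) + b * (1ℚ + c))) + ((1ℚ - a) * (1ℚ + a) - (0ℚ - b) * (0ℚ + b))
  p = solve-∀ ℚ-ring
  q : ∀ a b c d → 0ℚ + (a * (a * d + b * c) + b * (a * c - b * d))
      ≡ (a * (a * (0ℚ + d) + b * (1ℚ + c)) + b * (a * (1ℚ + c) - b * (0ℚ + d))) + ((1ℚ - a) * (0ℚ + b) + (0ℚ - b) * (1ℚ + a))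
  q = solve-∀ ℚ-ring
  r : ∀ K D → 2ℚ * (1ℚ * (1ℚ * (K * D))) + 2ℚ * (4ℚ * D) + 8ℚ * ((K - 1ℚ) * D) ≡ 10ℚ * K * D
  r = solve-∀ ℚ-ring

parity : ∀ d → ∃[ k ] (d ≡ k ℕ.* 2 ⊎ d ≡ suc (k ℕ.* 2))
parity zero = 0 , inj₁ refl
parity (suc d) with parity d
... | k , inj₁ e = k , inj₂ (cong suc e)
... | k , inj₂ e = suc k , inj₁ (cong suc e)

geo-bound : ℕ → ℚ
geo-bound m = 4ℚ ^ℚ m * 10ℚ ^ℚ (2 ℕ.^ m)

0<geo-bound : ∀ m → 0ℚ < geo-bound m
0<geo-bound m = 0<* (0<^ m (<! {0ℚ} {4ℚ})) (0<^ (2 ℕ.^ m) (<! {0ℚ} {10ℚ}))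

-- geo (2 ^ (1 + m)) (z ^ d) is a product of factors 1 + z ^ (d 2 ^ i), i ≤ m; the one that makes
-- the exponent an odd multiple of 2 ^ m is small.
geo-small : ∀ m {z} d → Unit z → 0 ℕ.< d → d ℕ.< 2 ℕ.^ suc m →
  ∣ geo (2 ℕ.^ suc m) (z ^ᶜ d) ∣² ≤ geo-bound (suc m) * ∣ 1ᶜ ⊕ z ^ᶜ (2 ℕ.^ m) ∣²
geo-small m {z} d uz 0<d d< with parity d
... | k , inj₂ refl = begin
  ∣ geo (2 ℕ.^ suc m) w ∣²                         ≡⟨ trans (cong ∣_∣² (geo-double H w)) (∣⊗∣² (geo H w) (1ᶜ ⊕ w ^ᶜ H)) ⟩
  ∣ geo H w ∣² * ∣ 1ᶜ ⊕ w ^ᶜ H ∣²                  ≡⟨ cong (λ t → ∣ geo H w ∣² * ∣ 1ᶜ ⊕ t ∣²) swap ⟩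
  ∣ geo H w ∣² * ∣ 1ᶜ ⊕ (z ^ᶜ H) ^ᶜ suc (k ℕ.* 2) ∣²
    ≤⟨ *-mono (0≤∣∣² (geo H w)) (≤-trans (∣geo∣²-≤ m {w} (Unit-^ {z} d uz)) (^ℚ-monoʳ {4ℚ} (≤! {1ℚ} {4ℚ}) (ℕₚ.n≤1+n m)))
              (0≤∣∣² (1ᶜ ⊕ (z ^ᶜ H) ^ᶜ suc (k ℕ.* 2))) (∣1⊕odd-power∣² {z ^ᶜ H} (Unit-^ {z} H uz) k) ⟩
  4ℚ ^ℚ suc m * (10ℚ ^ℚ k * D)
    ≤⟨ *-monoˡ (4ℚ ^ℚ suc m) (0≤^ (suc m) (≤! {0ℚ} {4ℚ})) (*-monoʳ-≤-nonNeg D {{nonNegative 0≤D}} (^ℚ-monoʳ {10ℚ} (≤! {1ℚ} {10ℚ}) k≤)) ⟩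
  4ℚ ^ℚ suc m * (10ℚ ^ℚ (2 ℕ.^ suc m) * D)         ≡⟨ sym (*-assoc (4ℚ ^ℚ suc m) _ D) ⟩
  geo-bound (suc m) * D ∎
  where
  open ≤-Reasoning
  H : ℕ
  H = 2 ℕ.^ m
  w : ℂ
  w = z ^ᶜ d
  D : ℚ
  D = ∣ 1ᶜ ⊕ z ^ᶜ H ∣²
  0≤D : 0ℚ ≤ D
  0≤D = 0≤∣∣² (1ᶜ ⊕ z ^ᶜ H)
  swap : w ^ᶜ H ≡ (z ^ᶜ H) ^ᶜ d
  swap = trans (sym (^ᶜ-* z d H)) (trans (cong (z ^ᶜ_) (ℕₚ.*-comm H d)) (^ᶜ-* z H d))
  k≤ : k ℕ.≤ 2 ℕ.^ suc m
  k≤ = ℕₚ.≤-trans (ℕₚ.m≤m*n k 2) (ℕₚ.<⇒≤ (ℕₚ.<-trans (ℕₚ.n<1+n (k ℕ.* 2)) d<))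
geo-small zero {z} .(zero ℕ.* 2) uz () d< | zero , inj₁ refl
geo-small (suc m) {z} .(zero ℕ.* 2) uz () d< | zero , inj₁ refl
geo-small zero {z} .(suc k ℕ.* 2) uz 0<d (ℕ.s≤s (ℕ.s≤s ())) | suc k , inj₁ refl
geo-small (suc m) {z} d uz 0<d d< | suc k , inj₁ refl = begin
  ∣ geo (2 ℕ.^ suc (suc m)) w ∣²                   ≡⟨ trans (cong ∣_∣² (geo-double H w)) (∣⊗∣² (geo H w) (1ᶜ ⊕ w ^ᶜ H)) ⟩
  ∣ geo H w ∣² * ∣ 1ᶜ ⊕ w ^ᶜ H ∣²                  ≤⟨ *-mono (0≤∣∣² (geo H w)) IH (0≤∣∣² (1ᶜ ⊕ w ^ᶜ H)) (∣1⊕unit∣²≤4 {w ^ᶜ H} (Unit-^ {w} H (Unit-^ {z} d uz))) ⟩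
  geo-bound (suc m) * D * 4ℚ                       ≡⟨ p (4ℚ ^ℚ suc m) (10ℚ ^ℚ H) D ⟩
  4ℚ ^ℚ suc (suc m) * (10ℚ ^ℚ H * D)
    ≤⟨ *-monoˡ (4ℚ ^ℚ suc (suc m)) (0≤^ (suc (suc m)) (≤! {0ℚ} {4ℚ})) (*-monoʳ-≤-nonNeg D {{nonNegative (0≤∣∣² (1ᶜ ⊕ z ^ᶜ H))}} (^ℚ-monoʳ {10ℚ} (≤! {1ℚ} {10ℚ}) (ℕₚ.m≤m+n H (H ℕ.+ 0)))) ⟩
  4ℚ ^ℚ suc (suc m) * (10ℚ ^ℚ (2 ℕ.^ suc (suc m)) * D)   ≡⟨ sym (*-assoc (4ℚ ^ℚ suc (suc m)) _ D) ⟩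
  geo-bound (suc (suc m)) * D ∎
  where
  open ≤-Reasoning
  H : ℕ
  H = 2 ℕ.^ suc m
  w : ℂ
  w = z ^ᶜ d
  D : ℚ
  D = ∣ 1ᶜ ⊕ z ^ᶜ H ∣²
  p : ∀ a b d → a * b * d * 4ℚ ≡ 4ℚ * a * (b * d)
  p = solve-∀ ℚ-ring
  even : w ≡ (z ⊗ z) ^ᶜ suc k
  even = trans (cong (z ^ᶜ_) (ℕₚ.*-comm (suc k) 2)) (double-^ᶜ z (suc k))
  IH : ∣ geo H w ∣² ≤ geo-bound (suc m) * D
  IH = subst₂ (λ x y → ∣ geo H x ∣² ≤ geo-bound (suc m) * ∣ 1ᶜ ⊕ y ∣²) (sym even) (sym (double-^ᶜ z (2 ℕ.^ m)))
    (geo-small m {z ⊗ z} (suc k) (Unit-⊗ {z} {z} uz uz) (ℕ.s≤s ℕ.z≤n)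
      (ℕₚ.*-cancelʳ-< 2 (suc k) H (ℕₚ.<-≤-trans d< (ℕₚ.≤-reflexive (ℕₚ.*-comm 2 H)))))

abstract
  -- The accuracy of z is taken so high that even the enormous constant `geo-bound` disappears in
  -- ε². Real parts suffice, as they are the inner products of two characters.
  characters : ∀ m ε → 0ℚ < ε → ∃[ z ] (Unit z × (∀ d → 0 ℕ.< d → d ℕ.< 2 ℕ.^ suc m →
    ∑ (2 ℕ.^ suc m) (λ ξ → re (z ^ᶜ (ξ ℕ.* d))) ≤ ε × - ε ≤ ∑ (2 ℕ.^ suc m) (λ ξ → re (z ^ᶜ (ξ ℕ.* d)))))
  characters m ε 0<ε =
    let C = geo-bound (suc m)
        C⁻¹ , 0<C⁻¹ , CC⁻¹ = inverse C (0<geo-bound (suc m))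
        z , uz , _ , close = near-root-of-−1 m (C⁻¹ * (ε * ε)) (0<* 0<C⁻¹ (0<* 0<ε 0<ε))
        bound : ∀ d → 0 ℕ.< d → d ℕ.< 2 ℕ.^ suc m → ∣ geo (2 ℕ.^ suc m) (z ^ᶜ d) ∣² ≤ ε * ε
        bound d 0<d d< = begin
          ∣ geo (2 ℕ.^ suc m) (z ^ᶜ d) ∣²     ≤⟨ geo-small m {z} d uz 0<d d< ⟩
          C * ∣ 1ᶜ ⊕ z ^ᶜ (2 ℕ.^ m) ∣²        ≡⟨ cong (λ t → C * t) (cong₂ (λ a b → ∣ a ⊹ b ∣²) (+-comm 1ℚ (re (z ^ᶜ (2 ℕ.^ m)))) (+-comm 0ℚ (im (z ^ᶜ (2 ℕ.^ m))))) ⟩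
          C * ∣ z ^ᶜ (2 ℕ.^ m) ⊕ 1ᶜ ∣²        ≤⟨ *-monoˡ C (<⇒≤ (0<geo-bound (suc m))) close ⟩
          C * (C⁻¹ * (ε * ε))                 ≡⟨ sym (*-assoc C C⁻¹ (ε * ε)) ⟩
          C * C⁻¹ * (ε * ε)                   ≡⟨ cong (_* (ε * ε)) CC⁻¹ ⟩
          1ℚ * (ε * ε)                        ≡⟨ *-identityˡ _ ⟩
          ε * ε ∎
        re-sum : ∀ d → ∑ (2 ℕ.^ suc m) (λ ξ → re (z ^ᶜ (ξ ℕ.* d))) ≡ re (geo (2 ℕ.^ suc m) (z ^ᶜ d))
        re-sum d = ∑-cong (2 ℕ.^ suc m) (λ ξ _ → cong re (^ᶜ-* z d ξ))
        sq : ∀ d → 0 ℕ.< d → d ℕ.< 2 ℕ.^ suc m → re (geo (2 ℕ.^ suc m) (z ^ᶜ d)) * re (geo (2 ℕ.^ suc m) (z ^ᶜ d)) ≤ ε * ε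
        sq d 0<d d< = ≤-trans (≤-add _ (0≤sq (im (geo (2 ℕ.^ suc m) (z ^ᶜ d)))) refl) (bound d 0<d d<)
    in z , uz , λ d 0<d d< →
         subst (_≤ ε) (sym (re-sum d)) (sq-cancel-≤ (<⇒≤ 0<ε) (sq d 0<d d<)) ,
         subst (- ε ≤_) (sym (re-sum d))
           (subst (- ε ≤_) (neg-involutive _)
             (neg-antimono-≤ (sq-cancel-≤ (<⇒≤ 0<ε) (subst (_≤ ε * ε) (sym (neg-sq (re (geo (2 ℕ.^ suc m) (z ^ᶜ d))))) (sq d 0<d d<)))))
    where
    open ≤-Reasoning

-- Fourier analysis

𝟙 : {P : Set} → Dec P → ℚ
𝟙 (yes _) = 1ℚ
𝟙 (no _)  = 0ℚ

0≤𝟙 : ∀ {P : Set} (d : Dec P) → 0ℚ ≤ 𝟙 d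
0≤𝟙 (yes _) = ≤! {0ℚ} {1ℚ}
0≤𝟙 (no _)  = ≤-refl

𝟙-yes : ∀ {P : Set} (d : Dec P) → P → 𝟙 d ≡ 1ℚ
𝟙-yes (yes _) _ = refl
𝟙-yes (no ¬p) p = ⊥-elim (¬p p)

𝟙-no : ∀ {P : Set} (d : Dec P) → ¬ P → 𝟙 d ≡ 0ℚ
𝟙-no (yes p) ¬p = ⊥-elim (¬p p)
𝟙-no (no _)  _  = refl

∑-𝟙 : ∀ n (g : ℕ → ℚ) {x} → x ℕ.< n → ∑ n (λ y → 𝟙 (x ℕₚ.≟ y) * g y) ≡ g x
∑-𝟙 (suc n) g {x} x<1+n with ℕₚ.m≤n⇒m<n∨m≡n (ℕₚ.≤-pred x<1+n)
... | inj₁ x<n  = trans (cong₂ _+_ (∑-𝟙 n g x<n) (trans (cong (_* g n) (𝟙-no (x ℕₚ.≟ n) (ℕₚ.<⇒≢ x<n))) (*-zeroˡ (g n)))) (+-identityʳ (g x))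
... | inj₂ refl = trans (cong₂ _+_
      (∑-zero n (λ y y<n → trans (cong (_* g y) (𝟙-no (x ℕₚ.≟ y) (λ e → ℕₚ.<⇒≢ y<n (sym e)))) (*-zeroˡ (g y))))
      (trans (cong (_* g x) (𝟙-yes (x ℕₚ.≟ x) refl)) (*-identityˡ (g x)))) (+-identityˡ (g x))

-x*y≤∣x∣ : ∀ x {y} → y * y ≤ 1ℚ → - (x * y) ≤ ∣ x ∣
-x*y≤∣x∣ x {y} p with ≤-total 0ℚ x
... | inj₁ 0≤x = subst (- (x * y) ≤_) (sym (0≤p⇒∣p∣≡p 0≤x))
      (≤-add (x * (y - - 1ℚ)) (0≤* 0≤x (0≤- (sq≤1⇒-1≤ {y} p))) (eq x y))
  where
  eq : ∀ x y → - (x * y) + x * (y - - 1ℚ) ≡ x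
  eq = solve-∀ ℚ-ring
... | inj₂ x≤0 = subst (- (x * y) ≤_) (trans (sym (0≤p⇒∣p∣≡p 0≤-x)) (∣-p∣≡∣p∣ x))
      (≤-add (- x * (1ℚ - y)) (0≤* 0≤-x (0≤- (sq≤1⇒≤1 {y} p))) (eq x y))
  where
  0≤-x : 0ℚ ≤ - x
  0≤-x = neg-antimono-≤ x≤0
  eq : ∀ x y → - (x * y) + - x * (1ℚ - y) ≡ - x
  eq = solve-∀ ℚ-ring

∣x∣²≡x² : ∀ x → ∣ x ∣ * ∣ x ∣ ≡ x * x
∣x∣²≡x² x with ∣p∣≡p∨∣p∣≡-p x
... | inj₁ e = cong₂ _*_ e e
... | inj₂ e = trans (cong₂ _*_ e e) (neg-sq x)

-- A rational substitute for the modulus, equal to it up to a factor √2.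
∥_∥₁ : ℂ → ℚ
∥ x ∥₁ = ∣ re x ∣ + ∣ im x ∣

∥∥₁²≤2∣∣² : ∀ x → ∥ x ∥₁ * ∥ x ∥₁ ≤ 2ℚ * ∣ x ∣²
∥∥₁²≤2∣∣² x = ≤-add ((a - b) * (a - b)) (0≤sq (a - b))
    (trans (p a b) (cong₂ (λ s t → 2ℚ * (s + t)) (∣x∣²≡x² (re x)) (∣x∣²≡x² (im x))))
  where
  a b : ℚ
  a = ∣ re x ∣
  b = ∣ im x ∣
  p : ∀ a b → (a + b) * (a + b) + (a - b) * (a - b) ≡ 2ℚ * (a * a + b * b)
  p = solve-∀ ℚ-ring

-⟨⟩≤∥∥₁ : ∀ x {u} → Unit u → - ⟨ x , u ⟩ ≤ ∥ x ∥₁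
-⟨⟩≤∥∥₁ x {u} uu = subst (_≤ ∥ x ∥₁) (sym (neg-distrib-+ (re x * re u) (im x * im u)))
  (+-mono-≤ (-x*y≤∣x∣ (re x) {re u} (Unit⇒re-sq≤1 {u} uu)) (-x*y≤∣x∣ (im x) {im u} (Unit⇒im-sq≤1 {u} uu)))

infixr 7 _•_
_•_ : ℚ → ℂ → ℂ
a • w = (a * re w) ⊹ (a * im w)

⟨⟩-comm : ∀ x y → ⟨ x , y ⟩ ≡ ⟨ y , x ⟩
⟨⟩-comm x y = cong₂ _+_ (*-comm (re x) (re y)) (*-comm (im x) (im y))

⟨⟩-∑ˡ : ∀ n (a : ℕ → ℚ) (f : ℕ → ℂ) w → ⟨ ∑ᶜ n (λ i → a i • f i) , w ⟩ ≡ ∑ n (λ i → a i * ⟨ f i , w ⟩)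
⟨⟩-∑ˡ n a f w = trans (cong₂ _+_ (∑-* n _ (re w)) (∑-* n _ (im w)))
  (trans (sym (∑-distrib-+ n _ _)) (∑-cong n (λ i _ → p (a i) (re (f i)) (im (f i)) (re w) (im w))))
  where
  p : ∀ a b c d e → a * b * d + a * c * e ≡ a * (b * d + c * e)
  p = solve-∀ ℚ-ring

⟨⟩-∑∑ : ∀ m n (a b : ℕ → ℚ) (f g : ℕ → ℂ) →
  ⟨ ∑ᶜ m (λ i → a i • f i) , ∑ᶜ n (λ j → b j • g j) ⟩ ≡ ∑ m (λ i → ∑ n (λ j → a i * b j * ⟨ f i , g j ⟩))
⟨⟩-∑∑ m n a b f g = trans (⟨⟩-∑ˡ m a f _) (∑-cong m (λ i _ →
  trans (cong (a i *_) (trans (⟨⟩-comm (f i) _) (⟨⟩-∑ˡ n b g (f i))))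
  (trans (*-∑ n (a i) _) (∑-cong n (λ j _ →
    trans (sym (*-assoc (a i) (b j) _)) (cong (a i * b j *_) (⟨⟩-comm (g j) (f i))))))))

⟨a,a⊗c⟩ : ∀ {a} c → Unit a → ⟨ a , a ⊗ c ⟩ ≡ re c
⟨a,a⊗c⟩ {a} c ua = trans (p (re a) (im a) (re c) (im c)) (trans (cong (_* re c) ua) (*-identityˡ (re c)))
  where
  p : ∀ x y u v → x * (x * u - y * v) + y * (x * v + y * u) ≡ (x * x + y * y) * u
  p = solve-∀ ℚ-ring

⟨⊗,⊗⟩ : ∀ x y w → ⟨ x ⊗ w , y ⊗ w ⟩ ≡ ∣ w ∣² * ⟨ x , y ⟩
⟨⊗,⊗⟩ x y w = p (re x) (im x) (re y) (im y) (re w) (im w)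
  where
  p : ∀ a b c d e f → (a * e - b * f) * (c * e - d * f) + (a * f + b * e) * (c * f + d * e) ≡ (e * e + f * f) * (a * c + b * d)
  p = solve-∀ ℚ-ring

⊗-• : ∀ x a w → x ⊗ (a • w) ≡ a • (x ⊗ w)
⊗-• x a w = cong₂ _⊹_ (p (re x) (im x) (re w) (im w) a) (q (re x) (im x) (re w) (im w) a)
  where
  p : ∀ x y u v a → x * (a * u) - y * (a * v) ≡ a * (x * u - y * v)
  p = solve-∀ ℚ-ring
  q : ∀ x y u v a → x * (a * v) + y * (a * u) ≡ a * (x * v + y * u)
  q = solve-∀ ℚ-ring

conj : ℂ → ℂ
conj x = re x ⊹ (- im x)

conj-⊗-cancel : ∀ {a} c → Unit a → conj a ⊗ (a ⊗ c) ≡ c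
conj-⊗-cancel {a} c ua = trans (cong₂ _⊹_ (p (re a) (im a) (re c) (im c)) (q (re a) (im a) (re c) (im c)))
  (cong₂ _⊹_ (trans (cong (_* re c) ua) (*-identityˡ (re c))) (trans (cong (_* im c) ua) (*-identityˡ (im c))))
  where
  p : ∀ x y u v → x * (x * u - y * v) - - y * (x * v + y * u) ≡ (x * x + y * y) * u
  p = solve-∀ ℚ-ring
  q : ∀ x y u v → x * (x * v + y * u) + - y * (x * u - y * v) ≡ (x * x + y * y) * v
  q = solve-∀ ℚ-ring

-- Functions live on [0 , R) and frequencies on [0 , N); since R + R ≤ N, sums of two positions do
-- not wrap around.
module Fourier (R N : ℕ) (R+R≤N : R ℕ.+ R ℕ.≤ N) (1≤N : 1 ℕ.≤ N) (z : ℂ) (uz : Unit z)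
  (ε : ℚ) (0≤ε : 0ℚ ≤ ε) (Nε≤1 : ι N * ε ≤ 1ℚ)
  (orthogonal : ∀ d → 0 ℕ.< d → d ℕ.< N →
     ∑ N (λ ξ → re (z ^ᶜ (ξ ℕ.* d))) ≤ ε × - ε ≤ ∑ N (λ ξ → re (z ^ᶜ (ξ ℕ.* d)))) where

  χ : ℕ → ℕ → ℂ
  χ ξ x = z ^ᶜ (ξ ℕ.* x)

  Unit-χ : ∀ ξ x → Unit (χ ξ x)
  Unit-χ ξ x = Unit-^ {z} (ξ ℕ.* x) uz

  χ-+ : ∀ ξ x y → χ ξ (x ℕ.+ y) ≡ χ ξ x ⊗ χ ξ y
  χ-+ ξ x y = trans (cong (z ^ᶜ_) (ℕₚ.*-distribˡ-+ ξ x y)) (^ᶜ-+ z (ξ ℕ.* x) (ξ ℕ.* y))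

  -- An approximate delta function on [0 , N): `N` on the diagonal, within ε of 0 off it.
  kernel : ℕ → ℕ → ℚ
  kernel p q = ∑ N (λ ξ → ⟨ χ ξ p , χ ξ q ⟩)

  kernel-diag : ∀ p → kernel p p ≡ ι N
  kernel-diag p = trans (∑-cong N (λ ξ _ → Unit-χ ξ p)) (trans (∑-const N 1ℚ) (*-identityʳ (ι N)))

  kernel-comm : ∀ p q → kernel p q ≡ kernel q p
  kernel-comm p q = ∑-cong N (λ ξ _ → ⟨⟩-comm (χ ξ p) (χ ξ q))

  kernel-< : ∀ p q → p ℕ.< q → q ℕ.< N → kernel p q ≤ ε × - ε ≤ kernel p q
  kernel-< p q p<q q<N = subst (λ t → t ≤ ε × - ε ≤ t) (sym eq)
      (orthogonal (q ℕ.∸ p) (ℕₚ.m<n⇒0<n∸m p<q) (ℕₚ.≤-<-trans (ℕₚ.m∸n≤m q p) q<N))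
    where
    eq : kernel p q ≡ ∑ N (λ ξ → re (z ^ᶜ (ξ ℕ.* (q ℕ.∸ p))))
    eq = ∑-cong N (λ ξ _ → trans
      (cong (λ t → ⟨ χ ξ p , t ⟩) (trans (cong (χ ξ) (sym (ℕₚ.m+[n∸m]≡n (ℕₚ.<⇒≤ p<q)))) (χ-+ ξ p (q ℕ.∸ p))))
      (⟨a,a⊗c⟩ {χ ξ p} (χ ξ (q ℕ.∸ p)) (Unit-χ ξ p)))

  kernel-off : ∀ p q → p ℕ.< N → q ℕ.< N → ¬ p ≡ q → kernel p q ≤ ε × - ε ≤ kernel p q
  kernel-off p q p<N q<N p≢q with ℕₚ.<-cmp p q
  ... | tri< p<q _ _ = kernel-< p q p<q q<N
  ... | tri≈ _ p≡q _ = ⊥-elim (p≢q p≡q)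
  ... | tri> _ _ q<p = subst (λ t → t ≤ ε × - ε ≤ t) (kernel-comm q p) (kernel-< q p q<p p<N)

  hat : (ℕ → ℚ) → ℕ → ℂ
  hat u ξ = ∑ᶜ R (λ x → u x • χ ξ x)

  χ⊗hat : ∀ u ξ t → χ ξ t ⊗ hat u ξ ≡ ∑ᶜ R (λ y → u y • χ ξ (t ℕ.+ y))
  χ⊗hat u ξ t = trans (⊗-∑ᶜ R (χ ξ t) _) (∑ᶜ-cong R (λ y →
    trans (⊗-• (χ ξ t) (u y) (χ ξ y)) (cong (u y •_) (sym (χ-+ ξ t y)))))

  ∑∣hat∣² : ∀ u → ∑ N (λ ξ → ∣ hat u ξ ∣²) ≡ ∑ R (λ x → ∑ R (λ y → u x * u y * kernel x y))
  ∑∣hat∣² u = trans (∑-cong N (λ ξ _ → ⟨⟩-∑∑ R R u u (χ ξ) (χ ξ)))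
    (trans (∑-swap N R _) (∑-cong R (λ x _ →
      trans (∑-swap N R _) (∑-cong R (λ y _ → sym (*-∑ N (u x * u y) _))))))

  -- Exact orthogonality would give the constant N. The off-diagonal terms add at most ε R Σ u², and
  -- N ε ≤ 1 lets a second N absorb them.
  bessel : ∀ u → ∑ N (λ ξ → ∣ hat u ξ ∣²) ≤ 2ℚ * ι N * ∑ R (λ x → u x * u x)
  bessel u = begin
    ∑ N (λ ξ → ∣ hat u ξ ∣²)                                  ≡⟨ ∑∣hat∣² u ⟩
    ∑ R (λ x → ∑ R (λ y → u x * u y * kernel x y))            ≤⟨ ∑-mono R (λ x x<R → ∑-mono R (λ y y<R → term x y x<R y<R)) ⟩
    ∑ R (λ x → ∑ R (λ y → 𝟙 (x ℕₚ.≟ y) * (ι N * (u x * u y)) + ½ * ε * (u x * u x + u y * u y)))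
      ≡⟨ ∑-cong R (λ x x<R → trans (∑-distrib-+ R _ _) (cong₂ _+_ (∑-𝟙 R (λ y → ι N * (u x * u y)) x<R)
           (trans (sym (*-∑ R (½ * ε) _)) (cong (½ * ε *_) (trans (∑-distrib-+ R _ _) (cong (_+ U) (∑-const R (u x * u x)))))))) ⟩
    ∑ R (λ x → ι N * (u x * u x) + ½ * ε * (ι R * (u x * u x) + U))
      ≡⟨ trans (∑-distrib-+ R _ _) (cong₂ _+_ (sym (*-∑ R (ι N) _))
           (trans (sym (*-∑ R (½ * ε) _)) (cong (½ * ε *_) (trans (∑-distrib-+ R _ _) (cong₂ _+_ (sym (*-∑ R (ι R) _)) (∑-const R U)))))) ⟩
    ι N * U + ½ * ε * (ι R * U + ι R * U)                     ≤⟨ ≤-add (((ι N - ι R) * ε + ((1ℚ - ι N * ε) + (ι N - 1ℚ))) * U)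
          (0≤* (0≤+ (0≤* (0≤- (ι-mono R≤N)) 0≤ε) (0≤+ (0≤- Nε≤1) (0≤- (subst (_≤ ι N) (+-identityʳ 1ℚ) (ι-mono 1≤N))))) (0≤∑ R (λ x → 0≤sq (u x)))) (p (ι N) (ι R) ε U) ⟩
    2ℚ * ι N * U ∎
    where
    open ≤-Reasoning
    U : ℚ
    U = ∑ R (λ x → u x * u x)
    R≤N : R ℕ.≤ N
    R≤N = ℕₚ.≤-trans (ℕₚ.m≤m+n R R) R+R≤N
    p : ∀ N R e U → N * U + ½ * e * (R * U + R * U) + ((N - R) * e + ((1ℚ - N * e) + (N - 1ℚ))) * U ≡ 2ℚ * N * U
    p = solve-∀ ℚ-ring
    term : ∀ x y → x ℕ.< R → y ℕ.< R → u x * u y * kernel x y ≤ 𝟙 (x ℕₚ.≟ y) * (ι N * (u x * u y)) + ½ * ε * (u x * u x + u y * u y)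
    term x y x<R y<R with x ℕₚ.≟ y
    ... | yes refl = ≤-add (½ * ε * (u x * u x + u x * u x)) (0≤* (0≤* (≤! {0ℚ} {½}) 0≤ε) (0≤+ (0≤sq (u x)) (0≤sq (u x))))
          (cong (_+ ½ * ε * (u x * u x + u x * u x)) (trans (cong (u x * u x *_) (kernel-diag x)) (q (u x * u x) (ι N))))
      where
      q : ∀ a b → a * b ≡ 1ℚ * (b * a)
      q = solve-∀ ℚ-ring
    ... | no x≢y with kernel-off x y (ℕₚ.<-≤-trans x<R R≤N) (ℕₚ.<-≤-trans y<R R≤N) x≢y
    -- |u x u y k| ≤ ½ ε (u x² + u y²), with the slack written as two weighted squares so that no
    -- absolute value appears.
    ... | k≤ε , -ε≤k = ≤-add (¼ * ((ε - k) * ((u x + u y) * (u x + u y)) + (k - - ε) * ((u x - u y) * (u x - u y))))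
          (0≤* (≤! {0ℚ} {¼}) (0≤+ (0≤* (0≤- k≤ε) (0≤sq (u x + u y))) (0≤* (0≤- -ε≤k) (0≤sq (u x - u y))))) (q (u x) (u y) k ε)
      where
      k : ℚ
      k = kernel x y
      q : ∀ a b k e → a * b * k + ½ * ½ * ((e - k) * ((a + b) * (a + b)) + (k - - e) * ((a - b) * (a - b)))
          ≡ 0ℚ * (ι N * (a * b)) + ½ * e * (a * a + b * b)
      q a b k e = trans (q′ a b k e) (cong (_+ ½ * e * (a * a + b * b)) (sym (*-zeroˡ (ι N * (a * b)))))
        where
        q′ : ∀ a b k e → a * b * k + ½ * ½ * ((e - k) * ((a + b) * (a + b)) + (k - - e) * ((a - b) * (a - b)))
          ≡ 0ℚ + ½ * e * (a * a + b * b)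
        q′ = solve-∀ ℚ-ring

  -- |â|² ⟨χ t , χ x⟩ is the inner product of χ t â and χ x â, and multiplying a transform by a
  -- character translates the function.
  spectral-count : ∀ (F a : ℕ → ℚ) x →
    ∑ N (λ ξ → ∣ hat a ξ ∣² * ⟨ hat F ξ , χ ξ x ⟩)
      ≡ ∑ R (λ t → F t * ∑ R (λ y → ∑ R (λ y′ → a y * a y′ * kernel (t ℕ.+ y) (x ℕ.+ y′))))
  spectral-count F a x = begin
    ∑ N (λ ξ → ∣ hat a ξ ∣² * ⟨ hat F ξ , χ ξ x ⟩)
      ≡⟨ ∑-cong N (λ ξ _ → trans (cong (∣ hat a ξ ∣² *_) (⟨⟩-∑ˡ R F (χ ξ) (χ ξ x))) (trans (*-∑ R (∣ hat a ξ ∣²) _) (∑-cong R (λ t _ → at ξ t)))) ⟩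
    ∑ N (λ ξ → ∑ R (λ t → F t * ∑ R (λ y → ∑ R (λ y′ → a y * a y′ * ⟨ χ ξ (t ℕ.+ y) , χ ξ (x ℕ.+ y′) ⟩))))
      ≡⟨ trans (∑-swap N R _) (∑-cong R (λ t _ → trans (sym (*-∑ N (F t) _)) (cong (F t *_) (
           trans (∑-swap N R _) (∑-cong R (λ y _ → trans (∑-swap N R _) (∑-cong R (λ y′ _ → sym (*-∑ N (a y * a y′) _))))))))) ⟩
    ∑ R (λ t → F t * ∑ R (λ y → ∑ R (λ y′ → a y * a y′ * kernel (t ℕ.+ y) (x ℕ.+ y′)))) ∎
    where
    open ≡-Reasoning
    at : ∀ ξ t → ∣ hat a ξ ∣² * (F t * ⟨ χ ξ t , χ ξ x ⟩) ≡ F t * ∑ R (λ y → ∑ R (λ y′ → a y * a y′ * ⟨ χ ξ (t ℕ.+ y) , χ ξ (x ℕ.+ y′) ⟩))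
    at ξ t = trans (r (∣ hat a ξ ∣²) (F t) ⟨ χ ξ t , χ ξ x ⟩) (cong (F t *_) (trans (sym (⟨⊗,⊗⟩ (χ ξ t) (χ ξ x) (hat a ξ)))
      (trans (cong₂ ⟨_,_⟩ (χ⊗hat a ξ t) (χ⊗hat a ξ x)) (⟨⟩-∑∑ R R a a (λ y → χ ξ (t ℕ.+ y)) (λ y → χ ξ (x ℕ.+ y))))))
      where
      r : ∀ a b c → a * (b * c) ≡ b * (a * c)
      r = solve-∀ ℚ-ring

  -- Orthogonality turns the spectral sum into a count of the solutions of t + y = x + y′.
  count-bound : ∀ (F a : ℕ → ℚ) c {x} → x ℕ.< R → (∀ t → F t ≤ c) → (∀ t → - c ≤ F t) → (∀ y → 0ℚ ≤ a y) →
    - (ι N * ∑ R (λ t → F t * ∑ R (λ y → ∑ R (λ y′ → a y * a y′ * 𝟙 (t ℕ.+ y ℕₚ.≟ x ℕ.+ y′))))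
        + ι R * (c * (ε * (∑ R a * ∑ R a))))
      ≤ ∑ N (λ ξ → ∣ hat a ξ ∣² * ∥ hat F ξ ∥₁)
  count-bound F a c {x} x<R F≤c -c≤F 0≤a = begin
    - (ι N * ∑ R (λ t → F t * Y t) + ι R * (c * (ε * Z)))   ≤⟨ neg-antimono-≤ main ⟩
    - ∑ N (λ ξ → ∣ hat a ξ ∣² * ⟨ hat F ξ , χ ξ x ⟩)       ≡⟨ trans (neg-one _) (trans (*-∑ N (- 1ℚ) _) (∑-cong N (λ ξ _ → neg-in (∣ hat a ξ ∣²) _))) ⟩
    ∑ N (λ ξ → ∣ hat a ξ ∣² * - ⟨ hat F ξ , χ ξ x ⟩)       ≤⟨ ∑-mono N (λ ξ _ → *-monoˡ ∣ hat a ξ ∣² (0≤∣∣² (hat a ξ)) (-⟨⟩≤∥∥₁ (hat F ξ) {χ ξ x} (Unit-χ ξ x))) ⟩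
    ∑ N (λ ξ → ∣ hat a ξ ∣² * ∥ hat F ξ ∥₁) ∎
    where
    open ≤-Reasoning
    neg-one : ∀ a → - a ≡ - 1ℚ * a
    neg-one = solve-∀ ℚ-ring
    neg-in : ∀ a b → - 1ℚ * (a * b) ≡ a * - b
    neg-in = solve-∀ ℚ-ring
    X Y : ℕ → ℚ
    X t = ∑ R (λ y → ∑ R (λ y′ → a y * a y′ * kernel (t ℕ.+ y) (x ℕ.+ y′)))
    Y t = ∑ R (λ y → ∑ R (λ y′ → a y * a y′ * 𝟙 (t ℕ.+ y ℕₚ.≟ x ℕ.+ y′)))
    Z : ℚ
    Z = ∑ R a * ∑ R a
    Z≡ : ∑ R (λ y → ∑ R (λ y′ → a y * a y′)) ≡ Z
    Z≡ = trans (∑-cong R (λ y _ → sym (*-∑ R (a y) a))) (sym (∑-* R a (∑ R a)))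
    collect : ∀ s t → ∑ R (λ y → ∑ R (λ y′ → ι N * (a y * a y′ * 𝟙 (t ℕ.+ y ℕₚ.≟ x ℕ.+ y′)) + s * (a y * a y′))) ≡ ι N * Y t + s * Z
    collect s t = trans (∑-cong R (λ y _ → trans (∑-distrib-+ R _ _) (cong₂ _+_ (sym (*-∑ R (ι N) _)) (sym (*-∑ R s _)))))
      (trans (∑-distrib-+ R _ _) (cong₂ _+_ (sym (*-∑ R (ι N) _)) (trans (sym (*-∑ R s _)) (cong (s *_) Z≡))))
    term : ∀ t y y′ → t ℕ.< R → y ℕ.< R → y′ ℕ.< R →
      a y * a y′ * kernel (t ℕ.+ y) (x ℕ.+ y′) ≤ ι N * (a y * a y′ * 𝟙 (t ℕ.+ y ℕₚ.≟ x ℕ.+ y′)) + ε * (a y * a y′) ×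
      ι N * (a y * a y′ * 𝟙 (t ℕ.+ y ℕₚ.≟ x ℕ.+ y′)) + (- ε) * (a y * a y′) ≤ a y * a y′ * kernel (t ℕ.+ y) (x ℕ.+ y′)
    term t y y′ t<R y<R y′<R with t ℕ.+ y ℕₚ.≟ x ℕ.+ y′
    ... | yes e rewrite e | kernel-diag (x ℕ.+ y′) =
          ≤-add (ε * A) (0≤* 0≤ε 0≤A) (p A (ι N) ε) , ≤-add (ε * A) (0≤* 0≤ε 0≤A) (q A (ι N) ε)
      where
      A : ℚ
      A = a y * a y′
      0≤A : 0ℚ ≤ A
      0≤A = 0≤* (0≤a y) (0≤a y′)
      p : ∀ A n e → A * n + e * A ≡ n * (A * 1ℚ) + e * A
      p = solve-∀ ℚ-ring
      q : ∀ A n e → n * (A * 1ℚ) + (- e) * A + e * A ≡ A * n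
      q = solve-∀ ℚ-ring
    ... | no ≢ with kernel-off (t ℕ.+ y) (x ℕ.+ y′) (ℕₚ.<-≤-trans (ℕₚ.+-mono-< t<R y<R) R+R≤N) (ℕₚ.<-≤-trans (ℕₚ.+-mono-< x<R y′<R) R+R≤N) ≢
    ... | k≤ε , -ε≤k = ≤-add (A * (ε - k)) (0≤* 0≤A (0≤- k≤ε)) (trans (p A k ε) (z₀ (ε * A))) , ≤-add (A * (k - - ε)) (0≤* 0≤A (0≤- -ε≤k)) (trans (cong (_+ A * (k - - ε)) (sym (z₀ (- ε * A)))) (q A k ε))
      where
      k A : ℚ
      k = kernel (t ℕ.+ y) (x ℕ.+ y′)
      A = a y * a y′
      0≤A : 0ℚ ≤ A
      0≤A = 0≤* (0≤a y) (0≤a y′)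
      z₀ : ∀ s → s ≡ ι N * (A * 0ℚ) + s
      z₀ s = sym (trans (cong (_+ s) (trans (cong (ι N *_) (*-zeroʳ A)) (*-zeroʳ (ι N)))) (+-identityˡ s))
      p : ∀ A k e → A * k + A * (e - k) ≡ e * A
      p = solve-∀ ℚ-ring
      q : ∀ A k e → - e * A + A * (k - - e) ≡ A * k
      q = solve-∀ ℚ-ring
    X≤ : ∀ t → t ℕ.< R → X t ≤ ι N * Y t + ε * Z
    X≤ t t<R = subst (X t ≤_) (collect ε t) (∑-mono R (λ y y<R → ∑-mono R (λ y′ y′<R → proj₁ (term t y y′ t<R y<R y′<R))))
    ≤X : ∀ t → t ℕ.< R → ι N * Y t + (- ε) * Z ≤ X t
    ≤X t t<R = subst (_≤ X t) (collect (- ε) t) (∑-mono R (λ y y<R → ∑-mono R (λ y′ y′<R → proj₂ (term t y y′ t<R y<R y′<R))))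
    row : ∀ t → t ℕ.< R → F t * X t ≤ ι N * (F t * Y t) + c * (ε * Z)
    -- |F| ≤ c and |X - N Y| ≤ ε Z give F (X - N Y) ≤ c ε Z; the average of two products of
    -- nonnegative factors avoids a case distinction on signs.
    row t t<R = ≤-add (½ * ((c - F t) * (X t - (ι N * Y t + (- ε) * Z)) + (F t - - c) * (ι N * Y t + ε * Z - X t)))
      (0≤* (≤! {0ℚ} {½}) (0≤+ (0≤* (0≤- (F≤c t)) (0≤- (≤X t t<R))) (0≤* (0≤- (-c≤F t)) (0≤- (X≤ t t<R)))))
      (p (F t) (X t) (Y t) (ι N) ε Z c)
      where
      p : ∀ F X Y n e Z c → F * X + ½ * ((c - F) * (X - (n * Y + (- e) * Z)) + (F - - c) * (n * Y + e * Z - X)) ≡ n * (F * Y) + c * (e * Z)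
      p = solve-∀ ℚ-ring
    main : ∑ N (λ ξ → ∣ hat a ξ ∣² * ⟨ hat F ξ , χ ξ x ⟩) ≤ ι N * ∑ R (λ t → F t * Y t) + ι R * (c * (ε * Z))
    main = ≤-trans (≤-reflexive (spectral-count F a x)) (≤-trans (∑-mono R row)
      (≤-reflexive (trans (∑-distrib-+ R _ _) (cong₂ _+_ (sym (*-∑ R (ι N) _)) (∑-const R _)))))

  APsum : ℕ → ℕ → (ℕ → ℚ) → ℕ → ℚ
  APsum q L u s = ∑ L (λ i → u (i ℕ.* q ℕ.+ s))

  module _ (q L m : ℕ) (steps : ∀ i → i ℕ.< L → i ℕ.* q ℕ.≤ m) (u : ℕ → ℚ)
           (lo : ∀ x → x ℕ.< m → u x ≡ 0ℚ) (hi : ∀ x → R ℕ.≤ x → u x ≡ 0ℚ) where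

    -- Moving `u` down by i q multiplies its transform by the conjugate of χ ξ (i q). Nothing is cut
    -- off, as the support starts at m ≥ i q.
    hat-APsum : ∀ ξ → hat (APsum q L u) ξ ≡ hat u ξ ⊗ ∑ᶜ L (λ i → conj (χ ξ (i ℕ.* q)))
    hat-APsum ξ = begin
      hat (APsum q L u) ξ
        ≡⟨ cong₂ _⊹_ (expand (λ s → re (χ ξ s))) (expand (λ s → im (χ ξ s))) ⟩
      ∑ L (λ i → re (translate i)) ⊹ ∑ L (λ i → im (translate i))
        ≡⟨ cong₂ _⊹_ (∑-cong L (λ i i<L → cong re (each i i<L))) (∑-cong L (λ i i<L → cong im (each i i<L))) ⟩
      ∑ᶜ L (λ i → hat u ξ ⊗ conj (χ ξ (i ℕ.* q)))
        ≡⟨ sym (⊗-∑ᶜ L (hat u ξ) _) ⟩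
      hat u ξ ⊗ ∑ᶜ L (λ i → conj (χ ξ (i ℕ.* q))) ∎
      where
      open ≡-Reasoning
      translate : ℕ → ℂ
      translate i = ∑ᶜ R (λ s → u (i ℕ.* q ℕ.+ s) • χ ξ s)
      expand : ∀ (g : ℕ → ℚ) → ∑ R (λ s → APsum q L u s * g s) ≡ ∑ L (λ i → ∑ R (λ s → u (i ℕ.* q ℕ.+ s) * g s))
      expand g = trans (∑-cong R (λ s _ → ∑-* L _ (g s))) (∑-swap R L _)
      shifted : ∀ i → i ℕ.< L → ∑ᶜ R (λ s → u (i ℕ.* q ℕ.+ s) • χ ξ (i ℕ.* q ℕ.+ s)) ≡ hat u ξ
      shifted i i<L = cong₂ _⊹_ (shift₁ (λ x → re (χ ξ x))) (shift₁ (λ x → im (χ ξ x)))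
        where
        shift₁ : ∀ (g : ℕ → ℚ) → ∑ R (λ s → u (i ℕ.* q ℕ.+ s) * g (i ℕ.* q ℕ.+ s)) ≡ ∑ R (λ x → u x * g x)
        shift₁ g = ∑-shift R (i ℕ.* q) (λ x → u x * g x)
          (λ x x<iq → trans (cong (_* g x) (lo x (ℕₚ.<-≤-trans x<iq (steps i i<L)))) (*-zeroˡ (g x)))
          (λ x R≤x → trans (cong (_* g x) (hi x R≤x)) (*-zeroˡ (g x)))
      each : ∀ i → i ℕ.< L → translate i ≡ hat u ξ ⊗ conj (χ ξ (i ℕ.* q))
      each i i<L = begin
        translate i
          ≡⟨ ∑ᶜ-cong R (λ s → trans (cong (u (i ℕ.* q ℕ.+ s) •_) (trans (sym (conj-⊗-cancel {w} (χ ξ s) (Unit-χ ξ (i ℕ.* q)))) (cong (conj w ⊗_) (sym (χ-+ ξ (i ℕ.* q) s)))))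
                                    (sym (⊗-• (conj w) (u (i ℕ.* q ℕ.+ s)) (χ ξ (i ℕ.* q ℕ.+ s))))) ⟩
        ∑ᶜ R (λ s → conj w ⊗ (u (i ℕ.* q ℕ.+ s) • χ ξ (i ℕ.* q ℕ.+ s)))   ≡⟨ sym (⊗-∑ᶜ R (conj w) _) ⟩
        conj w ⊗ ∑ᶜ R (λ s → u (i ℕ.* q ℕ.+ s) • χ ξ (i ℕ.* q ℕ.+ s))     ≡⟨ cong (conj w ⊗_) (shifted i i<L) ⟩
        conj w ⊗ hat u ξ                                                  ≡⟨ ⊗-comm (conj w) (hat u ξ) ⟩
        hat u ξ ⊗ conj w ∎
        where
        w : ℂ
        w = χ ξ (i ℕ.* q)

    -- If the progression is trivial for ξ, the L summands of the multiplier all have real part at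
    -- least ½, so they cannot cancel.
    ∣hat-APsum∣² : ∀ ξ → (∀ i → i ℕ.< L → ½ ≤ re (χ ξ (i ℕ.* q))) →
      ½ * ι L * (½ * ι L) * ∣ hat u ξ ∣² ≤ ∣ hat (APsum q L u) ξ ∣²
    ∣hat-APsum∣² ξ near1 = begin
      h * h * ∣ hat u ξ ∣²         ≡⟨ *-comm (h * h) _ ⟩
      ∣ hat u ξ ∣² * (h * h)       ≤⟨ *-monoˡ ∣ hat u ξ ∣² (0≤∣∣² (hat u ξ)) (≤-trans (*-mono 0≤h h≤ 0≤h h≤) (≤-add _ (0≤sq (im M)) refl)) ⟩
      ∣ hat u ξ ∣² * ∣ M ∣²        ≡⟨ sym (trans (cong ∣_∣² (hat-APsum ξ)) (∣⊗∣² (hat u ξ) M)) ⟩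
      ∣ hat (APsum q L u) ξ ∣² ∎
      where
      open ≤-Reasoning
      h : ℚ
      h = ½ * ι L
      M : ℂ
      M = ∑ᶜ L (λ i → conj (χ ξ (i ℕ.* q)))
      0≤h : 0ℚ ≤ h
      0≤h = 0≤* (≤! {0ℚ} {½}) (0≤ι L)
      h≤ : h ≤ re M
      h≤ = ≤-trans (≤-reflexive (trans (*-comm ½ (ι L)) (sym (∑-const L ½)))) (∑-mono L near1)

  ∑ₗ : List ℕ → (ℕ → ℚ) → ℚ
  ∑ₗ []      g = 0ℚ
  ∑ₗ (ξ ∷ Λ) g = g ξ + ∑ₗ Λ g

  -- Expresses that Λ lists distinct frequencies below N, in the form in which it is applied.
  Frequencies : List ℕ → Set
  Frequencies Λ = ∀ g → (∀ ξ → 0ℚ ≤ g ξ) → ∑ₗ Λ g ≤ ∑ N g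

  ∑ₗ-mono : ∀ Λ {f g : ℕ → ℚ} → All (λ ξ → f ξ ≤ g ξ) Λ → ∑ₗ Λ f ≤ ∑ₗ Λ g
  ∑ₗ-mono []      []       = ≤-refl
  ∑ₗ-mono (ξ ∷ Λ) (p ∷ ps) = +-mono-≤ p (∑ₗ-mono Λ ps)

  *-∑ₗ : ∀ Λ c (g : ℕ → ℚ) → c * ∑ₗ Λ g ≡ ∑ₗ Λ (λ ξ → c * g ξ)
  *-∑ₗ []      c g = *-zeroʳ c
  *-∑ₗ (ξ ∷ Λ) c g = trans (*-distribˡ-+ c (g ξ) (∑ₗ Λ g)) (cong (c * g ξ +_) (*-∑ₗ Λ c g))

  ∑ₗ-const : ∀ Λ c → ∑ₗ Λ (λ _ → c) ≡ ι (length Λ) * c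
  ∑ₗ-const []      c = sym (*-zeroˡ c)
  ∑ₗ-const (ξ ∷ Λ) c = trans (cong (c +_) (∑ₗ-const Λ c)) (p c (ι (length Λ)))
    where
    p : ∀ c n → c + n * c ≡ (1ℚ + n) * c
    p = solve-∀ ℚ-ring

  -- Bessel's inequality for the sums of `u` along the progression: on Λ this smoothing multiplies
  -- the energy by at least L² / 4.
  spectrum-energy : ∀ q L m → (∀ i → i ℕ.< L → i ℕ.* q ℕ.≤ m) → ∀ u →
    (∀ x → x ℕ.< m → u x ≡ 0ℚ) → (∀ x → R ℕ.≤ x → u x ≡ 0ℚ) → ∀ Λ → Frequencies Λ →
    All (λ ξ → ∀ i → i ℕ.< L → ½ ≤ re (χ ξ (i ℕ.* q))) Λ →
    ι L * ι L * ∑ₗ Λ (λ ξ → ∣ hat u ξ ∣²) ≤ 8ℚ * ι N * ∑ R (λ s → APsum q L u s * APsum q L u s)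
  spectrum-energy q L m steps u lo hi Λ freq near = begin
    ι L * ι L * E                                     ≡⟨ p (ι L) E ⟩
    4ℚ * (½ * ι L * (½ * ι L) * E)                    ≡⟨ cong (4ℚ *_) (*-∑ₗ Λ (½ * ι L * (½ * ι L)) _) ⟩
    4ℚ * ∑ₗ Λ (λ ξ → ½ * ι L * (½ * ι L) * ∣ hat u ξ ∣²)
      ≤⟨ *-monoˡ 4ℚ (≤! {0ℚ} {4ℚ}) (≤-trans (∑ₗ-mono Λ (All.map (λ {ξ} → ∣hat-APsum∣² q L m steps u lo hi ξ) near))
           (≤-trans (freq (λ ξ → ∣ hat (APsum q L u) ξ ∣²) (λ ξ → 0≤∣∣² (hat (APsum q L u) ξ))) (bessel (APsum q L u)))) ⟩
    4ℚ * (2ℚ * ι N * V)                               ≡⟨ r (ι N) V ⟩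
    8ℚ * ι N * V ∎
    where
    open ≤-Reasoning
    E V : ℚ
    E = ∑ₗ Λ (λ ξ → ∣ hat u ξ ∣²)
    V = ∑ R (λ s → APsum q L u s * APsum q L u s)
    p : ∀ l e → l * l * e ≡ 4ℚ * (½ * l * (½ * l) * e)
    p = solve-∀ ℚ-ring
    r : ∀ n v → 4ℚ * (2ℚ * n * v) ≡ 8ℚ * n * v
    r = solve-∀ ℚ-ring

-- Simultaneous approximation

box : ∀ k c l x → l ≤ x → x ≤ l + c * ι (suc k) →
  ∃[ i ] (l + c * ι (toℕ {suc k} i) ≤ x × x ≤ l + c * ι (suc (toℕ i)))
box zero    c l x l≤x x≤ = fzero , subst (_≤ x) (p l c) l≤x , x≤
  where
  p : ∀ l c → l ≡ l + c * 0ℚ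
  p = solve-∀ ℚ-ring
box (suc k) c l x l≤x x≤ with x ≤? l + c * ι (suc k)
... | no ¬p = fromℕ (suc k) , subst (λ t → l + c * ι t ≤ x × x ≤ l + c * ι (suc t)) (sym (toℕ-fromℕ (suc k))) (<⇒≤ (≰⇒> ¬p) , x≤)
... | yes p with box k c l x l≤x p
... | i , r = inject₁ i , subst (λ t → l + c * ι t ≤ x × x ≤ l + c * ι (suc t)) (sym (toℕ-inject₁ i)) r

same-box : ∀ {c l x y} n → l + c * ι n ≤ x → x ≤ l + c * ι (suc n) → l + c * ι n ≤ y → y ≤ l + c * ι (suc n) →
  (x - y) * (x - y) ≤ c * c
same-box {c} {l} {x} {y} n p q r s = ≤-add ((c - (x - y)) * (c - (y - x))) (0≤* (d q r) (d s p)) (e c x y)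
  where
  e : ∀ c x y → (x - y) * (x - y) + (c - (x - y)) * (c - (y - x)) ≡ c * c
  e = solve-∀ ℚ-ring
  d : ∀ {x y} → x ≤ l + c * ι (suc n) → l + c * ι n ≤ y → 0ℚ ≤ c - (x - y)
  d {x} {y} q r = subst (0ℚ ≤_) (f l c (ι n) x y) (0≤+ (0≤- q) (0≤- r))
    where
    f : ∀ l c n x y → (l + c * (1ℚ + n) - x) + (y - (l + c * n)) ≡ c - (x - y)
    f = solve-∀ ℚ-ring

module _ (z : ℂ) (uz : Unit z) where

  abstract
    unit-box : ∀ k c → c * ι (suc k) ≡ 2ℚ → ∀ ξ x →
      (∃[ i ] (- 1ℚ + c * ι (toℕ {suc k} i) ≤ re (z ^ᶜ (ξ ℕ.* x)) × re (z ^ᶜ (ξ ℕ.* x)) ≤ - 1ℚ + c * ι (suc (toℕ i)))) ×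
      ∃[ i ] (- 1ℚ + c * ι (toℕ {suc k} i) ≤ im (z ^ᶜ (ξ ℕ.* x)) × im (z ^ᶜ (ξ ℕ.* x)) ≤ - 1ℚ + c * ι (suc (toℕ i)))
    unit-box k c e ξ x =
        box k c (- 1ℚ) (re w) (sq≤1⇒-1≤ {re w} (Unit⇒re-sq≤1 {w} uw)) (subst (re w ≤_) (cong (- 1ℚ +_) (sym e)) (sq≤1⇒≤1 {re w} (Unit⇒re-sq≤1 {w} uw)))
      , box k c (- 1ℚ) (im w) (sq≤1⇒-1≤ {im w} (Unit⇒im-sq≤1 {w} uw)) (subst (im w ≤_) (cong (- 1ℚ +_) (sym e)) (sq≤1⇒≤1 {im w} (Unit⇒im-sq≤1 {w} uw)))
      where
      w : ℂ
      w = z ^ᶜ (ξ ℕ.* x)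
      uw : Unit w
      uw = Unit-^ {z} (ξ ℕ.* x) uz

  module _ (k : ℕ) (c : ℚ) (cB≡2 : c * ι (suc k) ≡ 2ℚ) where

    boxes : ℕ → ℕ → Fin (suc k ℕ.* suc k)
    boxes ξ x = let (i , _) , (j , _) = unit-box k c cB≡2 ξ x in combine i j

    -- The cells of the real and imaginary parts at all frequencies of Λ, packed into one number for
    -- the pigeonhole principle.
    code : ∀ Λ → ℕ → Fin ((suc k ℕ.* suc k) ℕ.^ length Λ)
    code []      x = fzero
    code (ξ ∷ Λ) x = combine (boxes ξ x) (code Λ x)

    boxes-close : ∀ ξ x y → boxes ξ x ≡ boxes ξ y → ∣ z ^ᶜ (ξ ℕ.* x) ⊖ z ^ᶜ (ξ ℕ.* y) ∣² ≤ c * c + c * c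
    boxes-close ξ x y e with unit-box k c cB≡2 ξ x | unit-box k c cB≡2 ξ y
    ... | (i , p , q) , (j , r , s) | (i′ , p′ , q′) , (j′ , r′ , s′) with combine-injective i j i′ j′ e
    ... | refl , refl = +-mono-≤ (same-box {c} {(- 1ℚ)} (toℕ i) p q p′ q′) (same-box {c} {(- 1ℚ)} (toℕ j) r s r′ s′)

    code-close : ∀ Λ x y → code Λ x ≡ code Λ y → All (λ ξ → ∣ z ^ᶜ (ξ ℕ.* x) ⊖ z ^ᶜ (ξ ℕ.* y) ∣² ≤ c * c + c * c) Λ
    code-close []      x y e = []
    code-close (ξ ∷ Λ) x y e with combine-injective (boxes ξ x) (code Λ x) (boxes ξ y) (code Λ y) e
    ... | e₁ , e₂ = boxes-close ξ x y e₁ ∷ code-close Λ x y e₂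

  -- Each further factor w moves the power by |1 - w| ≤ √2 c, rounded up to the rational 2 c.
  power-near-1 : ∀ w c → 0ℚ ≤ c → Unit w → ∣ 1ᶜ ⊖ w ∣² ≤ c * c + c * c → ∀ i → 1ℚ - ι i * (2ℚ * c) ≤ re (w ^ᶜ i)
  power-near-1 w c 0≤c uw p zero = ≤-reflexive (e c)
    where
    e : ∀ c → 1ℚ - 0ℚ * (2ℚ * c) ≡ 1ℚ
    e = solve-∀ ℚ-ring
  power-near-1 w c 0≤c uw p (suc i) = ≤-add ((re P - (1ℚ - ι i * (2ℚ * c))) + (2ℚ * c - d))
      (0≤+ (0≤- (power-near-1 w c 0≤c uw p i)) (0≤- d≤)) (e (re P) (re (w ⊗ P)) (ι i) c)
    where
    P : ℂ
    P = w ^ᶜ i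
    d : ℚ
    d = re P - re (w ⊗ P)
    e : ∀ a b i c → 1ℚ - (1ℚ + i) * (2ℚ * c) + ((a - (1ℚ - i * (2ℚ * c))) + (2ℚ * c - (a - b))) ≡ b
    e = solve-∀ ℚ-ring
    d≤ : d ≤ 2ℚ * c
    d≤ = sq-cancel-≤ (0≤* (≤! {0ℚ} {2ℚ}) 0≤c) (begin
      d * d                                  ≤⟨ ≤-add _ (0≤sq (im P - im (w ⊗ P))) refl ⟩
      ∣ P ⊖ w ⊗ P ∣²                         ≡⟨ cong₂ (λ a b → ∣ a ⊹ b ∣²) (f (re w) (im w) (re P) (im P)) (g (re w) (im w) (re P) (im P)) ⟩
      ∣ (1ᶜ ⊖ w) ⊗ P ∣²                      ≡⟨ trans (∣⊗∣² (1ᶜ ⊖ w) P) (trans (cong (∣ 1ᶜ ⊖ w ∣² *_) (Unit-^ {w} i uw)) (*-identityʳ _)) ⟩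
      ∣ 1ᶜ ⊖ w ∣²                            ≤⟨ p ⟩
      c * c + c * c                          ≤⟨ ≤-add (c * c + c * c) (0≤+ (0≤sq c) (0≤sq c)) (h c) ⟩
      2ℚ * c * (2ℚ * c) ∎)
      where
      open ≤-Reasoning
      f : ∀ a b x y → x - (a * x - b * y) ≡ (1ℚ - a) * x - (0ℚ - b) * y
      f = solve-∀ ℚ-ring
      g : ∀ a b x y → y - (a * y + b * x) ≡ (1ℚ - a) * y + (0ℚ - b) * x
      g = solve-∀ ℚ-ring
      h : ∀ c → c * c + c * c + (c * c + c * c) ≡ 2ℚ * c * (2ℚ * c)
      h = solve-∀ ℚ-ring

  translate-close : ∀ ξ i j e → i ℕ.≤ j → ∣ z ^ᶜ (ξ ℕ.* i) ⊖ z ^ᶜ (ξ ℕ.* j) ∣² ≤ e → ∣ 1ᶜ ⊖ z ^ᶜ (ξ ℕ.* (j ℕ.∸ i)) ∣² ≤ e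
  translate-close ξ i j e i≤j = subst (_≤ e) eq
    where
    q : ℕ
    q = j ℕ.∸ i
    U W : ℂ
    U = z ^ᶜ (ξ ℕ.* i)
    W = z ^ᶜ (ξ ℕ.* q)
    split : z ^ᶜ (ξ ℕ.* j) ≡ U ⊗ W
    split = trans (cong (λ t → z ^ᶜ (ξ ℕ.* t)) (sym (ℕₚ.m+[n∸m]≡n i≤j)))
      (trans (cong (z ^ᶜ_) (ℕₚ.*-distribˡ-+ ξ i q)) (^ᶜ-+ z (ξ ℕ.* i) (ξ ℕ.* q)))
    f : ∀ a b x y → a - (a * x - b * y) ≡ a * (1ℚ - x) - b * (0ℚ - y)
    f = solve-∀ ℚ-ring
    g : ∀ a b x y → b - (a * y + b * x) ≡ a * (0ℚ - y) + b * (1ℚ - x)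
    g = solve-∀ ℚ-ring
    eq : ∣ U ⊖ z ^ᶜ (ξ ℕ.* j) ∣² ≡ ∣ 1ᶜ ⊖ W ∣²
    eq = trans (cong (λ t → ∣ U ⊖ t ∣²) split)
      (trans (cong₂ (λ a b → ∣ a ⊹ b ∣²) (f (re U) (im U) (re W) (im W)) (g (re U) (im U) (re W) (im W)))
      (trans (∣⊗∣² U (1ᶜ ⊖ W)) (trans (cong (_* ∣ 1ᶜ ⊖ W ∣²) (Unit-^ {z} (ξ ℕ.* i) uz)) (*-identityˡ _))))

  multiples-near-1 : ∀ ξ q L c → 0ℚ ≤ c → ι L * (4ℚ * c) ≤ 1ℚ → ∣ 1ᶜ ⊖ z ^ᶜ (ξ ℕ.* q) ∣² ≤ c * c + c * c →
    ∀ l → l ℕ.< L → ½ ≤ re (z ^ᶜ (ξ ℕ.* (l ℕ.* q)))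
  multiples-near-1 ξ q L c 0≤c Lc≤1 close l l<L = ≤-trans half≤ (subst (λ t → 1ℚ - ι l * (2ℚ * c) ≤ re t) (sym power)
      (power-near-1 (z ^ᶜ (ξ ℕ.* q)) c 0≤c (Unit-^ {z} (ξ ℕ.* q) uz) close l))
    where
    power : z ^ᶜ (ξ ℕ.* (l ℕ.* q)) ≡ (z ^ᶜ (ξ ℕ.* q)) ^ᶜ l
    power = trans (cong (z ^ᶜ_) (trans (sym (ℕₚ.*-assoc ξ l q)) (trans (cong (ℕ._* q) (ℕₚ.*-comm ξ l)) (ℕₚ.*-assoc l ξ q)))) (^ᶜ-* z (ξ ℕ.* q) l)
    f : ∀ L l c → ½ + (½ * (1ℚ - L * (4ℚ * c)) + 2ℚ * ((L - l) * c)) ≡ 1ℚ - l * (2ℚ * c)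
    f = solve-∀ ℚ-ring
    half≤ : ½ ≤ 1ℚ - ι l * (2ℚ * c)
    half≤ = ≤-add (½ * (1ℚ - ι L * (4ℚ * c)) + 2ℚ * ((ι L - ι l) * c))
      (0≤+ (0≤* (≤! {0ℚ} {½}) (0≤- Lc≤1)) (0≤* (≤! {0ℚ} {2ℚ}) (0≤* (0≤- (ι-mono (ℕₚ.<⇒≤ l<L))) 0≤c)))
      (f (ι L) (ι l) c)

  abstract
    -- Pigeonhole with 1 + k boxes per coordinate.
    dirichlet : ∀ L k → suc k ≡ 8 ℕ.* L → ∀ Λ →
      ∃[ q ] (1 ℕ.≤ q × q ℕ.≤ (suc k ℕ.* suc k) ℕ.^ length Λ ×
              All (λ ξ → ∀ i → i ℕ.< L → ½ ≤ re (z ^ᶜ (ξ ℕ.* (i ℕ.* q)))) Λ)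
    dirichlet L k B≡8L Λ =
      let r , 0<r , Br≡1 = inverse (ι (suc k)) (ι-mono-< {0} {suc k} (ℕ.s≤s ℕ.z≤n))
          -- Cells of width 2 / B on [-1 , 1]. With B = 8 L the total drift 2 L c along the
          -- progression is exactly ½.
          c = 2ℚ * r
          cB≡2 : c * ι (suc k) ≡ 2ℚ
          cB≡2 = trans (f r (ι (suc k))) (cong (2ℚ *_) Br≡1)
          0≤c : 0ℚ ≤ c
          0≤c = 0≤* (≤! {0ℚ} {2ℚ}) (<⇒≤ 0<r)
          8Lr≡1 : ι 8 * ι L * r ≡ 1ℚ
          8Lr≡1 = trans (cong (_* r) (trans (sym (ι-* 8 L)) (cong ι (sym B≡8L)))) Br≡1
          i , j , i<j , e = pigeonhole (ℕₚ.n<1+n ((suc k ℕ.* suc k) ℕ.^ length Λ)) (λ i → code k c cB≡2 Λ (toℕ i))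
      in toℕ j ℕ.∸ toℕ i , ℕₚ.m<n⇒0<n∸m i<j , ℕₚ.≤-trans (ℕₚ.m∸n≤m (toℕ j) (toℕ i)) (ℕₚ.≤-pred (toℕ<n j)) ,
         All.map (λ {ξ} close → multiples-near-1 ξ (toℕ j ℕ.∸ toℕ i) L c 0≤c (≤-reflexive (trans (g (ι L) r) 8Lr≡1))
                    (translate-close ξ (toℕ i) (toℕ j) (c * c + c * c) (ℕₚ.<⇒≤ i<j) close))
           (code-close k c cB≡2 Λ (toℕ i) (toℕ j) e)
      where
      f : ∀ r B → 2ℚ * r * B ≡ 2ℚ * (B * r)
      f = solve-∀ ℚ-ring
      g : ∀ L r → L * (4ℚ * (2ℚ * r)) ≡ ι 8 * L * r
      g = solve-∀ ℚ-ring

-- Passing to progressions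

⟦_⟧ : Bool → ℚ
⟦ true ⟧  = 1ℚ
⟦ false ⟧ = 0ℚ

0≤⟦⟧ : ∀ b → 0ℚ ≤ ⟦ b ⟧
0≤⟦⟧ true  = ≤! {0ℚ} {1ℚ}
0≤⟦⟧ false = ≤-refl

⟦⟧≤1 : ∀ b → ⟦ b ⟧ ≤ 1ℚ
⟦⟧≤1 true  = ≤-refl
⟦⟧≤1 false = ≤! {0ℚ} {1ℚ}

⟦⟧≡0 : ∀ b → ¬ T b → ⟦ b ⟧ ≡ 0ℚ
⟦⟧≡0 true  ¬t = ⊥-elim (¬t tt)
⟦⟧≡0 false _  = refl

-- With d = x′ - x the equation says y′ = y + d, written without subtraction. Only the difference of
-- two heights in column x enters, and the height w in column x′ is free.
SkewFree : (ℕ → ℕ → Bool) → Set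
SkewFree a = ∀ x x′ y y′ w → T (a x y) → T (a x y′) → T (a x′ w) → y ℕ.+ x′ ≡ y′ ℕ.+ x → x ≡ x′

count : ℕ → (ℕ → ℕ → Bool) → ℚ
count n a = ∑ n (λ x → ∑ n (λ y → ⟦ a x y ⟧))

density : ℕ → (ℕ → ℕ → Bool) → ℚ
density h a = count (2 ℕ.^ h) a * (½ ^ℚ h * ½ ^ℚ h)

2^*½^ : ∀ h → ι (2 ℕ.^ h) * ½ ^ℚ h ≡ 1ℚ
2^*½^ h = trans (cong (_* ½ ^ℚ h) (ι-^ 2 h)) (trans (sym (^ℚ-distrib (ι 2) ½ h)) (1^ℚ h))

count≡density : ∀ h a → count (2 ℕ.^ h) a ≡ density h a * (ι (2 ℕ.^ h) * ι (2 ℕ.^ h))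
count≡density h a = sym (trans (p (count (2 ℕ.^ h) a) (½ ^ℚ h) (ι (2 ℕ.^ h)))
  (trans (cong (λ t → count (2 ℕ.^ h) a * (t * t)) (2^*½^ h)) (q (count (2 ℕ.^ h) a))))
  where
  p : ∀ c d e → c * (d * d) * (e * e) ≡ c * (e * d * (e * d))
  p = solve-∀ ℚ-ring
  q : ∀ c → c * (1ℚ * 1ℚ) ≡ c
  q = solve-∀ ℚ-ring

0≤density : ∀ h a → 0ℚ ≤ density h a
0≤density h a = 0≤* (0≤∑ (2 ℕ.^ h) (λ x → 0≤∑ (2 ℕ.^ h) (λ y → 0≤⟦⟧ (a x y)))) (0≤* 0≤½^ 0≤½^)
  where
  0≤½^ : 0ℚ ≤ ½ ^ℚ h
  0≤½^ = 0≤^ h (≤! {0ℚ} {½})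

filterTo : {P : ℕ → Set} → (∀ ξ → Dec (P ξ)) → ℕ → List ℕ
filterTo P? zero = []
filterTo P? (suc M) with P? M
... | yes _ = M ∷ filterTo P? M
... | no _  = filterTo P? M

All-filterTo : ∀ {P : ℕ → Set} (P? : ∀ ξ → Dec (P ξ)) M → All P (filterTo P? M)
All-filterTo P? zero = []
All-filterTo P? (suc M) with P? M
... | yes p = p ∷ All-filterTo P? M
... | no _  = All-filterTo P? M

-- The set sits in the window [m , m + n)², so that progressions of total extent at most m can be
-- translated without leaving [0 , m + n). The mean column size is τ.
module Transfer (n m N : ℕ) (R+R≤N : (m ℕ.+ n) ℕ.+ (m ℕ.+ n) ℕ.≤ N) (1≤N : 1 ℕ.≤ N) (z : ℂ) (uz : Unit z)
  (ε : ℚ) (0≤ε : 0ℚ ≤ ε) (Nε≤1 : ι N * ε ≤ 1ℚ)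
  (orthogonal : ∀ d → 0 ℕ.< d → d ℕ.< N →
     ∑ N (λ ξ → re (z ^ᶜ (ξ ℕ.* d))) ≤ ε × - ε ≤ ∑ N (λ ξ → re (z ^ᶜ (ξ ℕ.* d))))
  (a : ℕ → ℕ → Bool) (skewFree : SkewFree a)
  (window : ∀ x y → T (a x y) → (m ℕ.≤ x × x ℕ.< m ℕ.+ n) × (m ℕ.≤ y × y ℕ.< m ℕ.+ n))
  (τ : ℚ) (0≤τ : 0ℚ ≤ τ)
  (total : ∑ (m ℕ.+ n) (λ x → ∑ (m ℕ.+ n) (λ y → ⟦ a x y ⟧)) ≡ τ * ι n) where

  R : ℕ
  R = m ℕ.+ n

  open Fourier R N R+R≤N 1≤N z uz ε 0≤ε Nε≤1 orthogonal public

  row : ℕ → ℕ → ℚ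
  row x y = ⟦ a x y ⟧

  0≤row : ∀ x y → 0ℚ ≤ row x y
  0≤row x y = 0≤⟦⟧ (a x y)

  f : ℕ → ℚ
  f x = ∑ R (row x)

  0≤f : ∀ x → 0ℚ ≤ f x
  0≤f x = 0≤∑ R (0≤row x)

  row-lo : ∀ x y → y ℕ.< m → row x y ≡ 0ℚ
  row-lo x y y<m = ⟦⟧≡0 (a x y) (λ t → ℕₚ.<⇒≱ y<m (proj₁ (proj₂ (window x y t))))

  row-hi : ∀ x y → R ℕ.≤ y → row x y ≡ 0ℚ
  row-hi x y R≤y = ⟦⟧≡0 (a x y) (λ t → ℕₚ.≤⇒≯ R≤y (proj₂ (proj₂ (window x y t))))

  row-out-lo : ∀ x y → x ℕ.< m → row x y ≡ 0ℚ
  row-out-lo x y x<m = ⟦⟧≡0 (a x y) (λ t → ℕₚ.<⇒≱ x<m (proj₁ (proj₁ (window x y t))))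

  row-out-hi : ∀ x y → R ℕ.≤ x → row x y ≡ 0ℚ
  row-out-hi x y R≤x = ⟦⟧≡0 (a x y) (λ t → ℕₚ.≤⇒≯ R≤x (proj₂ (proj₁ (window x y t))))

  f-lo : ∀ x → x ℕ.< m → f x ≡ 0ℚ
  f-lo x p = ∑-zero R (λ y _ → row-out-lo x y p)

  f-hi : ∀ x → R ℕ.≤ x → f x ≡ 0ℚ
  f-hi x p = ∑-zero R (λ y _ → row-out-hi x y p)

  I : ℕ → ℚ
  I x = 𝟙 (m ℕₚ.≤? x) * 𝟙 (x ℕₚ.<? R)

  I-lo : ∀ x → x ℕ.< m → I x ≡ 0ℚ
  I-lo x p = trans (cong (_* 𝟙 (x ℕₚ.<? R)) (𝟙-no (m ℕₚ.≤? x) (ℕₚ.<⇒≱ p))) (*-zeroˡ (𝟙 (x ℕₚ.<? R)))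

  I-hi : ∀ x → R ℕ.≤ x → I x ≡ 0ℚ
  I-hi x p = trans (cong (𝟙 (m ℕₚ.≤? x) *_) (𝟙-no (x ℕₚ.<? R) (ℕₚ.≤⇒≯ p))) (*-zeroʳ (𝟙 (m ℕₚ.≤? x)))

  I-in : ∀ x → m ℕ.≤ x → x ℕ.< R → I x ≡ 1ℚ
  I-in x p q = cong₂ _*_ (𝟙-yes (m ℕₚ.≤? x) p) (𝟙-yes (x ℕₚ.<? R) q)

  0≤I : ∀ x → 0ℚ ≤ I x
  0≤I x = 0≤* (0≤𝟙 (m ℕₚ.≤? x)) (0≤𝟙 (x ℕₚ.<? R))

  I≤1 : ∀ x → I x ≤ 1ℚ
  I≤1 x with m ℕₚ.≤? x | x ℕₚ.<? R
  ... | yes _ | yes _ = ≤-refl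
  ... | yes _ | no _  = ≤! {0ℚ} {1ℚ}
  ... | no _  | yes _ = ≤! {0ℚ} {1ℚ}
  ... | no _  | no _  = ≤! {0ℚ} {1ℚ}

  ∑I : ∑ R I ≡ ι n
  ∑I = trans (∑-split m n I) (trans (cong₂ _+_ (∑-zero m I-lo)
         (trans (∑-cong n (λ i i<n → I-in (m ℕ.+ i) (ℕₚ.m≤m+n m i) (ℕₚ.+-monoʳ-< m i<n))) (∑-const n 1ℚ)))
       (trans (+-identityˡ _) (*-identityʳ (ι n))))

  F : ℕ → ℚ
  F x = f x - τ * I x

  F-lo : ∀ x → x ℕ.< m → F x ≡ 0ℚ
  F-lo x p = trans (cong₂ (λ s t → s - τ * t) (f-lo x p) (I-lo x p)) (e τ)
    where
    e : ∀ t → 0ℚ - t * 0ℚ ≡ 0ℚ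
    e = solve-∀ ℚ-ring

  F-hi : ∀ x → R ℕ.≤ x → F x ≡ 0ℚ
  F-hi x p = trans (cong₂ (λ s t → s - τ * t) (f-hi x p) (I-hi x p)) (e τ)
    where
    e : ∀ t → 0ℚ - t * 0ℚ ≡ 0ℚ
    e = solve-∀ ℚ-ring

  module Progression (q b : ℕ) (1≤q : 1 ℕ.≤ q) (steps : ∀ i → i ℕ.< 2 ℕ.^ b → i ℕ.* q ℕ.≤ m) where

    L : ℕ
    L = 2 ℕ.^ b

    AP : (ℕ → ℚ) → ℕ → ℚ
    AP = APsum q L

    0<L : 0ℚ < ι L
    0<L = ι-mono-< {0} {L} (ℕₚ.m^n>0 2 b)

    ∑AP : ∀ u → (∀ x → x ℕ.< m → u x ≡ 0ℚ) → (∀ x → R ℕ.≤ x → u x ≡ 0ℚ) → ∑ R (AP u) ≡ ι L * ∑ R u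
    ∑AP u lo hi = trans (∑-swap R L _) (trans (∑-cong L (λ i i<L →
      ∑-shift R (i ℕ.* q) u (λ x x< → lo x (ℕₚ.<-≤-trans x< (steps i i<L))) hi)) (∑-const L _))

    abstract
      -- Each column takes its own densest translate of the progression, independently of the
      -- others.
      start : ℕ → ℕ
      start x = proj₁ (argmax R (AP (row x)))

      start-max : ∀ x s → s ℕ.≤ R → AP (row x) s ≤ AP (row x) (start x)
      start-max x = proj₂ (argmax R (AP (row x)))

    G : ℕ → ℚ
    G x = AP (row x) (start x)

    0≤G : ∀ x → 0ℚ ≤ G x
    0≤G x = 0≤∑ L (λ i → 0≤row x (i ℕ.* q ℕ.+ start x))

    G-lo : ∀ x → x ℕ.< m → G x ≡ 0ℚ
    G-lo x p = ∑-zero L (λ i _ → row-out-lo x _ p)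

    G-hi : ∀ x → R ℕ.≤ x → G x ≡ 0ℚ
    G-hi x p = ∑-zero L (λ i _ → row-out-hi x _ p)

    abstract
      origin : ℕ
      origin = proj₁ (argmax R (AP G))

      origin-max : ∀ s → s ℕ.≤ R → AP G s ≤ AP G origin
      origin-max = proj₂ (argmax R (AP G))

    -- The subset to which the induction hypothesis is applied. Its count is `AP G origin`, so both
    -- maximisations enter its density.
    a′ : ℕ → ℕ → Bool
    a′ i t = a (i ℕ.* q ℕ.+ origin) (t ℕ.* q ℕ.+ start (i ℕ.* q ℕ.+ origin))

    δ′ : ℚ
    δ′ = density b a′

    AP-G≤ : ∀ s → s ℕ.≤ R → AP G s ≤ δ′ * (ι L * ι L)
    AP-G≤ s s≤R = ≤-trans (origin-max s s≤R) (≤-reflexive (count≡density b a′))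

    -- The offset of a column is added to both y and y′ and cancels. The heights must use the same
    -- step q as the columns, so that the equation is merely scaled.
    skewFree′ : SkewFree a′
    skewFree′ i i′ t t′ w p p′ p″ e = ℕₚ.*-cancelʳ-≡ i i′ q {{ℕ.>-nonZero 1≤q}} (ℕₚ.+-cancelʳ-≡ origin (i ℕ.* q) (i′ ℕ.* q)
      (skewFree _ _ _ _ _ p p′ p″ (shift t i′ t′ i (start (i ℕ.* q ℕ.+ origin)) origin e)))
      where
      rearrange : ∀ t i s o → (t ℕ.* q ℕ.+ s) ℕ.+ (i ℕ.* q ℕ.+ o) ≡ (t ℕ.+ i) ℕ.* q ℕ.+ (s ℕ.+ o)
      rearrange t i s o = ℕ-solve t i s o q
        where
        ℕ-solve : ∀ t i s o q → (t ℕ.* q ℕ.+ s) ℕ.+ (i ℕ.* q ℕ.+ o) ≡ (t ℕ.+ i) ℕ.* q ℕ.+ (s ℕ.+ o)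
        ℕ-solve = ℕS.solve-∀
      shift : ∀ t i′ t′ i s o → t ℕ.+ i′ ≡ t′ ℕ.+ i → (t ℕ.* q ℕ.+ s) ℕ.+ (i′ ℕ.* q ℕ.+ o) ≡ (t′ ℕ.* q ℕ.+ s) ℕ.+ (i ℕ.* q ℕ.+ o)
      shift t i′ t′ i s o e = trans (rearrange t i′ s o) (trans (cong (λ k → k ℕ.* q ℕ.+ (s ℕ.+ o)) e) (sym (rearrange t′ i s o)))

    -- The mean of `AP G` over all starting points is at most its maximum, which is the count of
    -- `a′`.
    ∑G≤ : ∑ R G ≤ ι R * (δ′ * ι L)
    ∑G≤ = *-cancelˡ (ι L) 0<L (begin
      ι L * ∑ R G                    ≡⟨ sym (∑AP G G-lo G-hi) ⟩
      ∑ R (AP G)                     ≤⟨ ∑-≤const R (λ s s<R → AP-G≤ s (ℕₚ.<⇒≤ s<R)) ⟩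
      ι R * (δ′ * (ι L * ι L))       ≡⟨ e (ι R) δ′ (ι L) ⟩
      ι L * (ι R * (δ′ * ι L)) ∎)
      where
      open ≤-Reasoning
      e : ∀ r d l → r * (d * (l * l)) ≡ l * (r * (d * l))
      e = solve-∀ ℚ-ring

    Lf≤RG : ∀ x → ι L * f x ≤ ι R * G x
    Lf≤RG x = ≤-trans (≤-reflexive (sym (∑AP (row x) (row-lo x) (row-hi x)))) (∑-≤const R (λ s s<R → start-max x s (ℕₚ.<⇒≤ s<R)))

    -- A concentration of the column sizes alone is also visible in `a′`: by `Lf≤RG` a column loses
    -- no density on its best translate. So one subset covers both kinds of increment.
    AP-f≤ : ∀ s → s ℕ.≤ R → AP f s ≤ ι R * δ′ * ι L
    AP-f≤ s s≤R = *-cancelˡ (ι L) 0<L (begin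
      ι L * AP f s                                ≡⟨ *-∑ L (ι L) _ ⟩
      ∑ L (λ i → ι L * f (i ℕ.* q ℕ.+ s))         ≤⟨ ∑-mono L (λ i _ → Lf≤RG (i ℕ.* q ℕ.+ s)) ⟩
      ∑ L (λ i → ι R * G (i ℕ.* q ℕ.+ s))         ≡⟨ sym (*-∑ L (ι R) _) ⟩
      ι R * AP G s                                ≤⟨ *-monoˡ (ι R) (0≤ι R) (AP-G≤ s s≤R) ⟩
      ι R * (δ′ * (ι L * ι L))                    ≡⟨ e (ι R) δ′ (ι L) ⟩
      ι L * (ι R * δ′ * ι L) ∎)
      where
      open ≤-Reasoning
      e : ∀ r d l → r * (d * (l * l)) ≡ l * (r * d * l)
      e = solve-∀ ℚ-ring

    module _ (Λ : List ℕ) (freq : Frequencies Λ) (near : All (λ ξ → ∀ i → i ℕ.< L → ½ ≤ re (χ ξ (i ℕ.* q))) Λ) where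

      -- Σ v² ≤ max v · Σ v for the sums v of the column along translates of the progression, and
      -- the maximum is `G x`.
      row-spectrum : ∀ x → ι L * ∑ₗ Λ (λ ξ → ∣ hat (row x) ξ ∣²) ≤ 8ℚ * ι N * (G x * f x)
      row-spectrum x = *-cancelˡ (ι L) 0<L (begin
        ι L * (ι L * E)                         ≡⟨ sym (*-assoc (ι L) (ι L) E) ⟩
        ι L * ι L * E                           ≤⟨ spectrum-energy q L m steps (row x) (row-lo x) (row-hi x) Λ freq near ⟩
        8ℚ * ι N * ∑ R (λ s → v s * v s)        ≤⟨ *-monoˡ (8ℚ * ι N) (0≤* (≤! {0ℚ} {8ℚ}) (0≤ι N)) (∑-mono R (λ s s<R →
                                                     *-mono (0≤v s) (start-max x s (ℕₚ.<⇒≤ s<R)) (0≤v s) ≤-refl)) ⟩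
        8ℚ * ι N * ∑ R (λ s → G x * v s)        ≡⟨ cong (8ℚ * ι N *_) (trans (sym (*-∑ R (G x) v)) (cong (G x *_) (∑AP (row x) (row-lo x) (row-hi x)))) ⟩
        8ℚ * ι N * (G x * (ι L * f x))          ≡⟨ e (ι N) (G x) (ι L) (f x) ⟩
        ι L * (8ℚ * ι N * (G x * f x)) ∎)
        where
        open ≤-Reasoning
        E : ℚ
        E = ∑ₗ Λ (λ ξ → ∣ hat (row x) ξ ∣²)
        v : ℕ → ℚ
        v = AP (row x)
        0≤v : ∀ s → 0ℚ ≤ v s
        0≤v s = 0≤∑ L (λ i → 0≤row x (i ℕ.* q ℕ.+ s))
        e : ∀ n g l f → 8ℚ * n * (g * (l * f)) ≡ l * (8ℚ * n * (g * f))
        e = solve-∀ ℚ-ring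

      -- With V = `AP f` ≤ c and W = `AP I` ≤ L, the bounds V² ≤ c V, V W ≥ L V - c (L - W) and W² ≤
      -- L W make (V - τ W)² at most linear in V and W, whose sums are known exactly. The summand 2
      -- m is the loss near the ends of the window, where W < L.
      balanced-spectrum : ∑ₗ Λ (λ ξ → ∣ hat F ξ ∣²) ≤ 8ℚ * ι N * (τ * (ι R * δ′ * (ι n + 2ℚ * ι m) - τ * ι n))
      balanced-spectrum = *-cancelˡ (ι L * ι L) (0<* 0<L 0<L) (begin
        ι L * ι L * ∑ₗ Λ (λ ξ → ∣ hat F ξ ∣²)              ≤⟨ spectrum-energy q L m steps F F-lo F-hi Λ freq near ⟩
        8ℚ * ι N * ∑ R (λ s → AP F s * AP F s)             ≤⟨ *-monoˡ (8ℚ * ι N) (0≤* (≤! {0ℚ} {8ℚ}) (0≤ι N)) energy ⟩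
        8ℚ * ι N * (c * (l * (τ * ι n)) - 2ℚ * τ * (l * (l * (τ * ι n)) - c * (ι R * l - l * ι n)) + τ * τ * (l * (l * ι n)))
          ≡⟨ cong (λ r → 8ℚ * ι N * (c * (l * (τ * ι n)) - 2ℚ * τ * (l * (l * (τ * ι n)) - c * (r * l - l * ι n)) + τ * τ * (l * (l * ι n)))) (ι-+ m n) ⟩
        8ℚ * ι N * (c * (l * (τ * ι n)) - 2ℚ * τ * (l * (l * (τ * ι n)) - c * ((ι m + ι n) * l - l * ι n)) + τ * τ * (l * (l * ι n)))
          ≡⟨ e (ι N) (ι R) δ′ l τ (ι n) (ι m) ⟩
        ι L * ι L * (8ℚ * ι N * (τ * (ι R * δ′ * (ι n + 2ℚ * ι m) - τ * ι n))) ∎)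
        where
        open ≤-Reasoning
        l c : ℚ
        l = ι L
        c = ι R * δ′ * l
        V W : ℕ → ℚ
        V = AP f
        W = AP I
        0≤V : ∀ s → 0ℚ ≤ V s
        0≤V s = 0≤∑ L (λ i → 0≤f (i ℕ.* q ℕ.+ s))
        0≤W : ∀ s → 0ℚ ≤ W s
        0≤W s = 0≤∑ L (λ i → 0≤I (i ℕ.* q ℕ.+ s))
        W≤l : ∀ s → W s ≤ l
        W≤l s = ≤-trans (∑-≤const L (λ i _ → I≤1 (i ℕ.* q ℕ.+ s))) (≤-reflexive (*-identityʳ l))
        AP-F : ∀ s → AP F s ≡ V s - τ * W s
        AP-F s = trans (∑-distrib-- L _ _) (cong (λ t → V s - t) (sym (*-∑ L τ _)))
        e : ∀ N R d l t n m → 8ℚ * N * (R * d * l * (l * (t * n)) - 2ℚ * t * (l * (l * (t * n)) - R * d * l * ((m + n) * l - l * n)) + t * t * (l * (l * n)))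
            ≡ l * l * (8ℚ * N * (t * (R * d * (n + 2ℚ * m) - t * n)))
        e = solve-∀ ℚ-ring
        pointwise : ∀ s → s ℕ.< R → AP F s * AP F s ≤ c * V s - 2ℚ * τ * (l * V s - c * (l - W s)) + τ * τ * (l * W s)
        pointwise s s<R = subst (λ t → t * t ≤ c * V s - 2ℚ * τ * (l * V s - c * (l - W s)) + τ * τ * (l * W s)) (sym (AP-F s))
          (≤-add ((c - V s) * V s + 2ℚ * τ * ((c - V s) * (l - W s)) + τ * τ * ((l - W s) * W s))
            (0≤+ (0≤+ (0≤* c-V (0≤V s)) (0≤* (0≤* (≤! {0ℚ} {2ℚ}) 0≤τ) (0≤* c-V l-W))) (0≤* (0≤* 0≤τ 0≤τ) (0≤* l-W (0≤W s))))
            (p (V s) (W s) c l τ))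
          where
          c-V : 0ℚ ≤ c - V s
          c-V = 0≤- (AP-f≤ s (ℕₚ.<⇒≤ s<R))
          l-W : 0ℚ ≤ l - W s
          l-W = 0≤- (W≤l s)
          p : ∀ V W c l t → (V - t * W) * (V - t * W) + ((c - V) * V + 2ℚ * t * ((c - V) * (l - W)) + t * t * ((l - W) * W))
              ≡ c * V - 2ℚ * t * (l * V - c * (l - W)) + t * t * (l * W)
          p = solve-∀ ℚ-ring
        ∑V : ∑ R V ≡ l * (τ * ι n)
        ∑V = trans (∑AP f f-lo f-hi) (cong (l *_) total)
        ∑W : ∑ R W ≡ l * ι n
        ∑W = trans (∑AP I I-lo I-hi) (cong (l *_) ∑I)
        sum-up : ∑ R (λ s → c * V s - 2ℚ * τ * (l * V s - c * (l - W s)) + τ * τ * (l * W s))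
          ≡ c * ∑ R V - 2ℚ * τ * (l * ∑ R V - c * (ι R * l - ∑ R W)) + τ * τ * (l * ∑ R W)
        sum-up = trans (∑-distrib-+ R _ _) (cong₂ _+_
          (trans (∑-distrib-- R _ _) (cong₂ _-_ (sym (*-∑ R c V)) (trans (sym (*-∑ R (2ℚ * τ) _)) (cong (2ℚ * τ *_)
            (trans (∑-distrib-- R _ _) (cong₂ _-_ (sym (*-∑ R l V)) (trans (sym (*-∑ R c _)) (cong (c *_)
              (trans (∑-distrib-- R _ _) (cong (_- ∑ R W) (∑-const R l)))))))))))
          (trans (sym (*-∑ R (τ * τ) _)) (cong (τ * τ *_) (sym (*-∑ R l W)))))
        energy : ∑ R (λ s → AP F s * AP F s) ≤ c * (l * (τ * ι n)) - 2ℚ * τ * (l * (l * (τ * ι n)) - c * (ι R * l - l * ι n)) + τ * τ * (l * (l * ι n))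
        energy = ≤-trans (∑-mono R pointwise) (≤-reflexive (trans sum-up
          (cong₂ (λ v w → c * v - 2ℚ * τ * (l * v - c * (ι R * l - w)) + τ * τ * (l * w)) ∑V ∑W)))

  -- What remains of a progression trivial for Λ once its subset has density at most ρ. The
  -- progression is forgotten, so different level sets may use different ones. `weight x` is the
  -- density of column x on its best translate.
  record Controlled (ρ : ℚ) (Λ : List ℕ) : Set where
    field
      F-energy     : ∑ₗ Λ (λ ξ → ∣ hat F ξ ∣²) ≤ 8ℚ * ι N * (τ * (ι R * ρ * (ι n + 2ℚ * ι m) - τ * ι n))
      weight       : ℕ → ℚ
      0≤weight     : ∀ x → 0ℚ ≤ weight x
      row-energy   : ∀ x → ∑ₗ Λ (λ ξ → ∣ hat (row x) ξ ∣²) ≤ 8ℚ * ι N * (weight x * f x)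
      total-weight : ∑ R weight ≤ ι R * ρ

  controlled : ∀ q b (1≤q : 1 ℕ.≤ q) (steps : ∀ i → i ℕ.< 2 ℕ.^ b → i ℕ.* q ℕ.≤ m) ρ → Progression.δ′ q b 1≤q steps ≤ ρ →
    ∀ Λ → Frequencies Λ → All (λ ξ → ∀ i → i ℕ.< 2 ℕ.^ b → ½ ≤ re (χ ξ (i ℕ.* q))) Λ → Controlled ρ Λ
  controlled q b 1≤q steps ρ δ′≤ρ Λ freq near = record
    { F-energy     = ≤-trans (balanced-spectrum Λ freq near)
        (*-monoˡ (8ℚ * ι N) 0≤8N (*-monoˡ τ 0≤τ (+-monoˡ-≤ (- (τ * ι n))
          (*-monoʳ-≤-nonNeg (ι n + 2ℚ * ι m) {{nonNegative (0≤+ (0≤ι n) (0≤* (≤! {0ℚ} {2ℚ}) (0≤ι m)))}} (*-monoˡ (ι R) (0≤ι R) δ′≤ρ)))))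
    ; weight       = λ x → G x * λL
    ; 0≤weight     = λ x → 0≤* (0≤G x) 0≤λL
    ; row-energy   = λ x → begin
        E x                                  ≡⟨ sym (*-identityˡ (E x)) ⟩
        1ℚ * E x                             ≡⟨ cong (_* E x) (sym (2^*½^ b)) ⟩
        ι L * λL * E x                       ≡⟨ e₁ (ι L) λL (E x) ⟩
        λL * (ι L * E x)                     ≤⟨ *-monoˡ λL 0≤λL (row-spectrum Λ freq near x) ⟩
        λL * (8ℚ * ι N * (G x * f x))        ≡⟨ e₂ λL (ι N) (G x) (f x) ⟩
        8ℚ * ι N * (G x * λL * f x) ∎
    ; total-weight = begin
        ∑ R (λ x → G x * λL)                 ≡⟨ sym (∑-* R G λL) ⟩
        ∑ R G * λL                           ≤⟨ *-monoʳ-≤-nonNeg λL {{nonNegative 0≤λL}} ∑G≤ ⟩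
        ι R * (δ′ * ι L) * λL                ≡⟨ e₃ (ι R) δ′ (ι L) λL ⟩
        ι R * δ′ * (ι L * λL)                ≡⟨ trans (cong (ι R * δ′ *_) (2^*½^ b)) (*-identityʳ _) ⟩
        ι R * δ′                             ≤⟨ *-monoˡ (ι R) (0≤ι R) δ′≤ρ ⟩
        ι R * ρ ∎
    }
    where
    open Progression q b 1≤q steps
    open ≤-Reasoning
    λL : ℚ
    λL = ½ ^ℚ b
    0≤λL : 0ℚ ≤ λL
    0≤λL = 0≤^ b (≤! {0ℚ} {½})
    0≤8N : 0ℚ ≤ 8ℚ * ι N
    0≤8N = 0≤* (≤! {0ℚ} {8ℚ}) (0≤ι N)
    E : ℕ → ℚ
    E x = ∑ₗ Λ (λ ξ → ∣ hat (row x) ξ ∣²)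
    e₁ : ∀ l i e → l * i * e ≡ i * (l * e)
    e₁ = solve-∀ ℚ-ring
    e₂ : ∀ i n g f → i * (8ℚ * n * (g * f)) ≡ 8ℚ * n * (g * i * f)
    e₂ = solve-∀ ℚ-ring
    e₃ : ∀ r d l i → r * (d * l) * i ≡ r * d * (l * i)
    e₃ = solve-∀ ℚ-ring

  -- Lower bound for the spectral sum of one column

  row≤I : ∀ x y → row x y ≤ I y
  row≤I x y with m ℕₚ.≤? y | y ℕₚ.<? R
  ... | yes _ | yes _ = ⟦⟧≤1 (a x y)
  ... | yes _ | no ¬p = ≤-reflexive (row-hi x y (ℕₚ.≮⇒≥ ¬p))
  ... | no ¬p | yes _ = ≤-reflexive (row-lo x y (ℕₚ.≰⇒> ¬p))
  ... | no ¬p | no _  = ≤-reflexive (row-lo x y (ℕₚ.≰⇒> ¬p))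

  f≤n : ∀ x → f x ≤ ι n
  f≤n x = ≤-trans (∑-mono R (λ y _ → row≤I x y)) (≤-reflexive ∑I)

  f≤nI : ∀ x → f x ≤ ι n * I x
  f≤nI x with m ℕₚ.≤? x | x ℕₚ.<? R
  ... | yes _ | yes _ = ≤-trans (f≤n x) (≤-reflexive (sym (*-identityʳ (ι n))))
  ... | yes _ | no ¬p = ≤-reflexive (trans (f-hi x (ℕₚ.≮⇒≥ ¬p)) (sym (*-zeroʳ (ι n))))
  ... | no ¬p | yes _ = ≤-reflexive (trans (f-lo x (ℕₚ.≰⇒> ¬p)) (sym (*-zeroʳ (ι n))))
  ... | no ¬p | no _  = ≤-reflexive (trans (f-lo x (ℕₚ.≰⇒> ¬p)) (sym (*-zeroʳ (ι n))))

  τ≤n : 0ℚ < ι n → τ ≤ ι n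
  τ≤n 0<n = *-cancelˡ (ι n) 0<n (begin
    ι n * τ               ≡⟨ trans (*-comm (ι n) τ) (sym total) ⟩
    ∑ R f                 ≤⟨ ∑-mono R (λ x _ → f≤nI x) ⟩
    ∑ R (λ x → ι n * I x) ≡⟨ trans (sym (*-∑ R (ι n) I)) (cong (ι n *_) ∑I) ⟩
    ι n * ι n ∎)
    where open ≤-Reasoning

  F≤n : ∀ t → F t ≤ ι n
  F≤n t = ≤-trans (≤-add (τ * I t) (0≤* 0≤τ (0≤I t)) (e (f t) (τ * I t))) (f≤n t)
    where
    e : ∀ a b → a - b + b ≡ a
    e = solve-∀ ℚ-ring

  -n≤F : 0ℚ < ι n → ∀ t → - ι n ≤ F t
  -n≤F 0<n t = ≤-add (f t + ((ι n - τ) + τ * (1ℚ - I t))) (0≤+ (0≤f t) (0≤+ (0≤- (τ≤n 0<n)) (0≤* 0≤τ (0≤- (I≤1 t))))) (e (f t) (ι n) τ (I t))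
    where
    e : ∀ f n t i → - n + (f + ((n - t) + t * (1ℚ - i))) ≡ f - t * i
    e = solve-∀ ℚ-ring

  solutions : ℕ → ℕ → ℚ
  solutions x t = ∑ R (λ y → ∑ R (λ y′ → row x y * row x y′ * 𝟙 (t ℕ.+ y ℕₚ.≟ x ℕ.+ y′)))

  solutions-diag : ∀ x → solutions x x ≤ f x
  solutions-diag x = ∑-mono R (λ y y<R → ≤-trans (∑-mono R (λ y′ _ → term y y′)) (≤-reflexive (∑-𝟙 R (row x) y<R)))
    where
    term : ∀ y y′ → row x y * row x y′ * 𝟙 (x ℕ.+ y ℕₚ.≟ x ℕ.+ y′) ≤ 𝟙 (y ℕₚ.≟ y′) * row x y′
    term y y′ with x ℕ.+ y ℕₚ.≟ x ℕ.+ y′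
    ... | no _  = ≤-trans (≤-reflexive (*-zeroʳ (row x y * row x y′))) (0≤* (0≤𝟙 (y ℕₚ.≟ y′)) (0≤row x y′))
    ... | yes e = begin
      row x y * row x y′ * 1ℚ       ≡⟨ *-identityʳ _ ⟩
      row x y * row x y′            ≤⟨ *-monoʳ-≤-nonNeg (row x y′) {{nonNegative (0≤row x y′)}} (⟦⟧≤1 (a x y)) ⟩
      1ℚ * row x y′                 ≡⟨ cong (_* row x y′) (sym (𝟙-yes (y ℕₚ.≟ y′) (ℕₚ.+-cancelˡ-≡ x y y′ e))) ⟩
      𝟙 (y ℕₚ.≟ y′) * row x y′ ∎
      where open ≤-Reasoning

  -- The use of skew corner-freeness: if column t ≠ x is nonempty and t - x is a difference of two
  -- heights in column x, these points form a skew corner.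
  solutions-off : ∀ x t → ¬ x ≡ t → f t * solutions x t ≡ 0ℚ
  solutions-off x t x≢t = trans (∑-* R (row t) (solutions x t)) (∑-zero R (λ w _ → term w))
    where
    term : ∀ w → row t w * solutions x t ≡ 0ℚ
    term w with a t w in atw
    ... | false = *-zeroˡ (solutions x t)
    ... | true  = trans (*-identityˡ _) (∑-zero R (λ y _ → ∑-zero R (λ y′ _ → inner y y′)))
      where
      inner : ∀ y y′ → row x y * row x y′ * 𝟙 (t ℕ.+ y ℕₚ.≟ x ℕ.+ y′) ≡ 0ℚ
      inner y y′ with a x y in axy | a x y′ in axy′ | t ℕ.+ y ℕₚ.≟ x ℕ.+ y′
      ... | false | false | yes _ = refl
      ... | false | false | no _  = refl
      ... | false | true  | yes _ = refl
      ... | false | true  | no _  = refl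
      ... | true  | false | yes _ = refl
      ... | true  | false | no _  = refl
      ... | true  | true  | no _  = refl
      ... | true  | true  | yes e = ⊥-elim (x≢t (skewFree x t y y′ w (holds axy) (holds axy′) (holds atw)
              (trans (ℕₚ.+-comm y t) (trans e (ℕₚ.+-comm x y′)))))
        where
        holds : ∀ {b} → b ≡ true → T b
        holds refl = tt

  -- Only t = x contributes, and there the equation forces y = y′.
  f-count : ∀ {x} → x ℕ.< R → ∑ R (λ t → f t * solutions x t) ≤ ι n * f x
  f-count {x} x<R = ≤-trans (∑-mono R (λ t _ → term t)) (≤-reflexive (∑-𝟙 R (λ _ → ι n * f x) x<R))
    where
    term : ∀ t → f t * solutions x t ≤ 𝟙 (x ℕₚ.≟ t) * (ι n * f x)
    term t with x ℕₚ.≟ t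
    ... | yes refl = ≤-trans (*-mono (0≤f x) (f≤n x) 0≤sol (solutions-diag x)) (≤-reflexive (sym (*-identityˡ _)))
      where
      0≤sol : 0ℚ ≤ solutions x x
      0≤sol = 0≤∑ R (λ y → 0≤∑ R (λ y′ → 0≤* (0≤* (0≤row x y) (0≤row x y′)) (0≤𝟙 (x ℕ.+ y ℕₚ.≟ x ℕ.+ y′))))
    ... | no x≢t = ≤-reflexive (trans (solutions-off x t x≢t) (sym (*-zeroˡ (ι n * f x))))

  -- Heights in the same half of the window differ by less than p = n / 2, and from every x in the
  -- window a move of that size is possible to the left or to the right. So each such pair, in one
  -- of its two orders, has its solution t inside the window.
  module Half (p : ℕ) (n≡p+p : n ≡ p ℕ.+ p) {x : ℕ} (m≤x : m ℕ.≤ x) (x<R : x ℕ.< R) where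

    Q : ℕ → ℕ → ℚ
    Q y y′ = ∑ R (λ t → I t * 𝟙 (t ℕ.+ y ℕₚ.≟ x ℕ.+ y′))

    0≤Q : ∀ y y′ → 0ℚ ≤ Q y y′
    0≤Q y y′ = 0≤∑ R (λ t → 0≤* (0≤I t) (0≤𝟙 (t ℕ.+ y ℕₚ.≟ x ℕ.+ y′)))

    1≤Q : ∀ y y′ t → m ℕ.≤ t → t ℕ.< R → t ℕ.+ y ≡ x ℕ.+ y′ → 1ℚ ≤ Q y y′
    1≤Q y y′ t m≤t t<R e = ≤-trans (≤-reflexive (sym (cong₂ _*_ (I-in t m≤t t<R) (𝟙-yes (t ℕ.+ y ℕₚ.≟ x ℕ.+ y′) e))))
      (term≤∑ R (λ t → 0≤* (0≤I t) (0≤𝟙 (t ℕ.+ y ℕₚ.≟ x ℕ.+ y′))) t<R)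

    R≡mid+p : R ≡ (m ℕ.+ p) ℕ.+ p
    R≡mid+p = trans (cong (m ℕ.+_) n≡p+p) (sym (ℕₚ.+-assoc m p p))

    move : ∀ d → d ℕ.< p → (∃[ t ] (m ℕ.≤ t × t ℕ.< R × t ≡ x ℕ.+ d)) ⊎ (∃[ t ] (m ℕ.≤ t × t ℕ.< R × t ℕ.+ d ≡ x))
    move d d<p with x ℕₚ.<? m ℕ.+ p
    ... | yes x<mid = inj₁ (x ℕ.+ d , ℕₚ.≤-trans m≤x (ℕₚ.m≤m+n x d) , subst (x ℕ.+ d ℕ.<_) (sym R≡mid+p) (ℕₚ.+-mono-< x<mid d<p) , refl)
    ... | no x≮mid  = inj₂ (x ℕ.∸ d , m≤x-d , ℕₚ.≤-<-trans (ℕₚ.m∸n≤m x d) x<R , ℕₚ.m∸n+n≡m d≤x)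
      where
      m+d≤x : m ℕ.+ d ℕ.≤ x
      m+d≤x = ℕₚ.≤-trans (ℕₚ.+-monoʳ-≤ m (ℕₚ.<⇒≤ d<p)) (ℕₚ.≮⇒≥ x≮mid)
      d≤x : d ℕ.≤ x
      d≤x = ℕₚ.≤-trans (ℕₚ.m≤n+m d m) m+d≤x
      m≤x-d : m ℕ.≤ x ℕ.∸ d
      m≤x-d = ℕₚ.m+n≤o⇒m≤o∸n m m+d≤x

    close-pair : ∀ y d → d ℕ.< p → 1ℚ ≤ Q y (y ℕ.+ d) + Q (y ℕ.+ d) y
    close-pair y d d<p with move d d<p
    ... | inj₁ (t , m≤t , t<R , e) = ≤-trans (1≤Q y (y ℕ.+ d) t m≤t t<R (trans (cong (ℕ._+ y) e) (trans (ℕₚ.+-assoc x d y) (cong (x ℕ.+_) (ℕₚ.+-comm d y)))))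
          (≤-add (Q (y ℕ.+ d) y) (0≤Q (y ℕ.+ d) y) refl)
    ... | inj₂ (t , m≤t , t<R , e) = ≤-trans (1≤Q (y ℕ.+ d) y t m≤t t<R (trans (cong (t ℕ.+_) (ℕₚ.+-comm y d)) (trans (sym (ℕₚ.+-assoc t d y)) (cong (ℕ._+ y) e))))
          (≤-add (Q y (y ℕ.+ d)) (0≤Q y (y ℕ.+ d)) (+-comm (Q (y ℕ.+ d) y) _))

    close-pair′ : ∀ c y y′ → c ℕ.≤ y → y ℕ.< c ℕ.+ p → c ℕ.≤ y′ → y′ ℕ.< c ℕ.+ p → 1ℚ ≤ Q y y′ + Q y′ y
    close-pair′ c y y′ c≤y y< c≤y′ y′< = case (ℕₚ.≤-total y y′)
      where
      instance
        p≢0 : ℕ.NonZero p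
        p≢0 = ℕ.>-nonZero (ℕₚ.+-cancelˡ-< c 0 p (subst (ℕ._< c ℕ.+ p) (sym (ℕₚ.+-identityʳ c)) (ℕₚ.≤-<-trans c≤y y<)))
      gap : ∀ {u v} → c ℕ.≤ u → v ℕ.< c ℕ.+ p → v ℕ.∸ u ℕ.< p
      gap {u} {v} c≤u v< = ℕₚ.≤-<-trans (ℕₚ.∸-monoʳ-≤ v c≤u) (ℕₚ.m<n+o⇒m∸n<o v c v<)
      case : y ℕ.≤ y′ ⊎ y′ ℕ.≤ y → 1ℚ ≤ Q y y′ + Q y′ y
      case (inj₁ y≤y′) = subst (λ s → 1ℚ ≤ Q y s + Q s y) (ℕₚ.m+[n∸m]≡n y≤y′) (close-pair y (y′ ℕ.∸ y) (gap c≤y y′<))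
      case (inj₂ y′≤y) = subst (λ s → 1ℚ ≤ Q s y′ + Q y′ s) (ℕₚ.m+[n∸m]≡n y′≤y)
        (≤-trans (close-pair y′ (y ℕ.∸ y′) (gap c≤y′ y<)) (≤-reflexive (+-comm (Q y′ (y′ ℕ.+ (y ℕ.∸ y′))) _)))

    lower upper : ℕ → ℚ
    lower y = row x y * 𝟙 (y ℕₚ.<? m ℕ.+ p)
    upper y = row x y * (1ℚ - 𝟙 (y ℕₚ.<? m ℕ.+ p))

    pair-bound : ∀ y y′ → lower y * lower y′ + upper y * upper y′ ≤ row x y * row x y′ * (Q y y′ + Q y′ y)
    pair-bound y y′ with a x y in axy | a x y′ in axy′
    ... | false | false = ≤-reflexive (e (𝟙 (y ℕₚ.<? m ℕ.+ p)) (𝟙 (y′ ℕₚ.<? m ℕ.+ p)) (Q y y′ + Q y′ y))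
      where
      e : ∀ c d q → 0ℚ * c * (0ℚ * d) + 0ℚ * (1ℚ - c) * (0ℚ * (1ℚ - d)) ≡ 0ℚ * 0ℚ * q
      e = solve-∀ ℚ-ring
    ... | false | true = ≤-reflexive (e (𝟙 (y ℕₚ.<? m ℕ.+ p)) (𝟙 (y′ ℕₚ.<? m ℕ.+ p)) (Q y y′ + Q y′ y))
      where
      e : ∀ c d q → 0ℚ * c * (1ℚ * d) + 0ℚ * (1ℚ - c) * (1ℚ * (1ℚ - d)) ≡ 0ℚ * 1ℚ * q
      e = solve-∀ ℚ-ring
    ... | true | false = ≤-reflexive (e (𝟙 (y ℕₚ.<? m ℕ.+ p)) (𝟙 (y′ ℕₚ.<? m ℕ.+ p)) (Q y y′ + Q y′ y))
      where
      e : ∀ c d q → 1ℚ * c * (0ℚ * d) + 1ℚ * (1ℚ - c) * (0ℚ * (1ℚ - d)) ≡ 1ℚ * 0ℚ * q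
      e = solve-∀ ℚ-ring
    ... | true | true = ≤-trans both (≤-reflexive (sym (trans (cong (_* (Q y y′ + Q y′ y)) (*-identityˡ 1ℚ)) (*-identityˡ _))))
      where
      holds : ∀ {b} → b ≡ true → T b
      holds refl = tt
      wy = proj₂ (window x y (holds axy))
      wy′ = proj₂ (window x y′ (holds axy′))
      0≤QQ : 0ℚ ≤ Q y y′ + Q y′ y
      0≤QQ = 0≤+ (0≤Q y y′) (0≤Q y′ y)
      both : 1ℚ * 𝟙 (y ℕₚ.<? m ℕ.+ p) * (1ℚ * 𝟙 (y′ ℕₚ.<? m ℕ.+ p)) + 1ℚ * (1ℚ - 𝟙 (y ℕₚ.<? m ℕ.+ p)) * (1ℚ * (1ℚ - 𝟙 (y′ ℕₚ.<? m ℕ.+ p))) ≤ Q y y′ + Q y′ y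
      both with y ℕₚ.<? m ℕ.+ p | y′ ℕₚ.<? m ℕ.+ p
      ... | yes y< | yes y′< = close-pair′ m y y′ (proj₁ wy) y< (proj₁ wy′) y′<
      ... | yes _  | no _    = 0≤QQ
      ... | no _   | yes _   = 0≤QQ
      ... | no y≮  | no y′≮  = close-pair′ (m ℕ.+ p) y y′ (ℕₚ.≮⇒≥ y≮) (subst (y ℕ.<_) R≡mid+p (proj₂ wy)) (ℕₚ.≮⇒≥ y′≮) (subst (y′ ℕ.<_) R≡mid+p (proj₂ wy′))

    -- Pairs within one half are at least half of all pairs, as P² + U² ≥ ½ (P + U)². Having only
    -- one of the two orders guaranteed costs another factor 2.
    I-count : f x * f x ≤ 4ℚ * ∑ R (λ t → I t * solutions x t)
    I-count = begin
      f x * f x                           ≡⟨ cong (λ t → t * t) split ⟩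
      (P + U) * (P + U)                   ≤⟨ ≤-add ((P - U) * (P - U)) (0≤sq (P - U)) (e₁ P U) ⟩
      2ℚ * (P * P + U * U)                ≡⟨ cong (2ℚ *_) (sym squares) ⟩
      2ℚ * ∑ R (λ y → ∑ R (λ y′ → lower y * lower y′ + upper y * upper y′))
        ≤⟨ *-monoˡ 2ℚ (≤! {0ℚ} {2ℚ}) (∑-mono R (λ y _ → ∑-mono R (λ y′ _ → pair-bound y y′))) ⟩
      2ℚ * ∑ R (λ y → ∑ R (λ y′ → row x y * row x y′ * (Q y y′ + Q y′ y)))  ≡⟨ cong (2ℚ *_) symmetrise ⟩
      2ℚ * (S + S)                        ≡⟨ trans (e₂ S) (cong (4ℚ *_) swap) ⟩
      4ℚ * ∑ R (λ t → I t * solutions x t) ∎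
      where
      open ≤-Reasoning
      P U S : ℚ
      P = ∑ R lower
      U = ∑ R upper
      S = ∑ R (λ y → ∑ R (λ y′ → row x y * row x y′ * Q y y′))
      e₀ : ∀ r c → r ≡ r * c + r * (1ℚ - c)
      e₀ = solve-∀ ℚ-ring
      e₁ : ∀ p u → (p + u) * (p + u) + (p - u) * (p - u) ≡ 2ℚ * (p * p + u * u)
      e₁ = solve-∀ ℚ-ring
      e₂ : ∀ s → 2ℚ * (s + s) ≡ 4ℚ * s
      e₂ = solve-∀ ℚ-ring
      split : f x ≡ P + U
      split = trans (∑-cong R (λ y _ → e₀ (row x y) (𝟙 (y ℕₚ.<? m ℕ.+ p)))) (∑-distrib-+ R lower upper)
      square : ∀ (g : ℕ → ℚ) → ∑ R (λ y → ∑ R (λ y′ → g y * g y′)) ≡ ∑ R g * ∑ R g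
      square g = trans (∑-cong R (λ y _ → sym (*-∑ R (g y) g))) (sym (∑-* R g (∑ R g)))
      squares : ∑ R (λ y → ∑ R (λ y′ → lower y * lower y′ + upper y * upper y′)) ≡ P * P + U * U
      squares = trans (∑-cong R (λ y _ → ∑-distrib-+ R _ _)) (trans (∑-distrib-+ R _ _) (cong₂ _+_ (square lower) (square upper)))
      symmetrise : ∑ R (λ y → ∑ R (λ y′ → row x y * row x y′ * (Q y y′ + Q y′ y))) ≡ S + S
      symmetrise = trans (∑-cong R (λ y _ → trans (∑-cong R (λ y′ _ → *-distribˡ-+ (row x y * row x y′) (Q y y′) (Q y′ y))) (∑-distrib-+ R _ _)))
        (trans (∑-distrib-+ R _ _) (cong (S +_) (trans (∑-swap R R _)
          (∑-cong R (λ y _ → ∑-cong R (λ y′ _ → cong (_* Q y y′) (*-comm (row x y′) (row x y))))))))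
      swap : S ≡ ∑ R (λ t → I t * solutions x t)
      swap = trans (∑-cong R (λ y _ → trans (∑-cong R (λ y′ _ → trans (*-∑ R (row x y * row x y′) _)
                 (∑-cong R (λ t _ → r (row x y * row x y′) (I t) (𝟙 (t ℕ.+ y ℕₚ.≟ x ℕ.+ y′)))))) (∑-swap R R _)))
             (trans (∑-swap R R _) (∑-cong R (λ t _ → trans (∑-cong R (λ y _ → sym (*-∑ R (I t) _))) (sym (*-∑ R (I t) _)))))
        where
        r : ∀ a b c → a * (b * c) ≡ b * (a * c)
        r = solve-∀ ℚ-ring

  -- The sum of F against the solutions is A - τ B with A ≤ n f x and B ≥ f x² / 4, hence very
  -- negative unless f x is small. The inexact characters cost a further n f x, whence 8 = 4 (1 +
  -- 1).
  row-lower : ∀ p → n ≡ p ℕ.+ p → 0ℚ < ι n → ∀ {x} → m ℕ.≤ x → x ℕ.< R →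
    ι N * (τ * (f x * f x) - 8ℚ * (ι n * f x)) ≤ 4ℚ * ∑ N (λ ξ → ∣ hat (row x) ξ ∣² * ∥ hat F ξ ∥₁)
  row-lower p n≡p+p 0<n {x} m≤x x<R = begin
    ι N * (τ * (f x * f x) - 8ℚ * (ι n * f x))
      ≤⟨ ≤-add (4ℚ * (ι N * (ι n * f x) - E) + ι N * (4ℚ * (ι n * f x - A) + τ * (4ℚ * B - f x * f x)))
           (0≤+ (0≤* (≤! {0ℚ} {4ℚ}) (0≤- error)) (0≤* (0≤ι N) (0≤+ (0≤* (≤! {0ℚ} {4ℚ}) (0≤- (f-count x<R))) (0≤* 0≤τ (0≤- (Half.I-count p n≡p+p m≤x x<R))))))
           (e (ι N) τ (f x) (ι n) A B E) ⟩
    4ℚ * - (ι N * (A - τ * B) + E)                    ≡⟨ cong (λ s → 4ℚ * - (ι N * s + E)) (sym S≡) ⟩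
    4ℚ * - (ι N * ∑ R (λ t → F t * solutions x t) + E)
      ≤⟨ *-monoˡ 4ℚ (≤! {0ℚ} {4ℚ}) (count-bound F (row x) (ι n) x<R F≤n (-n≤F 0<n) (0≤row x)) ⟩
    4ℚ * ∑ N (λ ξ → ∣ hat (row x) ξ ∣² * ∥ hat F ξ ∥₁) ∎
    where
    open ≤-Reasoning
    A B E : ℚ
    A = ∑ R (λ t → f t * solutions x t)
    B = ∑ R (λ t → I t * solutions x t)
    E = ι R * (ι n * (ε * (f x * f x)))
    S≡ : ∑ R (λ t → F t * solutions x t) ≡ A - τ * B
    S≡ = trans (∑-cong R (λ t _ → r (f t) τ (I t) (solutions x t))) (trans (∑-distrib-- R _ _) (cong (λ s → A - s) (sym (*-∑ R τ _))))
      where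
      r : ∀ f t i s → (f - t * i) * s ≡ f * s - t * (i * s)
      r = solve-∀ ℚ-ring
    e : ∀ N t f n A B E → N * (t * (f * f) - 8ℚ * (n * f)) + (4ℚ * (N * (n * f) - E) + N * (4ℚ * (n * f - A) + t * (4ℚ * B - f * f)))
        ≡ 4ℚ * - (N * (A - t * B) + E)
    e = solve-∀ ℚ-ring
    R≤N : ι R ≤ ι N
    R≤N = ι-mono (ℕₚ.≤-trans (ℕₚ.m≤m+n R R) R+R≤N)
    f≤N : f x ≤ ι N
    f≤N = ≤-trans (f≤n x) (≤-trans (ι-mono (ℕₚ.m≤n+m n m)) R≤N)
    error : E ≤ ι N * (ι n * f x)
    error = begin
      ι R * (ι n * (ε * (f x * f x)))      ≤⟨ *-mono (0≤ι R) R≤N (0≤* (0≤ι n) (0≤* 0≤ε (0≤* (0≤f x) (0≤f x)))) ≤-refl ⟩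
      ι N * (ι n * (ε * (f x * f x)))      ≡⟨ r (ι N) (ι n) ε (f x) ⟩
      ι N * ε * (ι n * f x * f x)          ≤⟨ *-mono (0≤* (0≤ι N) 0≤ε) Nε≤1 (0≤* (0≤* (0≤ι n) (0≤f x)) (0≤f x)) (*-monoˡ (ι n * f x) (0≤* (0≤ι n) (0≤f x)) f≤N) ⟩
      1ℚ * (ι n * f x * ι N)               ≡⟨ s (ι N) (ι n) (f x) ⟩
      ι N * (ι n * f x) ∎
      where
      r : ∀ N n e f → N * (n * (e * (f * f))) ≡ N * e * (n * f * f)
      r = solve-∀ ℚ-ring
      s : ∀ N n f → 1ℚ * (n * f * N) ≡ N * (n * f)
      s = solve-∀ ℚ-ring

  -- Level sets of the balanced spectrum

  w : ℕ → ℚ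
  w ξ = ∥ hat F ξ ∥₁

  exceeding : ℚ → List ℕ
  exceeding t = filterTo (λ ξ → t <? w ξ) N

  ∑ₗ-filterTo : ∀ {P : ℕ → Set} (P? : ∀ ξ → Dec (P ξ)) g M → ∑ₗ (filterTo P? M) g ≡ ∑ M (λ ξ → 𝟙 (P? ξ) * g ξ)
  ∑ₗ-filterTo P? g zero = refl
  ∑ₗ-filterTo P? g (suc M) with P? M
  ... | yes _ = trans (cong (g M +_) (∑ₗ-filterTo P? g M)) (trans (+-comm (g M) _) (cong (∑ M (λ ξ → 𝟙 (P? ξ) * g ξ) +_) (sym (*-identityˡ (g M)))))
  ... | no _  = trans (∑ₗ-filterTo P? g M) (trans (sym (+-identityʳ _)) (cong (∑ M (λ ξ → 𝟙 (P? ξ) * g ξ) +_) (sym (*-zeroˡ (g M)))))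

  Frequencies-take : ∀ k {P : ℕ → Set} (P? : ∀ ξ → Dec (P ξ)) → Frequencies (take k (filterTo P? N))
  Frequencies-take k P? g 0≤g = ≤-trans (drop-rest k (filterTo P? N)) (≤-trans (≤-reflexive (∑ₗ-filterTo P? g N)) (∑-mono N (λ ξ _ → term ξ)))
    where
    drop-rest : ∀ k Λ → ∑ₗ (take k Λ) g ≤ ∑ₗ Λ g
    drop-rest zero    []      = ≤-refl
    drop-rest zero    (ξ ∷ Λ) = 0≤+ (0≤g ξ) (drop-rest zero Λ)
    drop-rest (suc k) []      = ≤-refl
    drop-rest (suc k) (ξ ∷ Λ) = +-monoʳ-≤ (g ξ) (drop-rest k Λ)
    term : ∀ ξ → 𝟙 (P? ξ) * g ξ ≤ g ξ
    term ξ with P? ξ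
    ... | yes _ = ≤-reflexive (*-identityˡ (g ξ))
    ... | no _  = ≤-trans (≤-reflexive (*-zeroˡ (g ξ))) (0≤g ξ)

  energyBound : ℚ → ℚ
  energyBound ρ = 8ℚ * ι N * (τ * (ι R * ρ * (ι n + 2ℚ * ι m) - τ * ι n))

  -- Control is available for at most k frequencies, so it is applied to the first k of the level
  -- set. If there were more, these k alone would exceed the energy bound.
  few-exceed : ∀ t k ρ → 0ℚ ≤ t → Controlled ρ (take k (exceeding t)) → 2ℚ * energyBound ρ < ι k * (t * t) →
    take k (exceeding t) ≡ exceeding t
  few-exceed t k ρ 0≤t ctrl bound with length (exceeding t) ℕₚ.≤? k
  ... | yes short = take-all k (exceeding t) short
  ... | no ¬short = ⊥-elim (<-irrefl refl (<-≤-trans bound (begin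
    ι k * (t * t)                                 ≡⟨ cong (λ s → ι s * (t * t)) (sym len) ⟩
    ι (length Λ) * (t * t)                        ≡⟨ sym (∑ₗ-const Λ (t * t)) ⟩
    ∑ₗ Λ (λ _ → t * t)                            ≤⟨ ∑ₗ-mono Λ (All.map (λ {ξ} t<w → ≤-trans (*-mono 0≤t (<⇒≤ t<w) 0≤t (<⇒≤ t<w)) (∥∥₁²≤2∣∣² (hat F ξ))) (All-take k (All-filterTo (λ ξ → t <? w ξ) N))) ⟩
    ∑ₗ Λ (λ ξ → 2ℚ * ∣ hat F ξ ∣²)                ≡⟨ sym (*-∑ₗ Λ 2ℚ _) ⟩
    2ℚ * ∑ₗ Λ (λ ξ → ∣ hat F ξ ∣²)                ≤⟨ *-monoˡ 2ℚ (≤! {0ℚ} {2ℚ}) (Controlled.F-energy ctrl) ⟩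
    2ℚ * energyBound ρ ∎)))
    where
    open ≤-Reasoning
    Λ : List ℕ
    Λ = take k (exceeding t)
    len : length Λ ≡ k
    len = trans (length-take k (exceeding t)) (ℕₚ.m≤n⇒m⊓n≡m (ℕₚ.<⇒≤ (ℕₚ.≰⇒> ¬short)))

  module Levels (C : ℚ) (0≤C : 0ℚ ≤ C) (w≤C : ∀ ξ → ξ ℕ.< N → w ξ ≤ C) (J : ℕ) (g : ℕ → ℕ → ℚ) (0≤g : ∀ i x → 0ℚ ≤ g i x)
    (rows : ∀ i → i ℕ.< J → ∀ x → ∑ N (λ ξ → 𝟙 (C * ¼ ^ℚ suc i <? w ξ) * ∣ hat (row x) ξ ∣²) ≤ 8ℚ * ι N * (g i x * f x)) where

    -- Layer cake decomposition in ratio 4. When a layer is added, either w ξ lies above it and its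
    -- summand replaces the old remainder, or w ξ lies below it and the new remainder suffices.
    layers : ∀ ξ → ξ ℕ.< N → ∀ J → w ξ ≤ ∑ J (λ i → C * ¼ ^ℚ i * 𝟙 (C * ¼ ^ℚ suc i <? w ξ)) + C * ¼ ^ℚ J
    layers ξ ξ<N zero = ≤-trans (w≤C ξ ξ<N) (≤-reflexive (e C))
      where
      e : ∀ c → c ≡ 0ℚ + c * 1ℚ
      e = solve-∀ ℚ-ring
    layers ξ ξ<N (suc J) with C * ¼ ^ℚ suc J <? w ξ
    ... | yes _ = ≤-trans (layers ξ ξ<N J) (≤-add (C * ¼ ^ℚ suc J) 0≤last (e (∑ J _) (C * ¼ ^ℚ J) (C * ¼ ^ℚ suc J)))
      where
      0≤last : 0ℚ ≤ C * ¼ ^ℚ suc J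
      0≤last = 0≤* 0≤C (0≤^ (suc J) (≤! {0ℚ} {¼}))
      e : ∀ s a b → s + a + b ≡ s + a * 1ℚ + b
      e = solve-∀ ℚ-ring
    ... | no ¬p = ≤-trans (≮⇒≥ ¬p) (≤-add (∑ J (λ i → C * ¼ ^ℚ i * 𝟙 (C * ¼ ^ℚ suc i <? w ξ)) + C * ¼ ^ℚ J * 0ℚ)
          (0≤+ (0≤∑ J (λ i → 0≤* (0≤* 0≤C (0≤^ i (≤! {0ℚ} {¼}))) (0≤𝟙 (C * ¼ ^ℚ suc i <? w ξ)))) (≤-reflexive (sym (*-zeroʳ (C * ¼ ^ℚ J)))))
          (+-comm (C * ¼ ^ℚ suc J) _))

    row-upper : ∀ x → ∑ N (λ ξ → ∣ hat (row x) ξ ∣² * w ξ)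
      ≤ ∑ J (λ i → C * ¼ ^ℚ i * (8ℚ * ι N * (g i x * f x))) + C * ¼ ^ℚ J * (2ℚ * ι N * f x)
    row-upper x = begin
      ∑ N (λ ξ → P ξ * w ξ)
        ≤⟨ ∑-mono N (λ ξ ξ<N → *-monoˡ (P ξ) (0≤∣∣² (hat (row x) ξ)) (layers ξ ξ<N J)) ⟩
      ∑ N (λ ξ → P ξ * (∑ J (λ i → C * ¼ ^ℚ i * 𝟙 (C * ¼ ^ℚ suc i <? w ξ)) + C * ¼ ^ℚ J))
        ≡⟨ trans (∑-cong N (λ ξ _ → expand ξ)) (∑-distrib-+ N _ _) ⟩
      ∑ N (λ ξ → ∑ J (λ i → C * ¼ ^ℚ i * (𝟙 (C * ¼ ^ℚ suc i <? w ξ) * P ξ))) + ∑ N (λ ξ → C * ¼ ^ℚ J * P ξ)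
        ≡⟨ cong₂ _+_ (trans (∑-swap N J _) (∑-cong J (λ i _ → sym (*-∑ N (C * ¼ ^ℚ i) _)))) (sym (*-∑ N (C * ¼ ^ℚ J) P)) ⟩
      ∑ J (λ i → C * ¼ ^ℚ i * ∑ N (λ ξ → 𝟙 (C * ¼ ^ℚ suc i <? w ξ) * P ξ)) + C * ¼ ^ℚ J * ∑ N P
        ≤⟨ +-mono-≤ (∑-mono J (λ i i<J → *-monoˡ (C * ¼ ^ℚ i) (0≤C¼ i) (rows i i<J x))) (*-monoˡ (C * ¼ ^ℚ J) (0≤C¼ J) total-energy) ⟩
      ∑ J (λ i → C * ¼ ^ℚ i * (8ℚ * ι N * (g i x * f x))) + C * ¼ ^ℚ J * (2ℚ * ι N * f x) ∎
      where
      open ≤-Reasoning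
      P : ℕ → ℚ
      P ξ = ∣ hat (row x) ξ ∣²
      0≤C¼ : ∀ i → 0ℚ ≤ C * ¼ ^ℚ i
      0≤C¼ i = 0≤* 0≤C (0≤^ i (≤! {0ℚ} {¼}))
      expand : ∀ ξ → P ξ * (∑ J (λ i → C * ¼ ^ℚ i * 𝟙 (C * ¼ ^ℚ suc i <? w ξ)) + C * ¼ ^ℚ J)
        ≡ ∑ J (λ i → C * ¼ ^ℚ i * (𝟙 (C * ¼ ^ℚ suc i <? w ξ) * P ξ)) + C * ¼ ^ℚ J * P ξ
      expand ξ = trans (*-distribˡ-+ (P ξ) _ _) (cong₂ _+_ (trans (*-∑ J (P ξ) _) (∑-cong J (λ i _ → r (P ξ) (C * ¼ ^ℚ i) (𝟙 (C * ¼ ^ℚ suc i <? w ξ))))) (*-comm (P ξ) _))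
        where
        r : ∀ a b c → a * (b * c) ≡ b * (c * a)
        r = solve-∀ ℚ-ring
      total-energy : ∑ N P ≤ 2ℚ * ι N * f x
      total-energy = ≤-trans (bessel (row x)) (*-monoˡ (2ℚ * ι N) (0≤* (≤! {0ℚ} {2ℚ}) (0≤ι N)) (∑-mono R (λ y _ →
        ≤-trans (*-monoˡ (row x y) (0≤row x y) (⟦⟧≤1 (a x y))) (≤-reflexive (*-identityʳ (row x y))))))

    -- `row-lower` and `row-upper` share the factor N f x. Dividing by it leaves an inequality
    -- linear in the weights, ready to be summed over x.
    row-inequality : ∀ p → n ≡ p ℕ.+ p → 0ℚ < ι n → 0ℚ < ι N → ∀ x → x ℕ.< R →
      τ * f x ≤ 8ℚ * ι n + (ι 32 * (C * ∑ J (λ i → ¼ ^ℚ i * g i x)) + 8ℚ * (C * ¼ ^ℚ J))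
    row-inequality p n≡p+p 0<n 0<N x x<R with 0ℚ <? f x
    ... | no f≮0 = ≤-trans (≤-reflexive (trans (cong (τ *_) (≤-antisym (≮⇒≥ f≮0) (0≤f x))) (*-zeroʳ τ)))
          (0≤+ (0≤* (≤! {0ℚ} {8ℚ}) (0≤ι n)) (0≤+ (0≤* (0≤ι 32) (0≤* 0≤C (0≤∑ J (λ i → 0≤* (0≤^ i (≤! {0ℚ} {¼})) (0≤g i x)))))
             (0≤* (≤! {0ℚ} {8ℚ}) (0≤* 0≤C (0≤^ J (≤! {0ℚ} {¼}))))))
    ... | yes 0<f = *-cancelˡ (ι N * f x) (0<* 0<N 0<f) (begin
      ι N * f x * (τ * f x)
        ≡⟨ e₁ (ι N) (f x) τ (ι n) ⟩
      ι N * (τ * (f x * f x) - 8ℚ * (ι n * f x)) + ι N * f x * (8ℚ * ι n)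
        ≤⟨ +-monoˡ-≤ (ι N * f x * (8ℚ * ι n)) (≤-trans (row-lower p n≡p+p 0<n m≤x x<R) (*-monoˡ 4ℚ (≤! {0ℚ} {4ℚ}) (row-upper x))) ⟩
      4ℚ * (∑ J (λ i → C * ¼ ^ℚ i * (8ℚ * ι N * (g i x * f x))) + C * ¼ ^ℚ J * (2ℚ * ι N * f x)) + ι N * f x * (8ℚ * ι n)
        ≡⟨ cong (λ s → 4ℚ * (s + C * ¼ ^ℚ J * (2ℚ * ι N * f x)) + ι N * f x * (8ℚ * ι n))
             (trans (∑-cong J (λ i _ → e₂ C (¼ ^ℚ i) (ι N) (g i x) (f x))) (sym (*-∑ J (8ℚ * ι N * f x * C) _))) ⟩
      4ℚ * (8ℚ * ι N * f x * C * ∑ J (λ i → ¼ ^ℚ i * g i x) + C * ¼ ^ℚ J * (2ℚ * ι N * f x)) + ι N * f x * (8ℚ * ι n)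
        ≡⟨ e₃ (ι N) (f x) C (∑ J (λ i → ¼ ^ℚ i * g i x)) (¼ ^ℚ J) (ι n) ⟩
      ι N * f x * (8ℚ * ι n + (ι 32 * (C * ∑ J (λ i → ¼ ^ℚ i * g i x)) + 8ℚ * (C * ¼ ^ℚ J))) ∎)
      where
      open ≤-Reasoning
      m≤x : m ℕ.≤ x
      m≤x = ℕₚ.≮⇒≥ (λ x<m → <-irrefl (sym (f-lo x x<m)) 0<f)
      e₁ : ∀ N f t n → N * f * (t * f) ≡ N * (t * (f * f) - 8ℚ * (n * f)) + N * f * (8ℚ * n)
      e₁ = solve-∀ ℚ-ring
      e₂ : ∀ C q N g f → C * q * (8ℚ * N * (g * f)) ≡ 8ℚ * N * f * C * (q * g)
      e₂ = solve-∀ ℚ-ring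
      e₃ : ∀ N f C s q n → 4ℚ * (8ℚ * N * f * C * s + C * q * (2ℚ * N * f)) + N * f * (8ℚ * n) ≡ N * f * (8ℚ * n + (ι 32 * (C * s) + 8ℚ * (C * q)))
      e₃ = solve-∀ ℚ-ring

  singleton-frequency : ∀ {ξ} → ξ ℕ.< N → Frequencies (ξ ∷ [])
  singleton-frequency ξ<N g 0≤g = ≤-trans (≤-reflexive (+-identityʳ _)) (term≤∑ N 0≤g ξ<N)

  -- Energies are measured against c₀ = τ n. `num₁` puts every single frequency below C = c₀ θ, and
  -- `num₂` limits level i to k i frequencies. `num₃`, `num₄` and `num₅` bound the contributions of
  -- the levels, of the remainder below them and of the diagonal.
  module Contradiction (p : ℕ) (n≡p+p : n ≡ p ℕ.+ p) (0<n : 0ℚ < ι n)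
    (δ : ℚ) (0<δ : 0ℚ < δ) (τ≡δn : τ ≡ δ * ι n) (N≡4n : ι N ≡ 4ℚ * ι n)
    (η : ℚ) (0≤η : 0ℚ ≤ η) (η≤1 : η ≤ 1ℚ) (m≡ηn : ι m ≡ η * ι n)
    (θ : ℚ) (0<θ : 0ℚ < θ) (J : ℕ) (ρ₀ : ℚ) (ρ : ℕ → ℚ) (0≤ρ : ∀ i → 0ℚ ≤ ρ i) (k : ℕ → ℕ)
    (ctrl₀ : ∀ Λ → Frequencies Λ → length Λ ℕ.≤ 1 → Controlled (ρ₀ * δ) Λ)
    (ctrl : ∀ i → i ℕ.< J → ∀ Λ → Frequencies Λ → length Λ ℕ.≤ k i → Controlled (ρ i * δ) Λ)
    (num₁ : ι 64 * ((1ℚ + η) * (1ℚ + 2ℚ * η) * ρ₀ - 1ℚ) ≤ θ * θ)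
    (num₂ : ∀ i → ι 64 * ((1ℚ + η) * (1ℚ + 2ℚ * η) * ρ i - 1ℚ) < ι (k i) * (θ * ¼ ^ℚ suc i * (θ * ¼ ^ℚ suc i)))
    (num₃ : ι 64 * θ * ∑ J (λ i → ¼ ^ℚ i * ρ i) ≤ ¼)
    (num₄ : ι 16 * θ * ¼ ^ℚ J ≤ ¼ * δ)
    (num₅ : ι 64 ≤ ι n * (δ * δ)) where

    c₀ C : ℚ
    c₀ = τ * ι n
    C  = c₀ * θ

    0<τ : 0ℚ < τ
    0<τ = subst (0ℚ <_) (sym τ≡δn) (0<* 0<δ 0<n)

    0<c₀ : 0ℚ < c₀
    0<c₀ = 0<* 0<τ 0<n

    0≤C : 0ℚ ≤ C
    0≤C = <⇒≤ (0<* 0<c₀ 0<θ)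

    0<N : 0ℚ < ι N
    0<N = subst (0ℚ <_) (sym N≡4n) (0<* (<! {0ℚ} {4ℚ}) 0<n)

    -- In units of c₀² only η and ρ survive; (1 + η) (1 + 2 η) is the price of the margin.
    energyBound-scaled : ∀ ρ → 2ℚ * energyBound (ρ * δ) ≡ c₀ * c₀ * (ι 64 * ((1ℚ + η) * (1ℚ + 2ℚ * η) * ρ - 1ℚ))
    energyBound-scaled ρ = trans (cong₂ (λ s t → 2ℚ * (8ℚ * s * (τ * (t * (ρ * δ) * (ι n + 2ℚ * ι m) - τ * ι n)))) N≡4n (ι-+ m n))
      (trans (cong₂ (λ s t → 2ℚ * (8ℚ * (4ℚ * ι n) * (s * ((t + ι n) * (ρ * δ) * (ι n + 2ℚ * t) - s * ι n)))) τ≡δn m≡ηn)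
      (trans (e (ι n) δ η ρ) (cong (λ s → s * ι n * (s * ι n) * (ι 64 * ((1ℚ + η) * (1ℚ + 2ℚ * η) * ρ - 1ℚ))) (sym τ≡δn))))
      where
      e : ∀ n d h r → 2ℚ * (8ℚ * (4ℚ * n) * (d * n * ((h * n + n) * (r * d) * (n + 2ℚ * (h * n)) - d * n * n)))
          ≡ d * n * n * (d * n * n) * (ι 64 * ((1ℚ + h) * (1ℚ + 2ℚ * h) * r - 1ℚ))
      e = solve-∀ ℚ-ring

    w≤C : ∀ ξ → ξ ℕ.< N → w ξ ≤ C
    w≤C ξ ξ<N = sq-cancel-≤ 0≤C (begin
      w ξ * w ξ                          ≤⟨ ∥∥₁²≤2∣∣² (hat F ξ) ⟩
      2ℚ * ∣ hat F ξ ∣²                  ≡⟨ cong (2ℚ *_) (sym (+-identityʳ ∣ hat F ξ ∣²)) ⟩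
      2ℚ * (∣ hat F ξ ∣² + 0ℚ)           ≤⟨ *-monoˡ 2ℚ (≤! {0ℚ} {2ℚ}) (Controlled.F-energy (ctrl₀ (ξ ∷ []) (singleton-frequency ξ<N) ℕₚ.≤-refl)) ⟩
      2ℚ * energyBound (ρ₀ * δ)          ≡⟨ energyBound-scaled ρ₀ ⟩
      c₀ * c₀ * (ι 64 * ((1ℚ + η) * (1ℚ + 2ℚ * η) * ρ₀ - 1ℚ))   ≤⟨ *-monoˡ (c₀ * c₀) (0≤sq c₀) num₁ ⟩
      c₀ * c₀ * (θ * θ)                  ≡⟨ e c₀ θ ⟩
      C * C ∎)
      where
      open ≤-Reasoning
      e : ∀ c t → c * c * (t * t) ≡ c * t * (c * t)
      e = solve-∀ ℚ-ring

    level : ℕ → ℚ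
    level i = C * ¼ ^ℚ suc i

    level-control : ∀ i → i ℕ.< J → Controlled (ρ i * δ) (take (k i) (exceeding (level i)))
    level-control i i<J = ctrl i i<J _ (Frequencies-take (k i) (λ ξ → level i <? w ξ))
      (subst (ℕ._≤ k i) (sym (length-take (k i) (exceeding (level i)))) (ℕₚ.m⊓n≤m (k i) _))

    level-complete : ∀ i → i ℕ.< J → take (k i) (exceeding (level i)) ≡ exceeding (level i)
    level-complete i i<J = few-exceed (level i) (k i) (ρ i * δ) (0≤* 0≤C (0≤^ (suc i) (≤! {0ℚ} {¼}))) (level-control i i<J)
      (subst₂ _<_ (sym (energyBound-scaled (ρ i))) (e c₀ (ι (k i)) θ (¼ ^ℚ suc i))
        (*-monoʳ-<-pos (c₀ * c₀) {{positive (0<* 0<c₀ 0<c₀)}} (num₂ i)))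
      where
      e : ∀ c k t q → c * c * (k * (t * q * (t * q))) ≡ k * (c * t * q * (c * t * q))
      e = solve-∀ ℚ-ring

    -- Control is known for levels below J only; the default 0 makes `g` total and never enters a
    -- sum.
    weights : ∀ i → Dec (i ℕ.< J) → ℕ → ℚ
    weights i (yes i<J) x = Controlled.weight (level-control i i<J) x
    weights i (no _)    x = 0ℚ

    g : ℕ → ℕ → ℚ
    g i = weights i (i ℕₚ.<? J)

    0≤g : ∀ i x → 0ℚ ≤ g i x
    0≤g i x with i ℕₚ.<? J
    ... | yes i<J = Controlled.0≤weight (level-control i i<J) x
    ... | no _    = ≤-refl

    g-rows : ∀ i → i ℕ.< J → ∀ x → ∑ N (λ ξ → 𝟙 (C * ¼ ^ℚ suc i <? w ξ) * ∣ hat (row x) ξ ∣²) ≤ 8ℚ * ι N * (g i x * f x)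
    g-rows i i<J x with i ℕₚ.<? J
    ... | no ¬p = ⊥-elim (¬p i<J)
    ... | yes q = ≤-trans (≤-reflexive (trans (sym (∑ₗ-filterTo (λ ξ → level i <? w ξ) (λ ξ → ∣ hat (row x) ξ ∣²) N))
                    (cong (λ Λ → ∑ₗ Λ (λ ξ → ∣ hat (row x) ξ ∣²)) (sym (level-complete i q)))))
                  (Controlled.row-energy (level-control i q) x)

    g-total : ∀ i → i ℕ.< J → ∑ R (g i) ≤ ι R * (ρ i * δ)
    g-total i i<J with i ℕₚ.<? J
    ... | no ¬p = ⊥-elim (¬p i<J)
    ... | yes q = Controlled.total-weight (level-control i q)

    open Levels C 0≤C w≤C J g 0≤g g-rows

    summed : τ * (τ * ι n) ≤ ι R * (8ℚ * ι n) + (ι 32 * (C * (ι R * δ * ∑ J (λ i → ¼ ^ℚ i * ρ i))) + ι R * (8ℚ * (C * ¼ ^ℚ J)))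
    summed = begin
      τ * (τ * ι n)                       ≡⟨ trans (cong (τ *_) (sym total)) (*-∑ R τ f) ⟩
      ∑ R (λ x → τ * f x)                 ≤⟨ ∑-mono R (row-inequality p n≡p+p 0<n 0<N) ⟩
      ∑ R (λ x → 8ℚ * ι n + (ι 32 * (C * ∑ J (λ i → ¼ ^ℚ i * g i x)) + 8ℚ * (C * ¼ ^ℚ J)))
        ≡⟨ trans (∑-distrib-+ R _ _) (cong₂ _+_ (∑-const R _) (trans (∑-distrib-+ R _ _) (cong₂ _+_
             (trans (sym (*-∑ R (ι 32) _)) (cong (ι 32 *_) (trans (sym (*-∑ R C _)) (cong (C *_) (trans (∑-swap R J _) (∑-cong J (λ i _ → sym (*-∑ R (¼ ^ℚ i) (g i)))))))))
             (∑-const R _)))) ⟩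
      ι R * (8ℚ * ι n) + (ι 32 * (C * ∑ J (λ i → ¼ ^ℚ i * ∑ R (g i))) + ι R * (8ℚ * (C * ¼ ^ℚ J)))
        ≤⟨ +-monoʳ-≤ (ι R * (8ℚ * ι n)) (+-monoˡ-≤ (ι R * (8ℚ * (C * ¼ ^ℚ J))) (*-monoˡ (ι 32) (0≤ι 32) (*-monoˡ C 0≤C
             (∑-mono J (λ i i<J → *-monoˡ (¼ ^ℚ i) (0≤^ i (≤! {0ℚ} {¼})) (g-total i i<J)))))) ⟩
      ι R * (8ℚ * ι n) + (ι 32 * (C * ∑ J (λ i → ¼ ^ℚ i * (ι R * (ρ i * δ)))) + ι R * (8ℚ * (C * ¼ ^ℚ J)))
        ≡⟨ cong (λ s → ι R * (8ℚ * ι n) + (ι 32 * (C * s) + ι R * (8ℚ * (C * ¼ ^ℚ J))))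
             (trans (∑-cong J (λ i _ → r (¼ ^ℚ i) (ι R) (ρ i) δ)) (sym (*-∑ J (ι R * δ) _))) ⟩
      ι R * (8ℚ * ι n) + (ι 32 * (C * (ι R * δ * ∑ J (λ i → ¼ ^ℚ i * ρ i))) + ι R * (8ℚ * (C * ¼ ^ℚ J))) ∎
      where
      open ≤-Reasoning
      r : ∀ q R p d → q * (R * (p * d)) ≡ R * d * (q * p)
      r = solve-∀ ℚ-ring

    -- Each of the three terms of the last upper bound is at most a quarter of δ² n³.
    absurd : ⊥
    absurd = <-irrefl refl (<-≤-trans (0<* (<! {0ℚ} {¼}) 0<Y) (≤-add (Y′ - Y) (0≤- Y≤Y′) (e₄ Y)))
      where
      open ≤-Reasoning
      S q n′ D X Y Y′ : ℚ
      S  = ∑ J (λ i → ¼ ^ℚ i * ρ i)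
      q  = ¼ ^ℚ J
      n′ = ι n
      D  = δ * n′ * n′ * θ
      X  = 8ℚ * n′ + (ι 32 * (D * (δ * S)) + 8ℚ * (D * q))
      Y  = δ * δ * (n′ * n′ * n′)
      Y′ = ¼ * Y + ¼ * Y + ¼ * Y
      0<Y : 0ℚ < Y
      0<Y = 0<* (0<* 0<δ 0<δ) (0<* (0<* 0<n 0<n) 0<n)
      0≤n³ : 0ℚ ≤ n′ * n′ * n′
      0≤n³ = <⇒≤ (0<* (0<* 0<n 0<n) 0<n)
      0≤D : 0ℚ ≤ D
      0≤D = <⇒≤ (0<* (0<* (0<* 0<δ 0<n) 0<n) 0<θ)
      0≤X : 0ℚ ≤ X
      0≤X = 0≤+ (0≤* (≤! {0ℚ} {8ℚ}) (0≤ι n)) (0≤+ (0≤* (0≤ι 32) (0≤* 0≤D (0≤* (<⇒≤ 0<δ) (0≤∑ J (λ i → 0≤* (0≤^ i (≤! {0ℚ} {¼})) (0≤ρ i))))))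
              (0≤* (≤! {0ℚ} {8ℚ}) (0≤* 0≤D (0≤^ J (≤! {0ℚ} {¼})))))
      e₁ : ∀ d n → d * d * (n * n * n) ≡ d * n * (d * n * n)
      e₁ = solve-∀ ℚ-ring
      e₂ : ∀ h n d t s q → (h * n + n) * (8ℚ * n) + (ι 32 * (d * n * n * t * ((h * n + n) * d * s)) + (h * n + n) * (8ℚ * (d * n * n * t * q)))
           ≡ (1ℚ + h) * (n * (8ℚ * n + (ι 32 * (d * n * n * t * (d * s)) + 8ℚ * (d * n * n * t * q))))
      e₂ = solve-∀ ℚ-ring
      e₃ : ∀ n d t s q → 2ℚ * (n * (8ℚ * n + (ι 32 * (d * n * n * t * (d * s)) + 8ℚ * (d * n * n * t * q))))
           ≡ ¼ * (n * n * ι 64) + d * d * (n * n * n) * (ι 64 * t * s) + d * (n * n * n) * (ι 16 * t * q)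
      e₃ = solve-∀ ℚ-ring
      e₄ : ∀ y → ¼ * y + (¼ * y + ¼ * y + ¼ * y - y) ≡ 0ℚ
      e₄ = solve-∀ ℚ-ring
      e₅ : ∀ n d → ¼ * (n * n * (n * (d * d))) + d * d * (n * n * n) * ¼ + d * (n * n * n) * (¼ * d) ≡ ¼ * (d * d * (n * n * n)) + ¼ * (d * d * (n * n * n)) + ¼ * (d * d * (n * n * n))
      e₅ = solve-∀ ℚ-ring
      Y≤Y′ : Y ≤ Y′
      Y≤Y′ = begin
        Y                                    ≡⟨ e₁ δ n′ ⟩
        δ * n′ * (δ * n′ * n′)               ≤⟨ subst₂ (λ t r → t * (t * n′) ≤ r * (8ℚ * n′) + (ι 32 * (t * n′ * θ * (r * δ * S)) + r * (8ℚ * (t * n′ * θ * q))))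
                                                  τ≡δn (trans (ι-+ m n) (cong (_+ n′) m≡ηn)) summed ⟩
        (η * n′ + n′) * (8ℚ * n′) + (ι 32 * (D * ((η * n′ + n′) * δ * S)) + (η * n′ + n′) * (8ℚ * (D * q)))
                                             ≡⟨ e₂ η n′ δ θ S q ⟩
        (1ℚ + η) * (n′ * X)                  ≤⟨ *-monoʳ-≤-nonNeg (n′ * X) {{nonNegative (0≤* (0≤ι n) 0≤X)}} (+-monoʳ-≤ 1ℚ η≤1) ⟩
        2ℚ * (n′ * X)                        ≡⟨ e₃ n′ δ θ S q ⟩
        ¼ * (n′ * n′ * ι 64) + Y * (ι 64 * θ * S) + δ * (n′ * n′ * n′) * (ι 16 * θ * q)
          ≤⟨ +-mono-≤ (+-mono-≤ (*-monoˡ ¼ (≤! {0ℚ} {¼}) (*-monoˡ (n′ * n′) (0≤sq n′) num₅)) (*-monoˡ Y (<⇒≤ 0<Y) num₃)) (*-monoˡ (δ * (n′ * n′ * n′)) (0≤* (<⇒≤ 0<δ) 0≤n³) num₄) ⟩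
        ¼ * (n′ * n′ * (n′ * (δ * δ))) + Y * ¼ + δ * (n′ * n′ * n′) * (¼ * δ)
                                             ≡⟨ e₅ n′ δ ⟩
        Y′ ∎

-- Iteration

module _ (m n : ℕ) where

  inWindow : ℕ → Bool
  inWindow x = (m ℕ.≤ᵇ x) ∧ (x ℕ.<ᵇ m ℕ.+ n)

  shifted : (ℕ → ℕ → Bool) → ℕ → ℕ → Bool
  shifted a x y = inWindow x ∧ (inWindow y ∧ a (x ℕ.∸ m) (y ℕ.∸ m))

  inWindow⇒ : ∀ x → T (inWindow x) → m ℕ.≤ x × x ℕ.< m ℕ.+ n
  inWindow⇒ x t = let p , q = Equivalence.to T-∧ t in ℕₚ.≤ᵇ⇒≤ m x p , ℕₚ.<ᵇ⇒< x (m ℕ.+ n) q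

  inWindow-+ : ∀ i → i ℕ.< n → inWindow (m ℕ.+ i) ≡ true
  inWindow-+ i i<n = Equivalence.to T-≡ (Equivalence.from T-∧ (ℕₚ.≤⇒≤ᵇ (ℕₚ.m≤m+n m i) , ℕₚ.<⇒<ᵇ (ℕₚ.+-monoʳ-< m i<n)))

  shifted⇒ : ∀ a x y → T (shifted a x y) → T (inWindow x) × T (inWindow y) × T (a (x ℕ.∸ m) (y ℕ.∸ m))
  shifted⇒ a x y t = let p , q = Equivalence.to T-∧ t ; r , s = Equivalence.to T-∧ q in p , r , s

  shifted-window : ∀ a x y → T (shifted a x y) → (m ℕ.≤ x × x ℕ.< m ℕ.+ n) × (m ℕ.≤ y × y ℕ.< m ℕ.+ n)
  shifted-window a x y t = let p , q , _ = shifted⇒ a x y t in inWindow⇒ x p , inWindow⇒ y q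

  shifted-SkewFree : ∀ a → SkewFree a → SkewFree (shifted a)
  shifted-SkewFree a sf x x′ y y′ w t t′ t″ e =
    let px , py , p = shifted⇒ a x y t
        _ , py′ , p′ = shifted⇒ a x y′ t′
        px′ , _ , p″ = shifted⇒ a x′ w t″
        m≤x = proj₁ (inWindow⇒ x px)
        m≤x′ = proj₁ (inWindow⇒ x′ px′)
        m≤y = proj₁ (inWindow⇒ y py)
        m≤y′ = proj₁ (inWindow⇒ y′ py′)
    in ℕₚ.∸-cancelʳ-≡ m≤x m≤x′ (sf _ _ _ _ _ p p′ p″ (ℕₚ.+-cancelˡ-≡ (m ℕ.+ m) _ _
         (trans (restore y x′ m≤y m≤x′) (trans e (sym (restore y′ x m≤y′ m≤x))))))
    where
    restore : ∀ y x → m ℕ.≤ y → m ℕ.≤ x → (m ℕ.+ m) ℕ.+ ((y ℕ.∸ m) ℕ.+ (x ℕ.∸ m)) ≡ y ℕ.+ x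
    restore y x m≤y m≤x = trans (r m (y ℕ.∸ m) (x ℕ.∸ m)) (cong₂ ℕ._+_ (ℕₚ.m+[n∸m]≡n m≤y) (ℕₚ.m+[n∸m]≡n m≤x))
      where
      r : ∀ m a b → (m ℕ.+ m) ℕ.+ (a ℕ.+ b) ≡ (m ℕ.+ a) ℕ.+ (m ℕ.+ b)
      r = ℕS.solve-∀

  shifted-+ : ∀ a i j → i ℕ.< n → j ℕ.< n → shifted a (m ℕ.+ i) (m ℕ.+ j) ≡ a i j
  shifted-+ a i j i<n j<n = trans (cong₂ (λ b c → b ∧ (c ∧ a (m ℕ.+ i ℕ.∸ m) (m ℕ.+ j ℕ.∸ m))) (inWindow-+ i i<n) (inWindow-+ j j<n))
    (cong₂ a (ℕₚ.m+n∸m≡n m i) (ℕₚ.m+n∸m≡n m j))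

  shifted-count : ∀ a → ∑ (m ℕ.+ n) (λ x → ∑ (m ℕ.+ n) (λ y → ⟦ shifted a x y ⟧)) ≡ count n a
  shifted-count a = trans (restrict (λ x → ∑ (m ℕ.+ n) (λ y → ⟦ shifted a x y ⟧))
      (λ x x<m → ∑-zero (m ℕ.+ n) (λ y _ → ⟦⟧≡0 (shifted a x y) (λ t → ℕₚ.<⇒≱ x<m (proj₁ (proj₁ (shifted-window a x y t)))))))
    (∑-cong n (λ i i<n → trans (restrict (λ y → ⟦ shifted a (m ℕ.+ i) y ⟧)
      (λ y y<m → ⟦⟧≡0 (shifted a (m ℕ.+ i) y) (λ t → ℕₚ.<⇒≱ y<m (proj₁ (proj₂ (shifted-window a (m ℕ.+ i) y t))))))
      (∑-cong n (λ j j<n → cong ⟦_⟧ (shifted-+ a i j i<n j<n)))))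
    where
    restrict : ∀ g → (∀ x → x ℕ.< m → g x ≡ 0ℚ) → ∑ (m ℕ.+ n) g ≡ ∑ n (λ i → g (m ℕ.+ i))
    restrict g lo = trans (∑-split m n g) (trans (cong (_+ ∑ n (λ i → g (m ℕ.+ i))) (∑-zero m lo)) (+-identityˡ _))

density≤1 : ∀ h a → density h a ≤ 1ℚ
density≤1 h a = begin
  count (2 ℕ.^ h) a * (l * l)      ≤⟨ *-monoʳ-≤-nonNeg (l * l) {{nonNegative (0≤* 0≤l 0≤l)}} (∑-≤const (2 ℕ.^ h) (λ x _ → ∑-≤const (2 ℕ.^ h) (λ y _ → ⟦⟧≤1 (a x y)))) ⟩
  n * (n * 1ℚ) * (l * l)           ≡⟨ e n l ⟩
  n * l * (n * l)                  ≡⟨ cong (λ t → t * t) (2^*½^ h) ⟩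
  1ℚ ∎
  where
  open ≤-Reasoning
  n l : ℚ
  n = ι (2 ℕ.^ h)
  l = ½ ^ℚ h
  0≤l : 0ℚ ≤ l
  0≤l = 0≤^ h (≤! {0ℚ} {½})
  e : ∀ n l → n * (n * 1ℚ) * (l * l) ≡ n * l * (n * l)
  e = solve-∀ ℚ-ring

n<2^n : ∀ n → n ℕ.< 2 ℕ.^ n
n<2^n zero    = ℕ.s≤s ℕ.z≤n
n<2^n (suc n) = ℕₚ.≤-trans (ℕₚ.+-mono-≤ (ℕₚ.m^n>0 2 n) (n<2^n n)) (ℕₚ.≤-reflexive (cong (2 ℕ.^ n ℕ.+_) (sym (ℕₚ.+-identityʳ (2 ℕ.^ n)))))

bracket : ∀ (t : ℕ → ℕ) h M → t 0 ℕ.≤ h → h ℕ.< t M → ∃[ J ] (t J ℕ.≤ h × h ℕ.< t (suc J))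
bracket t h zero    p q = ⊥-elim (ℕₚ.<⇒≱ q p)
bracket t h (suc M) p q with t M ℕₚ.≤? h
... | yes r = M , r , q
... | no ¬r = bracket t h M p (ℕₚ.≰⇒> ¬r)

-- The quotient is the logarithm of the length of the progression. Rounding down costs a factor 2,
-- which is why the gain has to beat 2 ^ suc r.
quotient-bounds : ∀ r h → 2 ℕ.^ r ℕ.≤ h → ∃[ b ] (1 ℕ.≤ b × 2 ℕ.^ r ℕ.* b ℕ.≤ h × h ℕ.≤ 2 ℕ.^ suc r ℕ.* b)
quotient-bounds r h p = b , 1≤b , ℕₚ.≤-trans (ℕₚ.≤-reflexive (ℕₚ.*-comm d b)) (m/n*n≤m h d {{nz}}) , upper
  where
  d : ℕ
  d = 2 ℕ.^ r
  nz : ℕ.NonZero d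
  nz = ℕₚ.m^n≢0 2 r
  b : ℕ
  b = ℕ._/_ h d {{nz}}
  1≤b : 1 ℕ.≤ b
  1≤b = m≥n⇒m/n>0 {h} {d} {{nz}} p
  upper : h ℕ.≤ 2 ℕ.^ suc r ℕ.* b
  upper = begin
    h                       ≡⟨ m≡m%n+[m/n]*n h d {{nz}} ⟩
    ℕ._%_ h d {{nz}} ℕ.+ b ℕ.* d   ≤⟨ ℕₚ.+-monoˡ-≤ (b ℕ.* d) (ℕₚ.<⇒≤ (m%n<n h d {{nz}})) ⟩
    d ℕ.+ b ℕ.* d           ≤⟨ ℕₚ.+-monoˡ-≤ (b ℕ.* d) (ℕₚ.m≤n*m d b {{ℕ.>-nonZero 1≤b}}) ⟩
    b ℕ.* d ℕ.+ b ℕ.* d     ≡⟨ e b d ⟩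
    2 ℕ.* d ℕ.* b ∎
    where
    open ℕₚ.≤-Reasoning
    e : ∀ b d → b ℕ.* d ℕ.+ b ℕ.* d ≡ 2 ℕ.* d ℕ.* b
    e = ℕS.solve-∀

-- A progression of length 2 ^ b for k frequencies fits into the margin 2 ^ h′ = 2 ^ (h ∸ s).
progression-cost : ∀ s k r b h′ → 1 ℕ.≤ b → 8 ℕ.* k ℕ.+ 1 ℕ.+ s ℕ.≤ 2 ℕ.^ r → 2 ℕ.^ r ℕ.* b ℕ.≤ s ℕ.+ h′ →
  b ℕ.+ (3 ℕ.+ b ℕ.+ (3 ℕ.+ b)) ℕ.* k ℕ.≤ h′
progression-cost s k r b h′ 1≤b p q = ℕₚ.+-cancelˡ-≤ s _ _ (begin
  s ℕ.+ (b ℕ.+ (3 ℕ.+ b ℕ.+ (3 ℕ.+ b)) ℕ.* k)                    ≤⟨ ℕₚ.+-mono-≤ (ℕₚ.m≤m*n s b {{nz}}) (ℕₚ.+-monoʳ-≤ b (ℕₚ.*-monoˡ-≤ k 6+2b≤8b)) ⟩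
  s ℕ.* b ℕ.+ (b ℕ.+ 8 ℕ.* b ℕ.* k)                              ≡⟨ e s b k ⟩
  (8 ℕ.* k ℕ.+ 1 ℕ.+ s) ℕ.* b                                    ≤⟨ ℕₚ.*-monoˡ-≤ b p ⟩
  2 ℕ.^ r ℕ.* b                                                  ≤⟨ q ⟩
  s ℕ.+ h′ ∎)
  where
  open ℕₚ.≤-Reasoning
  nz : ℕ.NonZero b
  nz = ℕ.>-nonZero 1≤b
  e : ∀ s b k → s ℕ.* b ℕ.+ (b ℕ.+ 8 ℕ.* b ℕ.* k) ≡ (8 ℕ.* k ℕ.+ 1 ℕ.+ s) ℕ.* b
  e = ℕS.solve-∀
  6+2b≤8b : 3 ℕ.+ b ℕ.+ (3 ℕ.+ b) ℕ.≤ 8 ℕ.* b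
  6+2b≤8b = ℕₚ.≤-trans (ℕₚ.+-mono-≤ (ℕₚ.+-monoˡ-≤ b (ℕₚ.m≤m*n 3 b {{nz}})) (ℕₚ.+-monoˡ-≤ b (ℕₚ.m≤m*n 3 b {{nz}}))) (ℕₚ.≤-reflexive (e′ b))
    where
    e′ : ∀ b → 3 ℕ.* b ℕ.+ b ℕ.+ (3 ℕ.* b ℕ.+ b) ≡ 8 ℕ.* b
    e′ = ℕS.solve-∀

progression-fits : ∀ b k h′ len q → len ℕ.≤ k → b ℕ.+ (3 ℕ.+ b ℕ.+ (3 ℕ.+ b)) ℕ.* k ℕ.≤ h′ →
  q ℕ.≤ (2 ℕ.^ (3 ℕ.+ b) ℕ.* 2 ℕ.^ (3 ℕ.+ b)) ℕ.^ len → ∀ i → i ℕ.< 2 ℕ.^ b → i ℕ.* q ℕ.≤ 2 ℕ.^ h′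
progression-fits b k h′ len q len≤k cost q≤ i i<L = begin
  i ℕ.* q                                  ≤⟨ ℕₚ.*-mono-≤ (ℕₚ.<⇒≤ i<L) q≤ ⟩
  2 ℕ.^ b ℕ.* (B ℕ.* B) ℕ.^ len            ≡⟨ cong (λ t → 2 ℕ.^ b ℕ.* t ℕ.^ len) (sym (ℕₚ.^-distribˡ-+-* 2 (3 ℕ.+ b) (3 ℕ.+ b))) ⟩
  2 ℕ.^ b ℕ.* (2 ℕ.^ c) ℕ.^ len            ≡⟨ cong (2 ℕ.^ b ℕ.*_) (ℕₚ.^-*-assoc 2 c len) ⟩
  2 ℕ.^ b ℕ.* 2 ℕ.^ (c ℕ.* len)            ≡⟨ sym (ℕₚ.^-distribˡ-+-* 2 b (c ℕ.* len)) ⟩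
  2 ℕ.^ (b ℕ.+ c ℕ.* len)                  ≤⟨ ℕₚ.^-monoʳ-≤ 2 (ℕₚ.≤-trans (ℕₚ.+-monoʳ-≤ b (ℕₚ.*-monoʳ-≤ c len≤k)) cost) ⟩
  2 ℕ.^ h′ ∎
  where
  open ℕₚ.≤-Reasoning
  B c : ℕ
  B = 2 ℕ.^ (3 ℕ.+ b)
  c = 3 ℕ.+ b ℕ.+ (3 ℕ.+ b)

-- Otherwise δ′ ^ q b ≥ ρ ^ q δ ^ q b ≥ δ ^ q D b ≥ δ ^ q h > K, contrary to the bound at the
-- smaller scale.
no-increment : ∀ q δ δ′ ρ K b h D → 0ℚ ≤ δ → 0ℚ ≤ ρ → 0ℚ ≤ b → δ′ ^ℚ q * b ≤ K → K < δ ^ℚ q * h →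
  h ≤ D * b → D ≤ ρ ^ℚ q → δ′ ≤ ρ * δ
no-increment q δ δ′ ρ K b h D 0≤δ 0≤ρ 0≤b small large h≤ D≤ with δ′ ≤? ρ * δ
... | yes p = p
... | no ¬p = ⊥-elim (<-irrefl refl (<-≤-trans large (begin
  δ ^ℚ q * h                      ≤⟨ *-monoˡ (δ ^ℚ q) (0≤^ q 0≤δ) (≤-trans h≤ (*-monoʳ-≤-nonNeg b {{nonNegative 0≤b}} D≤)) ⟩
  δ ^ℚ q * (ρ ^ℚ q * b)           ≡⟨ e (δ ^ℚ q) (ρ ^ℚ q) b ⟩
  ρ ^ℚ q * δ ^ℚ q * b             ≡⟨ cong (_* b) (sym (^ℚ-distrib ρ δ q)) ⟩
  (ρ * δ) ^ℚ q * b                ≤⟨ *-monoʳ-≤-nonNeg b {{nonNegative 0≤b}} (^ℚ-mono q (0≤* 0≤ρ 0≤δ) (<⇒≤ (≰⇒> ¬p))) ⟩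
  δ′ ^ℚ q * b                     ≤⟨ small ⟩
  K ∎)))
  where
  open ≤-Reasoning
  e : ∀ d r b → d * (r * b) ≡ r * d * b
  e = solve-∀ ℚ-ring

ι2^ : ∀ k → ι (2 ℕ.^ k) ≡ 2ℚ ^ℚ k
ι2^ k = ι-^ 2 k

2^ℚ*½^ℚ : ∀ k → 2ℚ ^ℚ k * ½ ^ℚ k ≡ 1ℚ
2^ℚ*½^ℚ k = trans (sym (^ℚ-distrib 2ℚ ½ k)) (1^ℚ k)

-- A least counterexample: the bound fails at scale h and holds at all smaller scales. The margin is
-- 2 ^ (h - s).
module Step (s q : ℕ) (K : ℚ) (h h′ : ℕ) (h≡s+h′ : h ≡ s ℕ.+ h′) (a : ℕ → ℕ → Bool) (sf : SkewFree a)
  (IH : ∀ b → b ℕ.< h → ∀ a → SkewFree a → density b a ^ℚ q * ι b ≤ K)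
  (large : K < density h a ^ℚ q * ι h) where

  δ ε : ℚ
  δ = density h a
  -- Exactly 1 / N.
  ε = ½ ^ℚ suc (suc h)

  0≤δ : 0ℚ ≤ δ
  0≤δ = 0≤density h a

  n m N : ℕ
  n = 2 ℕ.^ h
  m = 2 ℕ.^ h′
  N = 2 ℕ.^ suc (suc h)

  abstract
    basis : ∃[ z ] (Unit z × (∀ d → 0 ℕ.< d → d ℕ.< N →
      ∑ N (λ ξ → re (z ^ᶜ (ξ ℕ.* d))) ≤ ε × - ε ≤ ∑ N (λ ξ → re (z ^ᶜ (ξ ℕ.* d)))))
    basis = characters (suc h) ε (0<^ (suc (suc h)) (<! {0ℚ} {½}))

  m≤n : m ℕ.≤ n
  m≤n = ℕₚ.^-monoʳ-≤ 2 (subst (h′ ℕ.≤_) (sym h≡s+h′) (ℕₚ.m≤n+m h′ s))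

  R+R≤N : (m ℕ.+ n) ℕ.+ (m ℕ.+ n) ℕ.≤ N
  R+R≤N = ℕₚ.≤-trans (ℕₚ.+-mono-≤ (ℕₚ.+-monoˡ-≤ n m≤n) (ℕₚ.+-monoˡ-≤ n m≤n)) (ℕₚ.≤-reflexive (e n))
    where
    e : ∀ n → (n ℕ.+ n) ℕ.+ (n ℕ.+ n) ≡ 2 ℕ.* (2 ℕ.* n)
    e = ℕS.solve-∀

  τ : ℚ
  τ = δ * ι n

  total : ∑ (m ℕ.+ n) (λ x → ∑ (m ℕ.+ n) (λ y → ⟦ shifted m n a x y ⟧)) ≡ τ * ι n
  total = trans (shifted-count m n a) (trans (count≡density h a) (sym (*-assoc δ (ι n) (ι n))))

  open Transfer n m N R+R≤N (ℕₚ.m^n>0 2 (suc (suc h))) (proj₁ basis) (proj₁ (proj₂ basis))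
    ε (0≤^ (suc (suc h)) (≤! {0ℚ} {½})) (≤-reflexive (2^*½^ (suc (suc h)))) (proj₂ (proj₂ basis))
    (shifted m n a) (shifted-SkewFree m n a sf) (shifted-window m n a) τ (0≤* 0≤δ (0≤ι n)) total public
    using (Frequencies; Controlled; controlled; module Progression; module Contradiction)

  -- A progression of length 2 ^ b trivial for Λ comes from `dirichlet`. The `cost` condition makes
  -- it fit into the margin, and minimality of h keeps the density of its subset below ρ δ.
  control : ∀ k r ρ → 0ℚ ≤ ρ → 8 ℕ.* k ℕ.+ 1 ℕ.+ s ℕ.≤ 2 ℕ.^ r → 1 ℕ.≤ r → 2 ℕ.^ r ℕ.≤ h → 2ℚ ^ℚ suc r ≤ ρ ^ℚ q →
    ∀ Λ → Frequencies Λ → length Λ ℕ.≤ k → Controlled (ρ * δ) Λ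
  control k r ρ 0≤ρ cost 1≤r 2^r≤h gain Λ freq len≤k =
    let b , 1≤b , lower , upper = quotient-bounds r h 2^r≤h
        B-1 = ℕ.pred (8 ℕ.* 2 ℕ.^ b)
        B≡ : suc B-1 ≡ 8 ℕ.* 2 ℕ.^ b
        B≡ = ℕₚ.suc-pred (8 ℕ.* 2 ℕ.^ b) {{ℕ.>-nonZero (ℕₚ.*-mono-≤ (ℕ.s≤s (ℕ.z≤n {7})) (ℕₚ.m^n>0 2 b))}}
        B≡2^ : suc B-1 ≡ 2 ℕ.^ (3 ℕ.+ b)
        B≡2^ = trans B≡ (sym (ℕₚ.^-distribˡ-+-* 2 3 b))
        d , 1≤d , d≤ , near = dirichlet (proj₁ basis) (proj₁ (proj₂ basis)) (2 ℕ.^ b) B-1 B≡ Λ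
        steps = progression-fits b k h′ (length Λ) d len≤k
          (progression-cost s k r b h′ 1≤b cost (ℕₚ.≤-trans lower (ℕₚ.≤-reflexive h≡s+h′)))
          (subst (λ t → d ℕ.≤ (t ℕ.* t) ℕ.^ length Λ) B≡2^ d≤)
        b<h : b ℕ.< h
        b<h = ℕₚ.<-≤-trans (ℕₚ.m<m*n b (2 ℕ.^ r) {{ℕ.>-nonZero 1≤b}} (ℕₚ.^-monoʳ-≤ 2 1≤r)) (subst (ℕ._≤ h) (ℕₚ.*-comm (2 ℕ.^ r) b) lower)
    in controlled d b 1≤d steps (ρ * δ)
         (no-increment q δ (Progression.δ′ d b 1≤d steps) ρ K (ι b) (ι h) (2ℚ ^ℚ suc r) 0≤δ 0≤ρ (0≤ι b)
           (IH b b<h (Progression.a′ d b 1≤d steps) (Progression.skewFree′ d b 1≤d steps)) large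
           (subst (ι h ≤_) (trans (ι-* (2 ℕ.^ suc r) b) (cong (_* ι b) (ι2^ (suc r)))) (ι-mono upper)) gain)
         Λ freq near

module Iteration (s u q w : ℕ) (5+s≤u : 5 ℕ.+ s ℕ.≤ u) (u+5≤q : u ℕ.+ 5 ℕ.≤ q) (1≤w : 1 ℕ.≤ w)
  (θ ρ₀ : ℚ) (0<θ : 0ℚ < θ) (0≤ρ₀ : 0ℚ ≤ ρ₀)
  (gain₀ : 2ℚ ^ℚ (u ℕ.+ 5) ≤ ρ₀ ^ℚ q)
  (num₁ : ι 64 * ((1ℚ + ½ ^ℚ s) * (1ℚ + 2ℚ * ½ ^ℚ s) * ρ₀ - 1ℚ) ≤ θ * θ)
  (num₂ : (1ℚ + ½ ^ℚ s) * (1ℚ + 2ℚ * ½ ^ℚ s) ≤ 2ℚ)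
  (num₃ : ι 64 * (2ℚ * 2ℚ ^ℚ w) ≤ 2ℚ ^ℚ u * (θ * θ * (¼ * ¼)))
  (num₄ : ι 64 * θ * (2ℚ ^ℚ w * 2ℚ) ≤ ¼) where

  k : ℕ → ℕ
  k i = 2 ℕ.^ (u ℕ.+ 5 ℕ.* i)

  -- The summand 4 comes from 8 k + 1 + s ≤ 16 k.
  r : ℕ → ℕ
  r i = u ℕ.+ 4 ℕ.+ 5 ℕ.* i

  ρ : ℕ → ℚ
  ρ i = 2ℚ ^ℚ (w ℕ.+ i)

  -- Equal to 2 ^ r 1, as already the case J = 0 of `density-lower` demands.
  K : ℚ
  K = 2ℚ ^ℚ (u ℕ.+ 9)

  0≤ρ : ∀ i → 0ℚ ≤ ρ i
  0≤ρ i = 0≤^ (w ℕ.+ i) (≤! {0ℚ} {2ℚ})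

  s<u : s ℕ.< u
  s<u = ℕₚ.≤-trans (ℕₚ.+-monoˡ-≤ s (ℕ.s≤s (ℕ.z≤n {4}))) 5+s≤u

  cost : ∀ i → 8 ℕ.* k i ℕ.+ 1 ℕ.+ s ℕ.≤ 2 ℕ.^ r i
  cost i = begin
    8 ℕ.* k i ℕ.+ 1 ℕ.+ s                 ≡⟨ ℕₚ.+-assoc (8 ℕ.* k i) 1 s ⟩
    8 ℕ.* k i ℕ.+ suc s                   ≤⟨ ℕₚ.+-monoʳ-≤ (8 ℕ.* k i) (ℕₚ.≤-trans s<u (ℕₚ.≤-trans (ℕₚ.m≤m+n u (5 ℕ.* i)) (ℕₚ.≤-trans (ℕₚ.<⇒≤ (n<2^n (u ℕ.+ 5 ℕ.* i))) (ℕₚ.m≤n*m (k i) 8)))) ⟩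
    8 ℕ.* k i ℕ.+ 8 ℕ.* k i               ≡⟨ e₁ (k i) ⟩
    16 ℕ.* k i                            ≡⟨ sym (ℕₚ.^-distribˡ-+-* 2 4 (u ℕ.+ 5 ℕ.* i)) ⟩
    2 ℕ.^ (4 ℕ.+ (u ℕ.+ 5 ℕ.* i))         ≡⟨ cong (2 ℕ.^_) (e₂ u i) ⟩
    2 ℕ.^ r i ∎
    where
    open ℕₚ.≤-Reasoning
    e₁ : ∀ k → 8 ℕ.* k ℕ.+ 8 ℕ.* k ≡ 16 ℕ.* k
    e₁ = ℕS.solve-∀
    e₂ : ∀ u i → 4 ℕ.+ (u ℕ.+ 5 ℕ.* i) ≡ u ℕ.+ 4 ℕ.+ 5 ℕ.* i
    e₂ = ℕS.solve-∀

  cost₀ : 8 ℕ.* 1 ℕ.+ 1 ℕ.+ s ℕ.≤ 2 ℕ.^ (u ℕ.+ 4)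
  cost₀ = ℕₚ.≤-trans (ℕₚ.+-monoʳ-≤ 4 5+s≤u) (ℕₚ.≤-trans (ℕₚ.≤-reflexive (ℕₚ.+-comm 4 u)) (ℕₚ.<⇒≤ (n<2^n (u ℕ.+ 4))))

  gain : ∀ i → 2ℚ ^ℚ suc (r i) ≤ ρ i ^ℚ q
  gain i = subst (2ℚ ^ℚ suc (r i) ≤_) (^ℚ-* 2ℚ (w ℕ.+ i) q) (^ℚ-monoʳ (≤! {1ℚ} {2ℚ}) exponent)
    where
    exponent : suc (r i) ℕ.≤ q ℕ.* (w ℕ.+ i)
    -- (u + 5) (1 + i) exceeds suc (r i) by u i, so one exponent q serves all levels.
    exponent = ℕₚ.≤-trans (ℕₚ.≤-trans (ℕₚ.m≤m+n (suc (r i)) (u ℕ.* i)) (ℕₚ.≤-reflexive (e u i))) (ℕₚ.*-mono-≤ u+5≤q (ℕₚ.+-monoˡ-≤ i 1≤w))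
      where
      e : ∀ u i → suc (u ℕ.+ 4 ℕ.+ 5 ℕ.* i) ℕ.+ u ℕ.* i ≡ (u ℕ.+ 5) ℕ.* (1 ℕ.+ i)
      e = ℕS.solve-∀

  level-sizes : ∀ i → ι 64 * ((1ℚ + ½ ^ℚ s) * (1ℚ + 2ℚ * ½ ^ℚ s) * ρ i - 1ℚ) < ι (k i) * (θ * ¼ ^ℚ suc i * (θ * ¼ ^ℚ suc i))
  level-sizes i = begin-strict
    ι 64 * (H * ρ i - 1ℚ)                        <⟨ *-monoʳ-<-pos (ι 64) {{positive (<! {0ℚ} {ι 64})}} (subst (H * ρ i - 1ℚ <_) (+-identityʳ (H * ρ i)) (+-monoʳ-< (H * ρ i) (<! { - 1ℚ} {0ℚ}))) ⟩
    ι 64 * (H * ρ i)                             ≤⟨ *-monoˡ (ι 64) (0≤ι 64) (*-monoʳ-≤-nonNeg (ρ i) {{nonNegative (0≤ρ i)}} num₂) ⟩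
    ι 64 * (2ℚ * ρ i)                            ≡⟨ trans (cong (λ t → ι 64 * (2ℚ * t)) (^ℚ-+ 2ℚ w i)) (e₁ (ι 64) (2ℚ ^ℚ w) (2ℚ ^ℚ i)) ⟩
    ι 64 * (2ℚ * 2ℚ ^ℚ w) * 2ℚ ^ℚ i              ≤⟨ *-monoʳ-≤-nonNeg (2ℚ ^ℚ i) {{nonNegative (0≤^ i (≤! {0ℚ} {2ℚ}))}} num₃ ⟩
    2ℚ ^ℚ u * (θ * θ * (¼ * ¼)) * 2ℚ ^ℚ i        ≡⟨ cong (2ℚ ^ℚ u * (θ * θ * (¼ * ¼)) *_) (sym (quarter i)) ⟩
    2ℚ ^ℚ u * (θ * θ * (¼ * ¼)) * (2ℚ ^ℚ (5 ℕ.* i) * (¼ ^ℚ i * ¼ ^ℚ i))   ≡⟨ e₂ (2ℚ ^ℚ u) θ (2ℚ ^ℚ (5 ℕ.* i)) (¼ ^ℚ i) ⟩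
    2ℚ ^ℚ u * 2ℚ ^ℚ (5 ℕ.* i) * (θ * (¼ * ¼ ^ℚ i) * (θ * (¼ * ¼ ^ℚ i)))   ≡⟨ cong (_* (θ * ¼ ^ℚ suc i * (θ * ¼ ^ℚ suc i))) (sym (trans (ι2^ (u ℕ.+ 5 ℕ.* i)) (^ℚ-+ 2ℚ u (5 ℕ.* i)))) ⟩
    ι (k i) * (θ * ¼ ^ℚ suc i * (θ * ¼ ^ℚ suc i)) ∎
    where
    open ≤-Reasoning
    H : ℚ
    H = (1ℚ + ½ ^ℚ s) * (1ℚ + 2ℚ * ½ ^ℚ s)
    e₁ : ∀ c a x → c * (2ℚ * (a * x)) ≡ c * (2ℚ * a) * x
    e₁ = solve-∀ ℚ-ring
    e₂ : ∀ p t x y → p * (t * t * (¼ * ¼)) * (x * (y * y)) ≡ p * x * (t * (¼ * y) * (t * (¼ * y)))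
    e₂ = solve-∀ ℚ-ring
    quarter : ∀ i → 2ℚ ^ℚ (5 ℕ.* i) * (¼ ^ℚ i * ¼ ^ℚ i) ≡ 2ℚ ^ℚ i
    quarter zero    = refl
    quarter (suc i) = trans (cong (λ t → 2ℚ ^ℚ t * (¼ ^ℚ suc i * ¼ ^ℚ suc i)) (ℕₚ.*-suc 5 i))
      (trans (cong (_* (¼ ^ℚ suc i * ¼ ^ℚ suc i)) (^ℚ-+ 2ℚ 5 (5 ℕ.* i))) (trans (e (2ℚ ^ℚ (5 ℕ.* i)) (¼ ^ℚ i)) (cong (2ℚ *_) (quarter i))))
      where
      e : ∀ x y → 2ℚ ^ℚ 5 * x * (¼ * y * (¼ * y)) ≡ 2ℚ * (x * (y * y))
      e = solve-∀ ℚ-ring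

  level-sum : ∀ J → ι 64 * θ * ∑ J (λ i → ¼ ^ℚ i * ρ i) ≤ ¼
  level-sum J = begin
    ι 64 * θ * ∑ J (λ i → ¼ ^ℚ i * ρ i)               ≡⟨ cong (ι 64 * θ *_) (trans (∑-cong J (λ i _ → term i)) (sym (*-∑ J (2ℚ ^ℚ w) _))) ⟩
    ι 64 * θ * (2ℚ ^ℚ w * ∑ J (½ ^ℚ_))                ≤⟨ *-monoˡ (ι 64 * θ) (0≤* (0≤ι 64) (<⇒≤ 0<θ)) (*-monoˡ (2ℚ ^ℚ w) (0≤^ w (≤! {0ℚ} {2ℚ})) (≤-add (2ℚ * ½ ^ℚ J) (0≤* (≤! {0ℚ} {2ℚ}) (0≤^ J (≤! {0ℚ} {½}))) (geometric J))) ⟩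
    ι 64 * θ * (2ℚ ^ℚ w * 2ℚ)                         ≤⟨ num₄ ⟩
    ¼ ∎
    where
    open ≤-Reasoning
    geometric : ∀ J → ∑ J (½ ^ℚ_) + 2ℚ * ½ ^ℚ J ≡ 2ℚ
    geometric zero    = refl
    geometric (suc J) = trans (g (∑ J (½ ^ℚ_)) (½ ^ℚ J)) (geometric J)
      where
      g : ∀ x y → x + y + 2ℚ * (½ * y) ≡ x + 2ℚ * y
      g = solve-∀ ℚ-ring
    term : ∀ i → ¼ ^ℚ i * ρ i ≡ 2ℚ ^ℚ w * ½ ^ℚ i
    term i = trans (cong₂ _*_ (^ℚ-distrib ½ ½ i) (^ℚ-+ 2ℚ w i)) (trans (g (½ ^ℚ i) (2ℚ ^ℚ i) (2ℚ ^ℚ w))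
      (trans (cong (2ℚ ^ℚ w * ½ ^ℚ i *_) (2^ℚ*½^ℚ i)) (*-identityʳ _)))
      where
      g : ∀ h t c → h * h * (c * t) ≡ c * h * (t * h)
      g = solve-∀ ℚ-ring

  -- ¼ ^ J ≤ δ, for otherwise δ ^ q h ≤ 2 ^ (- 6 J) 2 ^ (u + 9 + 5 J) ≤ K.
  density-lower : ∀ J δ h → 0ℚ ≤ δ → δ ≤ 1ℚ → h ℕ.< 2 ℕ.^ r (suc J) → K < δ ^ℚ q * ι h → ¼ ^ℚ J ≤ δ
  density-lower J δ h 0≤δ δ≤1 h< large with ¼ ^ℚ J ≤? δ
  ... | yes p = p
  ... | no ¬p = ⊥-elim (<-irrefl refl (<-≤-trans large (begin
    δ ^ℚ q * ι h                                   ≤⟨ *-mono (0≤^ q 0≤δ) δ^q≤ (0≤ι h) (≤-trans (ι-mono (ℕₚ.<⇒≤ h<)) (≤-reflexive (ι2^ (r (suc J))))) ⟩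
    (¼ ^ℚ J) ^ℚ 3 * 2ℚ ^ℚ r (suc J)                ≡⟨ cong₂ (λ x y → x ^ℚ 3 * y) (^ℚ-distrib ½ ½ J) (trans (cong (2ℚ ^ℚ_) (e₁ u J)) (trans (^ℚ-+ 2ℚ (u ℕ.+ 9) (J ℕ.+ (J ℕ.+ (J ℕ.+ (J ℕ.+ J))))) (cong (K *_) five))) ⟩
    (y * y) ^ℚ 3 * (K * (x * (x * (x * (x * x)))))  ≡⟨ e₂ K x y ⟩
    K * (x * y) ^ℚ 5 * y                           ≡⟨ trans (cong (λ t → K * t ^ℚ 5 * y) (2^ℚ*½^ℚ J)) (cong (_* y) (*-identityʳ K)) ⟩
    K * y                                          ≤⟨ *-monoˡ K (0≤^ (u ℕ.+ 9) (≤! {0ℚ} {2ℚ})) (subst (y ≤_) (1^ℚ J) (^ℚ-mono J (≤! {0ℚ} {½}) (≤! {½} {1ℚ}))) ⟩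
    K * 1ℚ                                         ≡⟨ *-identityʳ K ⟩
    K ∎)))
    where
    open ≤-Reasoning
    x y : ℚ
    x = 2ℚ ^ℚ J
    y = ½ ^ℚ J
    five : 2ℚ ^ℚ (J ℕ.+ (J ℕ.+ (J ℕ.+ (J ℕ.+ J)))) ≡ x * (x * (x * (x * x)))
    five = trans (^ℚ-+ 2ℚ J (J ℕ.+ (J ℕ.+ (J ℕ.+ J)))) (cong (x *_) (trans (^ℚ-+ 2ℚ J (J ℕ.+ (J ℕ.+ J))) (cong (x *_) (trans (^ℚ-+ 2ℚ J (J ℕ.+ J)) (cong (x *_) (^ℚ-+ 2ℚ J J))))))
    e₁ : ∀ u J → u ℕ.+ 4 ℕ.+ 5 ℕ.* suc J ≡ (u ℕ.+ 9) ℕ.+ (J ℕ.+ (J ℕ.+ (J ℕ.+ (J ℕ.+ J))))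
    e₁ = ℕS.solve-∀
    e₂ : ∀ K x y → y * y * (y * y * (y * y * 1ℚ)) * (K * (x * (x * (x * (x * x))))) ≡ K * (x * y * (x * y * (x * y * (x * y * (x * y * 1ℚ))))) * y
    e₂ = solve-∀ ℚ-ring
    anti : ∀ {i j} → i ℕ.≤ j → δ ^ℚ j ≤ δ ^ℚ i
    anti {j = j} ℕ.z≤n = subst (δ ^ℚ j ≤_) (1^ℚ j) (^ℚ-mono j 0≤δ δ≤1)
    anti (ℕ.s≤s i≤j)   = *-monoˡ δ 0≤δ (anti i≤j)
    3≤q : 3 ℕ.≤ q
    3≤q = ℕₚ.≤-trans (ℕₚ.≤-trans (ℕ.s≤s (ℕ.s≤s (ℕ.s≤s (ℕ.z≤n {2})))) (ℕₚ.m≤n+m 5 u)) u+5≤q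
    δ^q≤ : δ ^ℚ q ≤ (¼ ^ℚ J) ^ℚ 3
    δ^q≤ = ≤-trans (anti 3≤q) (^ℚ-mono 3 0≤δ (<⇒≤ (≰⇒> ¬p)))

  -- h ≥ 2 ^ r J > r J ≥ 6 + 4 J, whereas δ² ≥ 2 ^ (- 4 J).
  large-n : ∀ J δ h → 2 ℕ.^ r J ℕ.≤ h → ¼ ^ℚ J ≤ δ → ι 64 ≤ ι (2 ℕ.^ h) * (δ * δ)
  large-n J δ h 2^r≤h ¼≤δ = begin
    ι 64                                        ≡⟨ sym (*-identityʳ (ι 64)) ⟩
    2ℚ ^ℚ 6 * 1ℚ                                ≡⟨ cong (2ℚ ^ℚ 6 *_) (sym (cong (_^ℚ 4) (2^ℚ*½^ℚ J))) ⟩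
    2ℚ ^ℚ 6 * (x * y) ^ℚ 4                      ≡⟨ e₁ (2ℚ ^ℚ 6) x y ⟩
    2ℚ ^ℚ 6 * (x * (x * (x * x))) * (y * y * (y * y))  ≡⟨ cong₂ _*_ (sym six) (cong (λ t → t * t) (sym (^ℚ-distrib ½ ½ J))) ⟩
    2ℚ ^ℚ (6 ℕ.+ (J ℕ.+ (J ℕ.+ (J ℕ.+ J)))) * (¼ ^ℚ J * ¼ ^ℚ J)
      ≤⟨ *-mono (0≤^ (6 ℕ.+ (J ℕ.+ (J ℕ.+ (J ℕ.+ J)))) (≤! {0ℚ} {2ℚ})) (^ℚ-monoʳ (≤! {1ℚ} {2ℚ}) exponent) (0≤sq (¼ ^ℚ J)) (*-mono 0≤¼ ¼≤δ 0≤¼ ¼≤δ) ⟩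
    2ℚ ^ℚ h * (δ * δ)                           ≡⟨ cong (_* (δ * δ)) (sym (ι2^ h)) ⟩
    ι (2 ℕ.^ h) * (δ * δ) ∎
    where
    open ≤-Reasoning
    x y : ℚ
    x = 2ℚ ^ℚ J
    y = ½ ^ℚ J
    0≤¼ : 0ℚ ≤ ¼ ^ℚ J
    0≤¼ = 0≤^ J (≤! {0ℚ} {¼})
    e₁ : ∀ c x y → c * (x * y * (x * y * (x * y * (x * y * 1ℚ)))) ≡ c * (x * (x * (x * x))) * (y * y * (y * y))
    e₁ = solve-∀ ℚ-ring
    six : 2ℚ ^ℚ (6 ℕ.+ (J ℕ.+ (J ℕ.+ (J ℕ.+ J)))) ≡ 2ℚ ^ℚ 6 * (x * (x * (x * x)))
    six = trans (^ℚ-+ 2ℚ 6 (J ℕ.+ (J ℕ.+ (J ℕ.+ J)))) (cong (2ℚ ^ℚ 6 *_) (trans (^ℚ-+ 2ℚ J (J ℕ.+ (J ℕ.+ J))) (cong (x *_) (trans (^ℚ-+ 2ℚ J (J ℕ.+ J)) (cong (x *_) (^ℚ-+ 2ℚ J J))))))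
    exponent : 6 ℕ.+ (J ℕ.+ (J ℕ.+ (J ℕ.+ J))) ℕ.≤ h
    exponent = ℕₚ.≤-trans (ℕₚ.≤-trans (ℕₚ.m≤m+n _ (J ℕ.+ (3 ℕ.+ s))) (ℕₚ.≤-trans (ℕₚ.≤-reflexive (e₂ s J)) (ℕₚ.+-monoˡ-≤ (5 ℕ.* J) (ℕₚ.+-monoˡ-≤ 4 5+s≤u))))
        (ℕₚ.≤-trans (ℕₚ.<⇒≤ (n<2^n (r J))) 2^r≤h)
      where
      e₂ : ∀ s J → 6 ℕ.+ (J ℕ.+ (J ℕ.+ (J ℕ.+ J))) ℕ.+ (J ℕ.+ (3 ℕ.+ s)) ≡ 5 ℕ.+ s ℕ.+ 4 ℕ.+ 5 ℕ.* J
      e₂ = ℕS.solve-∀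

  Bounded : ℕ → Set
  Bounded h = ∀ a → SkewFree a → density h a ^ℚ q * ι h ≤ K

  step : ∀ h → (∀ {b} → b ℕ.< h → Bounded b) → Bounded h
  step h IH a sf with density h a ^ℚ q * ι h ≤? K
  ... | yes p = p
  -- J counts the levels whose progressions are affordable at scale h; the search may stop at h
  -- because h < 2 ^ r h.
  ... | no ¬p = ⊥-elim (go (bracket (λ J → 2 ℕ.^ r J) h h start (ℕₚ.<-≤-trans (n<2^n h) (ℕₚ.^-monoʳ-≤ 2 (ℕₚ.≤-trans (ℕₚ.m≤m+n h (4 ℕ.* h)) (ℕₚ.m≤n+m (5 ℕ.* h) (u ℕ.+ 4)))))))
    where
    large : K < density h a ^ℚ q * ι h
    large = ≰⇒> ¬p
    K<h : K < ι h
    K<h = <-≤-trans large (≤-trans (*-monoʳ-≤-nonNeg (ι h) {{nonNegative (0≤ι h)}} (subst (density h a ^ℚ q ≤_) (1^ℚ q) (^ℚ-mono q (0≤density h a) (density≤1 h a)))) (≤-reflexive (*-identityˡ (ι h))))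
    2^r₀≤h : 2 ℕ.^ (u ℕ.+ 4) ℕ.≤ h
    2^r₀≤h = ι-cancel-≤ (≤-trans (≤-reflexive (ι2^ (u ℕ.+ 4))) (≤-trans (^ℚ-monoʳ (≤! {1ℚ} {2ℚ}) (ℕₚ.+-monoʳ-≤ u (ℕₚ.m≤m+n 4 5))) (<⇒≤ K<h)))
    start : 2 ℕ.^ r 0 ℕ.≤ h
    start = subst (λ t → 2 ℕ.^ t ℕ.≤ h) (sym (ℕₚ.+-identityʳ (u ℕ.+ 4))) 2^r₀≤h
    u+4≤h : u ℕ.+ 4 ℕ.≤ h
    u+4≤h = ℕₚ.≤-trans (ℕₚ.<⇒≤ (n<2^n (u ℕ.+ 4))) 2^r₀≤h
    s≤h : s ℕ.≤ h
    s≤h = ℕₚ.≤-trans (ℕₚ.<⇒≤ s<u) (ℕₚ.≤-trans (ℕₚ.m≤m+n u 4) u+4≤h)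
    1≤h : 1 ℕ.≤ h
    1≤h = ℕₚ.≤-trans (ℕₚ.≤-trans (ℕ.s≤s (ℕ.z≤n {3})) (ℕₚ.m≤n+m 4 u)) u+4≤h
    h≡ : h ≡ s ℕ.+ (h ℕ.∸ s)
    h≡ = sym (ℕₚ.m+[n∸m]≡n s≤h)
    open Step s q K h (h ℕ.∸ s) h≡ a sf (λ b b<h → IH b<h) large
    go : ∃[ J ] (2 ℕ.^ r J ℕ.≤ h × h ℕ.< 2 ℕ.^ r (suc J)) → ⊥
    go (J , 2^r≤h , h<) = Contradiction.absurd (2 ℕ.^ ℕ.pred h) halves 0<n δ 0<δ refl (ι-N) (½ ^ℚ s) (0≤^ s (≤! {0ℚ} {½}))
        (subst (½ ^ℚ s ≤_) (1^ℚ s) (^ℚ-mono s (≤! {0ℚ} {½}) (≤! {½} {1ℚ}))) ι-m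
        θ 0<θ J ρ₀ ρ 0≤ρ k
        (control 1 (u ℕ.+ 4) ρ₀ 0≤ρ₀ cost₀ (ℕₚ.≤-trans (ℕ.s≤s (ℕ.z≤n {3})) (ℕₚ.m≤n+m 4 u)) 2^r₀≤h (subst (λ t → 2ℚ ^ℚ t ≤ ρ₀ ^ℚ q) (ℕₚ.+-suc u 4) gain₀))
        (λ i i<J → control (k i) (r i) (ρ i) (0≤ρ i) (cost i) (ℕₚ.≤-trans (ℕₚ.≤-trans (ℕ.s≤s (ℕ.z≤n {3})) (ℕₚ.m≤n+m 4 u)) (ℕₚ.m≤m+n (u ℕ.+ 4) (5 ℕ.* i)))
          (ℕₚ.≤-trans (ℕₚ.^-monoʳ-≤ 2 (ℕₚ.+-monoʳ-≤ (u ℕ.+ 4) (ℕₚ.*-monoʳ-≤ 5 (ℕₚ.<⇒≤ i<J)))) 2^r≤h) (gain i))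
        num₁ level-sizes (level-sum J) tail (large-n J δ h 2^r≤h ¼≤δ)
      where
      ¼≤δ : ¼ ^ℚ J ≤ δ
      ¼≤δ = density-lower J δ h 0≤δ (density≤1 h a) h< large
      0<δ : 0ℚ < δ
      0<δ = <-≤-trans (0<^ J (<! {0ℚ} {¼})) ¼≤δ
      0<n : 0ℚ < ι n
      0<n = ι-mono-< {0} {n} (ℕₚ.m^n>0 2 h)
      halves : n ≡ 2 ℕ.^ ℕ.pred h ℕ.+ 2 ℕ.^ ℕ.pred h
      halves = trans (cong (2 ℕ.^_) (sym (ℕₚ.suc-pred h {{ℕ.>-nonZero 1≤h}}))) (cong (2 ℕ.^ ℕ.pred h ℕ.+_) (ℕₚ.+-identityʳ _))
      ι-N : ι N ≡ 4ℚ * ι n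
      ι-N = trans (ι2^ (suc (suc h))) (trans (e (2ℚ ^ℚ h)) (cong (4ℚ *_) (sym (ι2^ h))))
        where
        e : ∀ x → 2ℚ * (2ℚ * x) ≡ 4ℚ * x
        e = solve-∀ ℚ-ring
      ι-m : ι m ≡ ½ ^ℚ s * ι n
      ι-m = sym (trans (cong (½ ^ℚ s *_) (trans (ι2^ h) (trans (cong (2ℚ ^ℚ_) h≡) (^ℚ-+ 2ℚ s (h ℕ.∸ s)))))
        (trans (e (½ ^ℚ s) (2ℚ ^ℚ s) (2ℚ ^ℚ (h ℕ.∸ s))) (trans (cong (_* 2ℚ ^ℚ (h ℕ.∸ s)) (2^ℚ*½^ℚ s)) (trans (*-identityˡ _) (sym (ι2^ (h ℕ.∸ s)))))))
        where
        e : ∀ x y z → x * (y * z) ≡ y * x * z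
        e = solve-∀ ℚ-ring
      0≤θ : 0ℚ ≤ θ
      0≤θ = <⇒≤ 0<θ
      16θ≤¼ : ι 16 * θ ≤ ¼
      16θ≤¼ = ≤-trans (subst (_≤ ι 64 * θ * (2ℚ ^ℚ w * 2ℚ)) (*-identityʳ (ι 16 * θ)) (*-mono (0≤* (0≤ι 16) 0≤θ) (*-monoʳ-≤-nonNeg θ {{nonNegative 0≤θ}} (≤! {ι 16} {ι 64})) (≤! {0ℚ} {1ℚ})
                (*-mono (≤! {0ℚ} {1ℚ}) (1≤^ w (≤! {1ℚ} {2ℚ})) (≤! {0ℚ} {1ℚ}) (≤! {1ℚ} {2ℚ})))) num₄
      tail : ι 16 * θ * ¼ ^ℚ J ≤ ¼ * δ
      tail = *-mono (0≤* (0≤ι 16) (<⇒≤ 0<θ)) 16θ≤¼ (0≤^ J (≤! {0ℚ} {¼})) ¼≤δ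

  bounded : ∀ h → Bounded h
  bounded = <-rec Bounded step

-- Constants and conclusion

bernoulli : ∀ {x} → 0ℚ ≤ x → ∀ n → 1ℚ + ι n * x ≤ (1ℚ + x) ^ℚ n
bernoulli {x} 0≤x zero    = ≤-reflexive (trans (cong (1ℚ +_) (*-zeroˡ x)) (+-identityʳ 1ℚ))
bernoulli {x} 0≤x (suc n) = ≤-trans (≤-add (ι n * (x * x)) (0≤* (0≤ι n) (0≤sq x)) (e (ι n) x))
  (*-monoˡ (1ℚ + x) (0≤+ (≤! {0ℚ} {1ℚ}) 0≤x) (bernoulli 0≤x n))
  where
  e : ∀ n x → 1ℚ + (1ℚ + n) * x + n * (x * x) ≡ (1ℚ + x) * (1ℚ + n * x)
  e = solve-∀ ℚ-ring

-- By Bernoulli, M + 1 factors 1 + x give at least 2 once M ≥ 1 / x.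
exponent-for : ∀ {x} → 0ℚ < x → ∀ c → ∃[ q ] (c ℕ.≤ q × 2ℚ ^ℚ c ≤ (1ℚ + x) ^ℚ q)
exponent-for {x} 0<x c =
  let x⁻¹ , 0<x⁻¹ , xx⁻¹ = inverse x 0<x
      M , M-big = archimedean x⁻¹
      doubled : 2ℚ ≤ (1ℚ + x) ^ℚ suc M
      doubled = ≤-trans (+-monoʳ-≤ 1ℚ (subst (_≤ ι (suc M) * x) xx⁻¹ (≤-trans (≤-reflexive (*-comm x x⁻¹))
          (*-monoʳ-≤-nonNeg x {{nonNegative (<⇒≤ 0<x)}} (≤-trans M-big (ι-mono (ℕₚ.n≤1+n M)))))))
        (bernoulli (<⇒≤ 0<x) (suc M))
  in c ℕ.* suc M , ℕₚ.m≤m*n c (suc M) , ≤-trans (^ℚ-mono c (≤! {0ℚ} {2ℚ}) doubled) (≤-reflexive (sym (^ℚ-* (1ℚ + x) (suc M) c)))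

½^≤1 : ∀ k → ½ ^ℚ k ≤ 1ℚ
½^≤1 k = subst (½ ^ℚ k ≤_) (1^ℚ k) (^ℚ-mono k (≤! {0ℚ} {½}) (≤! {½} {1ℚ}))

-- Any w ≥ 3 works; it stays a variable so that the huge numerals depending on it are never evaluated.
density-bound : ∀ w → 3 ℕ.≤ w →
  ∃[ q ] ∃[ K ] (1 ℕ.≤ q × (∀ h a → SkewFree a → density h a ^ℚ q * ι h ≤ ι K))
density-bound w 3≤w =
  let q , u+5≤q , gain₀ = exponent-for (0<^ s (<! {0ℚ} {½})) (u ℕ.+ 5)
  in q , 2 ℕ.^ (u ℕ.+ 9) , ℕₚ.≤-trans (ℕₚ.≤-trans (ℕ.s≤s (ℕ.z≤n {4})) (ℕₚ.m≤n+m 5 u)) u+5≤q , λ h a sf →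
       subst (density h a ^ℚ q * ι h ≤_) (sym (ι2^ (u ℕ.+ 9)))
         (Iteration.bounded s u q w 5+s≤u u+5≤q 1≤w θ (1ℚ + x) (0<^ t (<! {0ℚ} {½})) (0≤+ (≤! {0ℚ} {1ℚ}) 0≤x)
           gain₀ num₁ num₂ num₃ num₄ h a sf)
  where
  -- `num₄` holds with equality for θ = 2 ^ (- t); `num₁` needs 2 ^ 10 x ≤ θ², which gives s; `num₃`
  -- then gives u, with a factor 2 to spare.
  t s u : ℕ
  t = w ℕ.+ 9
  s = 10 ℕ.+ (t ℕ.+ t)
  u = (w ℕ.+ 8) ℕ.+ (t ℕ.+ t ℕ.+ 4)
  θ x A : ℚ
  θ = ½ ^ℚ t
  x = ½ ^ℚ s
  A = 2ℚ ^ℚ w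
  0≤x : 0ℚ ≤ x
  0≤x = 0≤^ s (≤! {0ℚ} {½})
  1≤w : 1 ℕ.≤ w
  1≤w = ℕₚ.≤-trans (ℕ.s≤s (ℕ.z≤n {2})) 3≤w
  5+s≤u : 5 ℕ.+ s ℕ.≤ u
  5+s≤u = ℕₚ.≤-trans (ℕₚ.≤-reflexive (e₁ t)) (ℕₚ.≤-trans (ℕₚ.+-monoˡ-≤ (t ℕ.+ t ℕ.+ 12) 3≤w) (ℕₚ.≤-reflexive (e₂ w t)))
    where
    e₁ : ∀ t → 5 ℕ.+ (10 ℕ.+ (t ℕ.+ t)) ≡ 3 ℕ.+ (t ℕ.+ t ℕ.+ 12)
    e₁ = ℕS.solve-∀
    e₂ : ∀ w t → w ℕ.+ (t ℕ.+ t ℕ.+ 12) ≡ (w ℕ.+ 8) ℕ.+ (t ℕ.+ t ℕ.+ 4)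
    e₂ = ℕS.solve-∀
  x≡ : x ≡ ½ ^ℚ 10 * (θ * θ)
  x≡ = trans (^ℚ-+ ½ 10 (t ℕ.+ t)) (cong (½ ^ℚ 10 *_) (^ℚ-+ ½ t t))
  4x≤1 : 4ℚ * x ≤ 1ℚ
  4x≤1 = begin
    4ℚ * x                            ≡⟨ cong (4ℚ *_) (^ℚ-+ ½ 2 (8 ℕ.+ (t ℕ.+ t))) ⟩
    4ℚ * (½ ^ℚ 2 * ½ ^ℚ (8 ℕ.+ (t ℕ.+ t)))   ≤⟨ *-monoˡ 4ℚ (≤! {0ℚ} {4ℚ}) (*-monoˡ (½ ^ℚ 2) (≤! {0ℚ} {½ ^ℚ 2}) (½^≤1 (8 ℕ.+ (t ℕ.+ t)))) ⟩
    4ℚ * (½ ^ℚ 2 * 1ℚ)                ≡⟨⟩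
    1ℚ ∎
    where open ≤-Reasoning
  num₁ : ι 64 * ((1ℚ + x) * (1ℚ + 2ℚ * x) * (1ℚ + x) - 1ℚ) ≤ θ * θ
  -- The bracket is 4 x + 5 x² + 2 x³ ≤ 11 x; it is rounded up to 16 x because 64 · 16 = 2 ^ 10.
  num₁ = begin
    ι 64 * ((1ℚ + x) * (1ℚ + 2ℚ * x) * (1ℚ + x) - 1ℚ)
      ≤⟨ ≤-add (ι 64 * (ι 5 * (x * (1ℚ - x)) + (2ℚ * (x * (1ℚ - x * x)) + ι 5 * x)))
           (0≤* (0≤ι 64) (0≤+ (0≤* (0≤ι 5) (0≤* 0≤x (0≤- (½^≤1 s)))) (0≤+ (0≤* (≤! {0ℚ} {2ℚ}) (0≤* 0≤x (0≤- (*-mono 0≤x (½^≤1 s) 0≤x (½^≤1 s))))) (0≤* (0≤ι 5) 0≤x))))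
           (e₁ x) ⟩
    ι 64 * ι 16 * x                   ≡⟨ cong (ι 64 * ι 16 *_) x≡ ⟩
    2ℚ ^ℚ 10 * (½ ^ℚ 10 * (θ * θ))    ≡⟨ sym (*-assoc (2ℚ ^ℚ 10) (½ ^ℚ 10) (θ * θ)) ⟩
    2ℚ ^ℚ 10 * ½ ^ℚ 10 * (θ * θ)      ≡⟨ trans (cong (_* (θ * θ)) (2^ℚ*½^ℚ 10)) (*-identityˡ (θ * θ)) ⟩
    θ * θ ∎
    where
    open ≤-Reasoning
    e₁ : ∀ x → ι 64 * ((1ℚ + x) * (1ℚ + 2ℚ * x) * (1ℚ + x) - 1ℚ) + ι 64 * (ι 5 * (x * (1ℚ - x)) + (2ℚ * (x * (1ℚ - x * x)) + ι 5 * x)) ≡ ι 64 * ι 16 * x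
    e₁ = solve-∀ ℚ-ring
  num₂ : (1ℚ + x) * (1ℚ + 2ℚ * x) ≤ 2ℚ
  num₂ = ≤-add ((1ℚ - 4ℚ * x) + x * (½ * (1ℚ - 4ℚ * x) + ½)) (0≤+ (0≤- 4x≤1) (0≤* 0≤x (0≤+ (0≤* (≤! {0ℚ} {½}) (0≤- 4x≤1)) (≤! {0ℚ} {½})))) (e x)
    where
    e : ∀ x → (1ℚ + x) * (1ℚ + 2ℚ * x) + ((1ℚ - 4ℚ * x) + x * (½ * (1ℚ - 4ℚ * x) + ½)) ≡ 2ℚ
    e = solve-∀ ℚ-ring
  num₃ : ι 64 * (2ℚ * A) ≤ 2ℚ ^ℚ u * (θ * θ * (¼ * ¼))
  num₃ = begin
    ι 64 * (2ℚ * A)                   ≡⟨ e₁ A ⟩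
    A * (ι 64 * 2ℚ)                   ≤⟨ *-monoˡ A (0≤^ w (≤! {0ℚ} {2ℚ})) (≤! {ι 64 * 2ℚ} {2ℚ ^ℚ 8}) ⟩
    A * 2ℚ ^ℚ 8                       ≡⟨ sym (^ℚ-+ 2ℚ w 8) ⟩
    P                                 ≡⟨ sym (*-identityʳ P) ⟩
    P * 1ℚ                            ≡⟨ cong (P *_) (sym (2^ℚ*½^ℚ v)) ⟩
    P * (2ℚ ^ℚ v * ½ ^ℚ v)            ≡⟨ sym (*-assoc P (2ℚ ^ℚ v) (½ ^ℚ v)) ⟩
    P * 2ℚ ^ℚ v * ½ ^ℚ v              ≡⟨ cong₂ _*_ (sym (^ℚ-+ 2ℚ (w ℕ.+ 8) v)) (trans (^ℚ-+ ½ (t ℕ.+ t) 4) (cong (_* (¼ * ¼)) (^ℚ-+ ½ t t))) ⟩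
    2ℚ ^ℚ u * (θ * θ * (¼ * ¼)) ∎
    where
    open ≤-Reasoning
    v : ℕ
    v = t ℕ.+ t ℕ.+ 4
    P : ℚ
    P = 2ℚ ^ℚ (w ℕ.+ 8)
    e₁ : ∀ a → ι 64 * (2ℚ * a) ≡ a * (ι 64 * 2ℚ)
    e₁ = solve-∀ ℚ-ring
  num₄ : ι 64 * θ * (A * 2ℚ) ≤ ¼
  num₄ = ≤-reflexive (trans (cong (λ y → ι 64 * y * (A * 2ℚ)) (^ℚ-+ ½ w 9)) (trans (e₁ (ι 64) (½ ^ℚ w) (½ ^ℚ 9) A)
    (trans (cong (ι 64 * ½ ^ℚ 9 * 2ℚ *_) (2^ℚ*½^ℚ w)) refl)))
    where
    e₁ : ∀ c h b a → c * (h * b) * (a * 2ℚ) ≡ c * b * 2ℚ * (a * h)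
    e₁ = solve-∀ ℚ-ring

-- From lists of lattice points to indicator functions

abstract
  _∈?_ : (p : ℤ × ℤ) (A : List (ℤ × ℤ)) → Dec (p ∈ A)
  _∈?_ = DecMembership._∈?_ (≡-dec ℤ._≟_ ℤ._≟_)

-- Coordinates from 1 to n correspond to indices from 0 to n - 1.
point : ℕ → ℕ → ℤ × ℤ
point x y = ℤ.+ suc x , ℤ.+ suc y

indicator : List (ℤ × ℤ) → ℕ → ℕ → Bool
indicator A x y = does (point x y ∈? A)

indicator⇒∈ : ∀ A x y → T (indicator A x y) → point x y ∈ A
indicator⇒∈ A x y t with point x y ∈? A
... | yes p = p

-- With d = x′ - x the three points form the skew corner (x , y), (x , y + d), (x + d , w).
indicator-SkewFree : ∀ A → SkewCornerFree A → SkewFree (indicator A)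
indicator-SkewFree A free x x′ y y′ w t t′ t″ e with x ℕₚ.≟ x′
... | yes p = p
... | no x≢x′ = ⊥-elim (free (ℤ.+ suc x) (ℤ.+ suc y) (ℤ.+ suc w) d d≢0
      (indicator⇒∈ A x y t)
      (subst (λ s → (ℤ.+ suc x , s) ∈ A) (sym y+d) (indicator⇒∈ A x y′ t′))
      (subst (λ s → (s , ℤ.+ suc w) ∈ A) (sym x+d) (indicator⇒∈ A x′ w t″)))
  where
  X X′ d : ℤ
  X  = ℤ.+ suc x
  X′ = ℤ.+ suc x′
  d  = X′ ℤ.- X
  x+d : X ℤ.+ d ≡ X′
  x+d = ez X X′
    where
    ez : ∀ a b → a ℤ.+ (b ℤ.- a) ≡ b
    ez = ℤS.solve-∀
  y+d : ℤ.+ suc y ℤ.+ d ≡ ℤ.+ suc y′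
  y+d = trans (ez₁ (ℤ.+ suc y) X X′) (trans (cong (ℤ._- X) sums) (ez₂ (ℤ.+ suc y′) X))
    where
    ez₁ : ∀ c a b → c ℤ.+ (b ℤ.- a) ≡ (c ℤ.+ b) ℤ.- a
    ez₁ = ℤS.solve-∀
    ez₂ : ∀ c a → (c ℤ.+ a) ℤ.- a ≡ c
    ez₂ = ℤS.solve-∀
    sums : ℤ.+ suc y ℤ.+ X′ ≡ ℤ.+ suc y′ ℤ.+ X
    sums = cong ℤ.+_ (trans (cong suc (ℕₚ.+-suc y x′)) (trans (cong (λ k → suc (suc k)) e) (cong suc (sym (ℕₚ.+-suc y′ x)))))
  d≢0 : ¬ d ≡ ℤ.+ 0
  d≢0 d≡0 = x≢x′ (ℕₚ.suc-injective (ℤₚ.+-injective (trans (sym (ℤₚ.+-identityʳ X)) (trans (cong (λ k → X ℤ.+ k) (sym d≡0)) x+d))))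

grid-coordinate : ∀ {n} {x : ℤ} → ℤ.+ 1 ℤ.≤ x → x ℤ.≤ ℤ.+ n → ∃[ k ] (x ≡ ℤ.+ suc k × k ℕ.< n)
grid-coordinate {x = ℤ.+ zero}  (ℤ.+≤+ ()) _
grid-coordinate {x = ℤ.+ suc k} _ (ℤ.+≤+ k<n) = k , refl , k<n

-- By uniqueness the head of the list is not in its tail, so adding it raises the indicator from 0
-- to 1 at one point.
length≤count : ∀ M n A → n ℕ.≤ M → Unique A → All (InGrid n) A → ι (length A) ≤ count M (indicator A)
length≤count M n [] n≤M _ _ = 0≤∑ M (λ x → 0≤∑ M (λ y → 0≤⟦⟧ (indicator [] x y)))
length≤count M n (p ∷ A) n≤M (p∉ ∷ unique) (((1≤x , x≤n) , (1≤y , y≤n)) ∷ grid)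
  with grid-coordinate 1≤x x≤n | grid-coordinate 1≤y y≤n
... | x₀ , refl , x₀<n | y₀ , refl , y₀<n = begin
  1ℚ + ι (length A)                                          ≤⟨ +-monoʳ-≤ 1ℚ (length≤count M n A n≤M unique grid) ⟩
  1ℚ + count M (indicator A)                                 ≡⟨ cong (_+ count M (indicator A)) (sym one) ⟩
  ∑ M (λ x → ∑ M (λ y → 𝟙 (x₀ ℕₚ.≟ x) * (𝟙 (y₀ ℕₚ.≟ y) * 1ℚ))) + count M (indicator A)
    ≡⟨ sym (trans (∑-cong M (λ x _ → ∑-distrib-+ M _ _)) (∑-distrib-+ M _ _)) ⟩
  ∑ M (λ x → ∑ M (λ y → 𝟙 (x₀ ℕₚ.≟ x) * (𝟙 (y₀ ℕₚ.≟ y) * 1ℚ) + ⟦ indicator A x y ⟧))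
    ≤⟨ ∑-mono M (λ x _ → ∑-mono M (λ y _ → term x y)) ⟩
  count M (indicator (point x₀ y₀ ∷ A)) ∎
  where
  open ≤-Reasoning
  one : ∑ M (λ x → ∑ M (λ y → 𝟙 (x₀ ℕₚ.≟ x) * (𝟙 (y₀ ℕₚ.≟ y) * 1ℚ))) ≡ 1ℚ
  one = trans (∑-cong M (λ x _ → trans (sym (*-∑ M (𝟙 (x₀ ℕₚ.≟ x)) _)) (cong (𝟙 (x₀ ℕₚ.≟ x) *_) (∑-𝟙 M (λ _ → 1ℚ) (ℕₚ.<-≤-trans y₀<n n≤M)))))
    (∑-𝟙 M (λ _ → 1ℚ) (ℕₚ.<-≤-trans x₀<n n≤M))
  monotone : ∀ x y → ⟦ indicator A x y ⟧ ≤ ⟦ indicator (point x₀ y₀ ∷ A) x y ⟧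
  monotone x y with point x y ∈? A | point x y ∈? (point x₀ y₀ ∷ A)
  ... | no _  | yes _ = ≤! {0ℚ} {1ℚ}
  ... | no _  | no _  = ≤-refl
  ... | yes _ | yes _ = ≤-refl
  ... | yes q | no ¬q = ⊥-elim (¬q (there q))
  new : 1ℚ * (1ℚ * 1ℚ) + ⟦ indicator A x₀ y₀ ⟧ ≤ ⟦ indicator (point x₀ y₀ ∷ A) x₀ y₀ ⟧
  new with point x₀ y₀ ∈? A | point x₀ y₀ ∈? (point x₀ y₀ ∷ A)
  ... | yes q | _     = ⊥-elim (All¬⇒¬Any p∉ q)
  ... | no _  | yes _ = ≤! {1ℚ * (1ℚ * 1ℚ) + 0ℚ} {1ℚ}
  ... | no _  | no ¬q = ⊥-elim (¬q (here refl))
  old : ∀ x y c → c ≡ 0ℚ → c + ⟦ indicator A x y ⟧ ≤ ⟦ indicator (point x₀ y₀ ∷ A) x y ⟧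
  old x y c c≡0 = ≤-trans (≤-reflexive (trans (cong (_+ ⟦ indicator A x y ⟧) c≡0) (+-identityˡ _))) (monotone x y)
  term : ∀ x y → 𝟙 (x₀ ℕₚ.≟ x) * (𝟙 (y₀ ℕₚ.≟ y) * 1ℚ) + ⟦ indicator A x y ⟧ ≤ ⟦ indicator (point x₀ y₀ ∷ A) x y ⟧
  term x y with x₀ ℕₚ.≟ x | y₀ ℕₚ.≟ y
  ... | yes refl | yes refl = new
  ... | yes refl | no _     = old x y (1ℚ * (0ℚ * 1ℚ)) refl
  ... | no _     | yes _    = old x y (0ℚ * (1ℚ * 1ℚ)) refl
  ... | no _     | no _     = old x y (0ℚ * (0ℚ * 1ℚ)) refl

clear-denominators : ∀ q K H ℓ a → ι ℓ ≤ count (2 ℕ.^ H) a → density H a ^ℚ q * ι H ≤ ι K →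
  ℓ ℕ.^ q ℕ.* H ℕ.≤ K ℕ.* (2 ℕ.^ H ℕ.* 2 ℕ.^ H) ℕ.^ q
clear-denominators q K H ℓ a ℓ≤ bound = ι-cancel-≤ (begin
  ι (ℓ ℕ.^ q ℕ.* H)                        ≡⟨ trans (ι-* (ℓ ℕ.^ q) H) (cong (_* ι H) (ι-^ ℓ q)) ⟩
  ι ℓ ^ℚ q * ι H                           ≤⟨ *-monoʳ-≤-nonNeg (ι H) {{nonNegative (0≤ι H)}} (^ℚ-mono q (0≤ι ℓ) (≤-trans ℓ≤ (≤-reflexive (count≡density H a)))) ⟩
  (density H a * (M * M)) ^ℚ q * ι H       ≡⟨ cong (_* ι H) (^ℚ-distrib (density H a) (M * M) q) ⟩
  density H a ^ℚ q * (M * M) ^ℚ q * ι H    ≡⟨ e (density H a ^ℚ q) ((M * M) ^ℚ q) (ι H) ⟩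
  density H a ^ℚ q * ι H * (M * M) ^ℚ q    ≤⟨ *-monoʳ-≤-nonNeg ((M * M) ^ℚ q) {{nonNegative (0≤^ q (0≤sq M))}} bound ⟩
  ι K * (M * M) ^ℚ q                       ≡⟨ sym (trans (ι-* K _) (cong (ι K *_) (trans (ι-^ (2 ℕ.^ H ℕ.* 2 ℕ.^ H) q) (cong (_^ℚ q) (ι-* (2 ℕ.^ H) (2 ℕ.^ H)))))) ⟩
  ι (K ℕ.* (2 ℕ.^ H ℕ.* 2 ℕ.^ H) ℕ.^ q) ∎)
  where
  open ≤-Reasoning
  M : ℚ
  M = ι (2 ℕ.^ H)
  e : ∀ a b c → a * b * c ≡ a * c * b
  e = solve-∀ ℚ-ring

^-distribʳ-* : ∀ a b q → (a ℕ.* b) ℕ.^ q ≡ a ℕ.^ q ℕ.* b ℕ.^ q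
^-distribʳ-* a b zero    = refl
^-distribʳ-* a b (suc q) = trans (cong (a ℕ.* b ℕ.*_) (^-distribʳ-* a b q)) (e a b (a ℕ.^ q) (b ℕ.^ q))
  where
  e : ∀ a b c d → a ℕ.* b ℕ.* (c ℕ.* d) ≡ a ℕ.* c ℕ.* (b ℕ.* d)
  e = ℕS.solve-∀

skew-corner-bound : ∀ q K → (∀ h a → SkewFree a → density h a ^ℚ q * ι h ≤ ι K) → ∀ n → n ℕ.≥ 1 →
  ∀ A → Unique A → All (InGrid n) A → SkewCornerFree A →
  length A ℕ.^ q ℕ.* ⌊log₂ n ⌋ ℕ.^ 1 ℕ.≤ (K ℕ.* 4 ℕ.^ q) ℕ.* n ℕ.^ (2 ℕ.* q)
skew-corner-bound q K bound n 1≤n A unique grid free =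
  -- The grid is enlarged to side 2 ^ H with n < 2 ^ H ≤ 2 n, which accounts for the factor 4 ^ q.
  let J , 2^J≤n , n<2^H = bracket (2 ℕ.^_) n n 1≤n (n<2^n n)
      H = suc J
      log≤H : ⌊log₂ n ⌋ ℕ.≤ H
      log≤H = ℕₚ.≤-trans (⌊log₂⌋-mono-≤ (ℕₚ.<⇒≤ n<2^H)) (ℕₚ.≤-reflexive (⌊log₂[2^n]⌋≡n H))
  in begin
    length A ℕ.^ q ℕ.* ⌊log₂ n ⌋ ℕ.^ 1           ≡⟨ cong (length A ℕ.^ q ℕ.*_) (ℕₚ.^-identityʳ ⌊log₂ n ⌋) ⟩
    length A ℕ.^ q ℕ.* ⌊log₂ n ⌋                 ≤⟨ ℕₚ.*-monoʳ-≤ (length A ℕ.^ q) log≤H ⟩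
    length A ℕ.^ q ℕ.* H
      ≤⟨ clear-denominators q K H (length A) (indicator A) (length≤count (2 ℕ.^ H) n A (ℕₚ.<⇒≤ n<2^H) unique grid)
           (bound H (indicator A) (indicator-SkewFree A free)) ⟩
    K ℕ.* (2 ℕ.^ H ℕ.* 2 ℕ.^ H) ℕ.^ q
      ≤⟨ ℕₚ.*-monoʳ-≤ K (ℕₚ.^-monoˡ-≤ q (ℕₚ.*-mono-≤ (ℕₚ.*-monoʳ-≤ 2 2^J≤n) (ℕₚ.*-monoʳ-≤ 2 2^J≤n))) ⟩
    K ℕ.* (2 ℕ.* n ℕ.* (2 ℕ.* n)) ℕ.^ q          ≡⟨ cong (λ t → K ℕ.* t ℕ.^ q) (e n) ⟩
    K ℕ.* (4 ℕ.* n ℕ.^ 2) ℕ.^ q                  ≡⟨ cong (K ℕ.*_) (trans (^-distribʳ-* 4 (n ℕ.^ 2) q) (cong (4 ℕ.^ q ℕ.*_) (ℕₚ.^-*-assoc n 2 q))) ⟩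
    K ℕ.* (4 ℕ.^ q ℕ.* n ℕ.^ (2 ℕ.* q))          ≡⟨ sym (ℕₚ.*-assoc K (4 ℕ.^ q) (n ℕ.^ (2 ℕ.* q))) ⟩
    K ℕ.* 4 ℕ.^ q ℕ.* n ℕ.^ (2 ℕ.* q) ∎
  where
  open ℕₚ.≤-Reasoning
  e : ∀ n → 2 ℕ.* n ℕ.* (2 ℕ.* n) ≡ 4 ℕ.* (n ℕ.* (n ℕ.* 1))
  e = ℕS.solve-∀

-- Here c₂ = p / q, realised with p = 1. Taking q-th roots gives |A| ≤ K ^ (1 / q) n² / ⌊log₂ n⌋ ^
-- (p / q), and ⌊log₂ n⌋ agrees with log n up to constant factors for n ≥ 2. Subsets of the grid are
-- lists without repetition, and bounding each of them bounds s(n).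
theorem2 : ∃[ p ] ∃[ q ] (p ℕ.≥ 1 × q ℕ.≥ 1 × ∃[ K ] ∃[ N ] (∀ (n : ℕ) → n ℕ.≥ N →
             ∀ (A : List (ℤ × ℤ)) → Unique A → All (InGrid n) A → SkewCornerFree A →
             length A ℕ.^ q ℕ.* ⌊log₂ n ⌋ ℕ.^ p ℕ.≤ K ℕ.* n ℕ.^ (2 ℕ.* q)))
theorem2 = let q , K , 1≤q , bound = density-bound 3 ℕₚ.≤-refl in
  1 , q , ℕₚ.≤-refl , 1≤q , K ℕ.* 4 ℕ.^ q , 1 , skew-corner-bound q K bound
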